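{- Let $f(x)\in K[x]$, let $c\in K$ be non-zero, and consider the curves $\mathcal C: y^n=f(x)$ and $\mathcal C': y^n=c\,f(x)$. For $d\mid n$ let $\mathcal C_d: y^d=f(x)$ and $\mathcal C_d': y^d=c\,f(x)$ be the corresponding quotient curves. Let $L=K[\sqrt[n]{c}]$, let $r=[L:K]$, and let $V_\ell^{(i)}(\mathrm{Jac}(\mathcal C_d))^{d\text{ -new}}$ and $V_\ell^{(i)}(\mathrm{Jac}(\mathcal C_d'))^{d\text{ -new}}$ denote the subspaces of the $d$-new parts on which $t$ acts as $\zeta_d^i$ (see the context). Let $\sigma\in\mathrm{Gal}(L/K)$ be the generator sending $\sqrt[n]{c}$ to $\zeta_n^{n/r}\sqrt[n]{c}$, and let $\chi:\mathrm{Gal}(L/K)\to\overline{\mathbb Q_\ell}$ denote the character sending $\sigma$ to $\zeta_n^{n/r}$. Then for all $1\le i\le n$ prime to $n$ we have $$V_\ell^{(i)}(\mathrm{Jac}(\mathcal C_d))^{d\text{ -new}}\simeq V_\ell^{(i)}(\mathrm{Jac}(\mathcal C_d'))^{d\text{ -new}}\otimes\chi^i .$$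
   Context: $K$ is the fraction field of a complete discrete valuation ring with residue field of characteristic $p$; $n$ is a positive integer with $p\nmid n$; $K$ contains a fixed primitive $n$-th root of unity $\zeta_n$, and roots of unity are chosen compatibly, so $\zeta_d=\zeta_n^{n/d}$ for $d\mid n$. The polynomial $f$ has nonzero discriminant and all its roots lie in $K$. $\ell\neq p$ is a prime. The chosen root of unity $\zeta_n$ is also regarded as an element of $\overline{\mathbb Q_\ell}$. For a curve, $V_\ell(\mathrm{Jac})=T_\ell(\mathrm{Jac})\otimes_{\mathbb Z_\ell}\mathbb Q_\ell$ is the rational $\ell$-adic Tate module of its Jacobian, with its action of $\mathrm{Gal}(\overline K/K)$. A generator $t$ of the group $\mu_n$ acts on $\mathcal C$ by $t\cdot(x,y)=(x,\zeta_n y)$. For $d\mid n$, the curve $\mathcal C_d$ is the quotient of $\mathcal C$ by $\mu_{n/d}$, via $(x,y)\mapsto(x,y^{n/d})$, so $t$ acts on $\mathcal C_d$ by $(x,y)\mapsto(x,\zeta_d y)$. This induces an action of $t$ on $V_\ell(\mathrm{Jac}(\mathcal C))$ and $V_\ell(\mathrm{Jac}(\mathcal C_d))$ through the endomorphisms of the Jacobians; it commutes with Galois because $\zeta_n\in K$. There is a decomposition $V_\ell(\mathrm{Jac}(\mathcal C))=\bigoplus_{d\mid n}V_\ell(\mathrm{Jac}(\mathcal C_d))^{d\text{ -new}}$, where the $d$-new part is the subspace on which $\mathbb Q_\ell[t]/\phi_d(t)$ acts, that is, on which $\phi_d(t)=0$, with $\phi_d$ the $d$-th cyclotomic polynomial.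 The $d$-new part decomposes further (with scalars extended to contain the $d$-th roots of unity) as a Galois module: $$V_\ell(\mathrm{Jac}(\mathcal C_d))^{d\text{ -new}}=\bigoplus_{1\le i\le d,\ \gcd(i,d)=1}V_\ell^{(i)}(\mathrm{Jac}(\mathcal C_d))^{d\text{ -new}},$$ where $t$ acts on $V_\ell^{(i)}$ as $\zeta_d^i$. The same definitions apply to $\mathcal C'$ and $\mathcal C_d'$. The character $\chi$ is viewed as a character of $\mathrm{Gal}(\overline K/K)$ through the quotient $\mathrm{Gal}(L/K)$, and the isomorphism is one of Galois representations.
   Formalization: For a proper divisor d of n the printed twist χ^i is false (K=ℚ_5, n=4, d=2, c=2, f=x³−x, i=1: determinants would force χ²=1); it is replaced by χ^{i·n/d}, which equals χ^i for d=n. The action of t on Jacobians is taken to be pullback. -}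

module Defs where

open import Algebra.Bundles using (CommutativeRing; Group; Semiring)
import Algebra.Construct.DirectProduct as DirectProduct
import Algebra.Definitions.RawSemiring as RawSemiringDefs
open import Algebra.Module.Bundles using (LeftModule)
open import Algebra.Module.Morphism.Structures using (module LeftModuleMorphisms)
open import Algebra.Morphism.Structures using (module RingMorphisms)
import Algebra.Properties.CommutativeSemiring.Exp as CommutativeExp
import Algebra.Properties.Group as GroupProperties
import Algebra.Properties.Monoid.Mult as Multiples
import Algebra.Properties.Ring as RingProperties
import Algebra.Solver.Ring.NaturalCoefficients.Default as Solver
open import Data.Bool.Base using (if_then_else_)
open import Data.Empty using (⊥; ⊥-elim)
open import Data.Fin.Base as Fin using (Fin; toℕ)
import Data.Fin.Properties as Finₚ
open import Data.Integer.Base as ℤ using (ℤ; 0ℤ; 1ℤ; +_; -[1+_])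
import Data.Integer.Divisibility.Signed as ℤᵈ
import Data.Integer.Properties as ℤₚ
open import Data.List.Base as List using (List; []; _∷_)
import Data.List.Membership.Setoid as Membership
import Data.List.Membership.Setoid.Properties as Membershipₚ
import Data.List.Relation.Unary.Unique.Setoid as UniqueList
import Data.List.Relation.Unary.Unique.Setoid.Properties as UniqueListₚ
open import Data.Maybe.Base as Maybe using (Maybe; just; nothing)
import Data.Maybe.Relation.Unary.All as MaybeAll
open import Data.Nat.Base as ℕ using (ℕ; zero; suc; NonZero)
import Data.Nat.Divisibility as ℕᵈ
import Data.Nat.DivMod as ℕ/
import Data.Nat.Properties as ℕₚ
open import Data.Product.Base using (Σ; ∃; _×_; _,_; proj₁; proj₂)
open import Data.Sum.Base using (_⊎_; inj₁; inj₂)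
open import Data.Unit.Base using (⊤; tt)
open import Data.Vec.Base as Vec using (Vec; []; _∷_)
open import Function.Base using (_∘_; id)
open import Function.Bundles using (_⇔_; mk⇔; Equivalence)
open import Level using (0ℓ)
open import Relation.Binary.Bundles using (Setoid)
open import Relation.Binary.Definitions using (tri<; tri≈; tri>)
open import Relation.Binary.PropositionalEquality as ≡ using (_≡_; _≢_)
import Relation.Binary.Reasoning.Setoid as SetoidReasoning
open import Relation.Nullary using (¬_; Dec; yes; no; ⌊_⌋)

CRing : Set₁
CRing = CommutativeRing 0ℓ 0ℓ

module Arithmetic (R : CRing) where
  open RawSemiringDefs (Semiring.rawSemiring (CommutativeRing.semiring R)) public
    using (_^_; _∣_; sum; product)
    renaming (_×_ to _×ᴿ_)

infix 1 _⟶_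

record _⟶_ (R S : CRing) : Set where
  private
    module R = CommutativeRing R
    module S = CommutativeRing S
  field
    ⟦_⟧                : R.Carrier → S.Carrier
    isRingHomomorphism : RingMorphisms.IsRingHomomorphism R.rawRing S.rawRing ⟦_⟧
  open RingMorphisms.IsRingHomomorphism isRingHomomorphism public

-- The dichotomy is the constructive form of "every nonzero element is
-- invertible"; classically it holds in every field.
record Field : Set₁ where
  field
    commutativeRing : CRing
  open CommutativeRing commutativeRing public
  field
    1≉0          : ¬ 1# ≈ 0#
    zero⊎inverse : ∀ x → x ≈ 0# ⊎ ∃ λ y → x * y ≈ 1#

∣_∣ : Field → CRing
∣_∣ = Field.commutativeRing

module _ (R : CRing) where
  open CommutativeRing R
  open Arithmetic R using (_^_; _×ᴿ_)

  IsRegular : Carrier → Set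
  IsRegular s = ∀ b → s * b ≈ 0# → b ≈ 0#

  IsPrimitiveRoot : ℕ → Carrier → Set
  IsPrimitiveRoot n ζ = (ζ ^ n ≈ 1#) × (∀ k → 0 ℕ.< k → k ℕ.< n → ¬ ζ ^ k ≈ 1#)

  fromℤ : ℤ → Carrier
  fromℤ (+ n)    = n ×ᴿ 1#
  fromℤ -[1+ n ] = - (suc n ×ᴿ 1#)

record IsFractionField {R : CRing} (K : Field) (ι : R ⟶ ∣ K ∣) : Set where
  private
    module R = CommutativeRing R
    module K = Field K
  open _⟶_ ι
  field
    injective : ∀ {a b} → ⟦ a ⟧ K.≈ ⟦ b ⟧ → a R.≈ b
    fraction  : ∀ z → ∃ λ a → ∃ λ s → (¬ s R.≈ R.0#) × (z K.* ⟦ s ⟧ K.≈ ⟦ a ⟧)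

record FractionField (R : CRing) : Set₁ where
  field
    field'          : Field
    ι               : R ⟶ ∣ field' ∣
    isFractionField : IsFractionField field' ι

record CompleteDVR : Set₁ where
  field
    commutativeRing : CRing
  open CommutativeRing commutativeRing public
  open Arithmetic commutativeRing using (_^_; _∣_; _×ᴿ_)
  field
    domain        : ∀ x y → x * y ≈ 0# → x ≈ 0# ⊎ y ≈ 0#
    π             : Carrier
    π≉0           : ¬ π ≈ 0#
    π∤1           : ¬ π ∣ 1#
    factorisation : ∀ x → x ≈ 0# ⊎ (∃ λ u → ∃ λ k → u ∣ 1# × x ≈ u * π ^ k)
    complete      : ∀ (a : ℕ → Carrier) → (∀ k → π ^ k ∣ (a (suc k) - a k)) →
                    ∃ λ l → ∀ k → π ^ k ∣ (l - a k)

  -- m · 1 vanishes in the residue field O/(π) exactly for the multiples m of p.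
  HasResidueCharacteristic : ℕ → Set
  HasResidueCharacteristic p = ∀ m → π ∣ (m ×ᴿ 1#) ⇔ p ℕᵈ.∣ m

record AlgebraicClosure (F : Field) : Set₁ where
  field
    closure : Field
    ι       : ∣ F ∣ ⟶ ∣ closure ∣
  private module F = Field F
  open Field closure
  open Arithmetic ∣ closure ∣ using (_^_; sum)
  open _⟶_ ι using (⟦_⟧)
  field
    closed    : ∀ m (a : Fin (suc m) → Carrier) →
                ∃ λ x → x ^ suc m + sum (λ j → a j * x ^ toℕ j) ≈ 0#
    algebraic : ∀ x → ∃ λ m → ∃ λ (a : Fin m → F.Carrier) →
                x ^ m + sum (λ j → ⟦ a j ⟧ * x ^ toℕ j) ≈ 0#

HasDegree : (F : Field) {E : CRing} → (∣ F ∣ ⟶ E) → ℕ → Set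
HasDegree F {E} ι r = ∃ λ (b : Fin r → E.Carrier) →
    (∀ z → ∃ λ (a : Fin r → F.Carrier) → z E.≈ sum (λ j → ⟦ a j ⟧ E.* b j))
  × (∀ (a : Fin r → F.Carrier) → sum (λ j → ⟦ a j ⟧ E.* b j) E.≈ E.0# → ∀ j → a j F.≈ F.0#)
  where
  module F = Field F
  module E = CommutativeRing E
  open Arithmetic E using (sum)
  open _⟶_ ι using (⟦_⟧)

infixl 6 _⊕_
infixl 7 _⊛_

data Expr (R : CRing) (X : Set) : Set where
  con : CommutativeRing.Carrier R → Expr R X
  var : X → Expr R X
  _⊕_ _⊛_ : Expr R X → Expr R X → Expr R X
  ⊝_  : Expr R X → Expr R X

module _ {R : CRing} {X : Set} where

  power : Expr R X → ℕ → Expr R X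
  power e zero    = con (CommutativeRing.1# R)
  power e (suc k) = e ⊛ power e k

  module _ {S : CRing} (φ : R ⟶ S) (ρ : X → CommutativeRing.Carrier S) where
    private module S = CommutativeRing S
    open _⟶_ φ using (⟦_⟧)

    eval : Expr R X → S.Carrier
    eval (con a)  = ⟦ a ⟧
    eval (var x)  = ρ x
    eval (e ⊕ e') = eval e S.+ eval e'
    eval (e ⊛ e') = eval e S.* eval e'
    eval (⊝ e)    = S.- eval e

module _ (R : CRing) {X : Set} (_≐_ : Expr R X → Expr R X → Set) where
  private module R = CommutativeRing R

  infix 4 _∼_

  -- The least R-algebra congruence containing _≐_.
  data _∼_ : Expr R X → Expr R X → Set where
    relation : ∀ {e e'} → e ≐ e' → e ∼ e'
    ∼-refl   : ∀ {e} → e ∼ e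
    ∼-sym    : ∀ {e e'} → e ∼ e' → e' ∼ e
    ∼-trans  : ∀ {e e' e''} → e ∼ e' → e' ∼ e'' → e ∼ e''
    con-cong : ∀ {a b} → a R.≈ b → con a ∼ con b
    ⊕-cong   : ∀ {e e' d d'} → e ∼ e' → d ∼ d' → e ⊕ d ∼ e' ⊕ d'
    ⊛-cong   : ∀ {e e' d d'} → e ∼ e' → d ∼ d' → e ⊛ d ∼ e' ⊛ d'
    ⊝-cong   : ∀ {e e'} → e ∼ e' → ⊝ e ∼ ⊝ e'
    con-+    : ∀ a b → con (a R.+ b) ∼ con a ⊕ con b
    con-*    : ∀ a b → con (a R.* b) ∼ con a ⊛ con b
    ⊕-assoc  : ∀ a b c → (a ⊕ b) ⊕ c ∼ a ⊕ (b ⊕ c)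
    ⊕-comm   : ∀ a b → a ⊕ b ∼ b ⊕ a
    ⊕-idˡ    : ∀ a → con R.0# ⊕ a ∼ a
    ⊕-invˡ   : ∀ a → ⊝ a ⊕ a ∼ con R.0#
    ⊛-assoc  : ∀ a b c → (a ⊛ b) ⊛ c ∼ a ⊛ (b ⊛ c)
    ⊛-comm   : ∀ a b → a ⊛ b ∼ b ⊛ a
    ⊛-idˡ    : ∀ a → con R.1# ⊛ a ∼ a
    distribˡ : ∀ a b c → a ⊛ (b ⊕ c) ∼ a ⊛ b ⊕ a ⊛ c

  presentedAlgebra : CRing
  presentedAlgebra = record
    { Carrier = Expr R X ; _≈_ = _∼_ ; _+_ = _⊕_ ; _*_ = _⊛_ ; -_ = ⊝_
    ; 0# = con R.0# ; 1# = con R.1#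
    ; isCommutativeRing = record
      { isRing = record
        { +-isAbelianGroup = record
          { isGroup = record
            { isMonoid = record
              { isSemigroup = record
                { isMagma = record
                  { isEquivalence = record { refl = ∼-refl ; sym = ∼-sym ; trans = ∼-trans }
                  ; ∙-cong = ⊕-cong }
                ; assoc = ⊕-assoc }
              ; identity = ⊕-idˡ , λ a → ∼-trans (⊕-comm _ _) (⊕-idˡ a) }
            ; inverse = ⊕-invˡ , λ a → ∼-trans (⊕-comm _ _) (⊕-invˡ a)
            ; ⁻¹-cong = ⊝-cong }
          ; comm = ⊕-comm }
        ; *-cong = ⊛-cong
        ; *-assoc = ⊛-assoc
        ; *-identity = ⊛-idˡ , λ a → ∼-trans (⊛-comm _ _) (⊛-idˡ a)
        ; distrib = distribˡ , λ a b c → ∼-trans (⊛-comm _ _)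
                      (∼-trans (distribˡ a b c) (⊕-cong (⊛-comm _ _) (⊛-comm _ _))) }
      ; *-comm = ⊛-comm } }

  module _ {S : CRing} (φ : R ⟶ S) (ρ : X → CommutativeRing.Carrier S) where
    private
      module S = CommutativeRing S
      module φ = _⟶_ φ

    eval-cong : (∀ {e e'} → e ≐ e' → eval φ ρ e S.≈ eval φ ρ e') →
                ∀ {e e'} → e ∼ e' → eval φ ρ e S.≈ eval φ ρ e'
    eval-cong r (relation p)      = r p
    eval-cong r ∼-refl            = S.refl
    eval-cong r (∼-sym p)         = S.sym (eval-cong r p)
    eval-cong r (∼-trans p q)     = S.trans (eval-cong r p) (eval-cong r q)
    eval-cong r (con-cong p)      = φ.⟦⟧-cong p
    eval-cong r (⊕-cong p q)      = S.+-cong (eval-cong r p) (eval-cong r q)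
    eval-cong r (⊛-cong p q)      = S.*-cong (eval-cong r p) (eval-cong r q)
    eval-cong r (⊝-cong p)        = S.-‿cong (eval-cong r p)
    eval-cong r (con-+ a b)       = φ.+-homo a b
    eval-cong r (con-* a b)       = φ.*-homo a b
    eval-cong r (⊕-assoc a b c)   = S.+-assoc _ _ _
    eval-cong r (⊕-comm a b)      = S.+-comm _ _
    eval-cong r (⊕-idˡ a)         = S.trans (S.+-congʳ φ.0#-homo) (S.+-identityˡ _)
    eval-cong r (⊕-invˡ a)        = S.trans (S.-‿inverseˡ _) (S.sym φ.0#-homo)
    eval-cong r (⊛-assoc a b c)   = S.*-assoc _ _ _
    eval-cong r (⊛-comm a b)      = S.*-comm _ _
    eval-cong r (⊛-idˡ a)         = S.trans (S.*-congʳ φ.1#-homo) (S.*-identityˡ _)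
    eval-cong r (distribˡ a b c)  = S.distribˡ _ _ _

_[X] : CRing → CRing
R [X] = presentedAlgebra R {⊤} (λ _ _ → ⊥)

-- f splits over K with leading coefficient a and roots r₀, …, rₘ; the degree
-- is m + 1.
record Splitting (K : Field) (f : Expr (∣ K ∣) ⊤) : Set where
  open Field K
  open Arithmetic ∣ K ∣ using (_^_; product)
  private
    module P = CommutativeRing (∣ K ∣ [X])
    module ΠP = Arithmetic (∣ K ∣ [X])
  field
    m             : ℕ
    lead          : Carrier
    lead≉0        : ¬ lead ≈ 0#
    root          : Fin (suc m) → Carrier
    factorisation : f P.≈ con lead P.* ΠP.product (λ j → var tt P.- con (root j))

  -- a^(2 deg f - 2) ∏_{i<j} (rᵢ - rⱼ)²
  discriminant : Carrier
  discriminant = lead ^ (2 ℕ.* m) *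
    product (λ i → product (λ j →
      if ⌊ i Finₚ.<? j ⌋ then (root i - root j) ^ 2 else 1#))

module _ (R S : CRing) where
  private
    module R = CommutativeRing R
    module S = CommutativeRing S

  ringHomomorphism : (f : R.Carrier → S.Carrier) →
    (∀ {a b} → a R.≈ b → f a S.≈ f b) →
    (∀ a b → f (a R.+ b) S.≈ f a S.+ f b) →
    (∀ a b → f (a R.* b) S.≈ f a S.* f b) →
    f R.1# S.≈ S.1# →
    RingMorphisms.IsRingHomomorphism R.rawRing S.rawRing f
  ringHomomorphism f f-cong f-+ f-* f-1 = record
    { isSemiringHomomorphism = record
      { isNearSemiringHomomorphism = record
        { +-isMonoidHomomorphism = record
          { isMagmaHomomorphism = record
            { isRelHomomorphism = record { cong = f-cong }
            ; homo = f-+ }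
          ; ε-homo = f-0 }
        ; *-homo = f-* }
      ; 1#-homo = f-1 }
    ; -‿homo = λ a → GroupProperties.inverseʳ-unique S.+-group (f a) (f (R.- a))
                 (S.trans (S.sym (f-+ _ _)) (S.trans (f-cong (R.-‿inverseʳ a)) f-0)) }
    where
    f-0 : f R.0# S.≈ S.0#
    f-0 = RingProperties.x+x≈x⇒x≈0 S.ring (f R.0#)
            (S.trans (S.sym (f-+ _ _)) (f-cong (R.+-identityˡ R.0#)))

hom-^ : ∀ {R S : CRing} (φ : R ⟶ S) a k → let open CommutativeRing S using (_≈_) in
  Arithmetic._^_ S (_⟶_.⟦_⟧ φ a) k ≈ _⟶_.⟦_⟧ φ (Arithmetic._^_ R a k)
hom-^ {S = S} φ a zero    = CommutativeRing.sym S (_⟶_.1#-homo φ)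
hom-^ {S = S} φ a (suc k) = S.trans (S.*-congˡ (hom-^ φ a k)) (S.sym (_⟶_.*-homo φ _ _))
  where module S = CommutativeRing S

module Fractions (A : CRing) where
  open CommutativeRing A
  open Solver commutativeSemiring using (solve; _:+_; _:*_; _:=_)
  open SetoidReasoning setoid

  record Fraction : Set where
    constructor _/_⟨_⟩
    field
      num     : Carrier
      den     : Carrier
      regular : IsRegular A den
  open Fraction public

  infix 4 _≈ᶠ_
  record _≈ᶠ_ (x y : Fraction) : Set where
    constructor cross
    field uncross : num x * den y ≈ num y * den x
  open _≈ᶠ_ public

  1-regular : IsRegular A 1#
  1-regular b p = trans (sym (*-identityˡ b)) p

  *-regular : ∀ {s t} → IsRegular A s → IsRegular A t → IsRegular A (s * t)
  *-regular {s} {t} hs ht b p = ht b (hs (t * b) (trans (sym (*-assoc s t b)) p))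

  cancel : ∀ {s a b} → IsRegular A s → s * a ≈ s * b → a ≈ b
  cancel {s} {a} {b} hs p = GroupProperties.x∙y⁻¹≈ε⇒x≈y +-group a b (hs (a - b)
    (trans (RingProperties.x[y-z]≈xy-xz ring s a b)
           (GroupProperties.x≈y⇒x∙y⁻¹≈ε +-group p)))

  private
    ≈ᶠ-trans : ∀ {x y z} → x ≈ᶠ y → y ≈ᶠ z → x ≈ᶠ z
    ≈ᶠ-trans {a / s ⟨ _ ⟩} {b / t ⟨ ht ⟩} {c / u ⟨ _ ⟩} (cross p) (cross q) =
      cross (cancel ht (begin
        t * (a * u)  ≈⟨ solve 3 (λ t a u → t :* (a :* u) := (a :* t) :* u) refl t a u ⟩
        (a * t) * u  ≈⟨ *-congʳ p ⟩
        (b * s) * u  ≈⟨ solve 3 (λ b s u → (b :* s) :* u := (b :* u) :* s) refl b s u ⟩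
        (b * u) * s  ≈⟨ *-congʳ q ⟩
        (c * t) * s  ≈⟨ solve 3 (λ c t s → (c :* t) :* s := t :* (c :* s)) refl c t s ⟩
        t * (c * s)  ∎))

  _+ᶠ_ _*ᶠ_ : Fraction → Fraction → Fraction
  (a / s ⟨ hs ⟩) +ᶠ (b / t ⟨ ht ⟩) = (a * t + b * s) / (s * t) ⟨ *-regular hs ht ⟩
  (a / s ⟨ hs ⟩) *ᶠ (b / t ⟨ ht ⟩) = (a * b) / (s * t) ⟨ *-regular hs ht ⟩

  -ᶠ_ : Fraction → Fraction
  -ᶠ (a / s ⟨ hs ⟩) = (- a) / s ⟨ hs ⟩

  base : Carrier → Fraction
  base a = a / 1# ⟨ 1-regular ⟩

  private
    +ᶠ-cong : ∀ {x x' y y'} → x ≈ᶠ x' → y ≈ᶠ y' → x +ᶠ y ≈ᶠ x' +ᶠ y'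
    +ᶠ-cong {a / s ⟨ _ ⟩} {a' / s' ⟨ _ ⟩} {b / t ⟨ _ ⟩} {b' / t' ⟨ _ ⟩} (cross p) (cross q) =
      cross (begin
        (a * t + b * s) * (s' * t')
          ≈⟨ solve 6 (λ a s t b s' t' → (a :* t :+ b :* s) :* (s' :* t')
               := (a :* s') :* (t :* t') :+ (b :* t') :* (s :* s')) refl a s t b s' t' ⟩
        (a * s') * (t * t') + (b * t') * (s * s')
          ≈⟨ +-cong (*-congʳ p) (*-congʳ q) ⟩
        (a' * s) * (t * t') + (b' * t) * (s * s')
          ≈⟨ solve 6 (λ a' s t b' s' t' → (a' :* s) :* (t :* t') :+ (b' :* t) :* (s :* s')
               := (a' :* t' :+ b' :* s') :* (s :* t)) refl a' s t b' s' t' ⟩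
        (a' * t' + b' * s') * (s * t) ∎)

    *ᶠ-cong : ∀ {x x' y y'} → x ≈ᶠ x' → y ≈ᶠ y' → x *ᶠ y ≈ᶠ x' *ᶠ y'
    *ᶠ-cong {a / s ⟨ _ ⟩} {a' / s' ⟨ _ ⟩} {b / t ⟨ _ ⟩} {b' / t' ⟨ _ ⟩} (cross p) (cross q) =
      cross (begin
        (a * b) * (s' * t')
          ≈⟨ solve 4 (λ a b s' t' → (a :* b) :* (s' :* t') := (a :* s') :* (b :* t')) refl a b s' t' ⟩
        (a * s') * (b * t')  ≈⟨ *-cong p q ⟩
        (a' * s) * (b' * t)
          ≈⟨ solve 4 (λ a' b' s t → (a' :* s) :* (b' :* t) := (a' :* b') :* (s :* t)) refl a' b' s t ⟩
        (a' * b') * (s * t)  ∎)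

    -ᶠ-cong : ∀ {x x'} → x ≈ᶠ x' → -ᶠ x ≈ᶠ -ᶠ x'
    -ᶠ-cong {a / s ⟨ _ ⟩} {a' / s' ⟨ _ ⟩} (cross p) =
      cross (trans (sym (RingProperties.-‿distribˡ-* ring a s'))
               (trans (-‿cong p) (RingProperties.-‿distribˡ-* ring a' s)))

    ≈ᶠ-of : ∀ {x y} → num x ≈ num y → den x ≈ den y → x ≈ᶠ y
    ≈ᶠ-of p q = cross (*-cong p (sym q))

    +ᶠ-comm : ∀ x y → x +ᶠ y ≈ᶠ y +ᶠ x
    +ᶠ-comm _ _ = ≈ᶠ-of (+-comm _ _) (*-comm _ _)

    *ᶠ-comm : ∀ x y → x *ᶠ y ≈ᶠ y *ᶠ x
    *ᶠ-comm _ _ = ≈ᶠ-of (*-comm _ _) (*-comm _ _)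

    +ᶠ-idˡ : ∀ x → base 0# +ᶠ x ≈ᶠ x
    +ᶠ-idˡ _ = ≈ᶠ-of (trans (+-cong (zeroˡ _) (*-identityʳ _)) (+-identityˡ _)) (*-identityˡ _)

    +ᶠ-invˡ : ∀ x → (-ᶠ x) +ᶠ x ≈ᶠ base 0#
    +ᶠ-invˡ (a / s ⟨ _ ⟩) = cross (begin
      (- a * s + a * s) * 1#  ≈⟨ *-identityʳ _ ⟩
      - a * s + a * s         ≈⟨ distribʳ s (- a) a ⟨
      (- a + a) * s           ≈⟨ *-congʳ (-‿inverseˡ a) ⟩
      0# * s                  ≈⟨ zeroˡ _ ⟩
      0#                      ≈⟨ zeroˡ _ ⟨
      0# * (s * s)            ∎)

    *ᶠ-idˡ : ∀ x → base 1# *ᶠ x ≈ᶠ x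
    *ᶠ-idˡ _ = ≈ᶠ-of (*-identityˡ _) (*-identityˡ _)

    +ᶠ-assoc : ∀ x y z → (x +ᶠ y) +ᶠ z ≈ᶠ x +ᶠ (y +ᶠ z)
    +ᶠ-assoc (a / s ⟨ _ ⟩) (b / t ⟨ _ ⟩) (c / u ⟨ _ ⟩) = ≈ᶠ-of
      (solve 6 (λ a b c s t u → (a :* t :+ b :* s) :* u :+ c :* (s :* t)
         := a :* (t :* u) :+ (b :* u :+ c :* t) :* s) refl a b c s t u)
      (*-assoc s t u)

    distribˡᶠ : ∀ x y z → x *ᶠ (y +ᶠ z) ≈ᶠ (x *ᶠ y) +ᶠ (x *ᶠ z)
    distribˡᶠ (a / s ⟨ _ ⟩) (b / t ⟨ _ ⟩) (c / u ⟨ _ ⟩) = cross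
      (solve 6 (λ a b c s t u → (a :* (b :* u :+ c :* t)) :* ((s :* t) :* (s :* u))
         := ((a :* b) :* (s :* u) :+ (a :* c) :* (s :* t)) :* (s :* (t :* u))) refl a b c s t u)

  totalFractions : CRing
  totalFractions = record
    { Carrier = Fraction ; _≈_ = _≈ᶠ_ ; _+_ = _+ᶠ_ ; _*_ = _*ᶠ_ ; -_ = -ᶠ_
    ; 0# = base 0# ; 1# = base 1#
    ; isCommutativeRing = record
      { isRing = record
        { +-isAbelianGroup = record
          { isGroup = record
            { isMonoid = record
              { isSemigroup = record
                { isMagma = record
                  { isEquivalence = record
                    { refl = cross refl ; sym = λ p → cross (sym (uncross p)) ; trans = ≈ᶠ-trans }
                  ; ∙-cong = +ᶠ-cong }
                ; assoc = +ᶠ-assoc }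
              ; identity = +ᶠ-idˡ , λ a → ≈ᶠ-trans (+ᶠ-comm a (base 0#)) (+ᶠ-idˡ a) }
            ; inverse = +ᶠ-invˡ , λ a → ≈ᶠ-trans (+ᶠ-comm a (-ᶠ a)) (+ᶠ-invˡ a)
            ; ⁻¹-cong = -ᶠ-cong }
          ; comm = +ᶠ-comm }
        ; *-cong = *ᶠ-cong
        ; *-assoc = λ _ _ _ → ≈ᶠ-of (*-assoc _ _ _) (*-assoc _ _ _)
        ; *-identity = *ᶠ-idˡ , λ a → ≈ᶠ-trans (*ᶠ-comm a (base 1#)) (*ᶠ-idˡ a)
        ; distrib = distribˡᶠ , λ a b c → ≈ᶠ-trans (*ᶠ-comm (b +ᶠ c) a)
                      (≈ᶠ-trans (distribˡᶠ a b c) (+ᶠ-cong (*ᶠ-comm a b) (*ᶠ-comm a c))) }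
      ; *-comm = *ᶠ-comm } }

  base-hom : A ⟶ totalFractions
  base-hom = record
    { ⟦_⟧ = base
    ; isRingHomomorphism = ringHomomorphism A totalFractions base
        (λ p → ≈ᶠ-of p refl)
        (λ _ _ → ≈ᶠ-of (+-cong (sym (*-identityʳ _)) (sym (*-identityʳ _))) (sym (*-identityʳ _)))
        (λ _ _ → ≈ᶠ-of refl (sym (*-identityʳ _)))
        (≈ᶠ-of refl refl) }

open Fractions using (totalFractions)

Grp : Set₁
Grp = Group 0ℓ 0ℓ

record RingAction (Γ : Grp) (A : CRing) : Set where
  private
    module Γ = Group Γ
    module A = CommutativeRing A
  field
    act     : Γ.Carrier → A.Carrier → A.Carrier
    act-cong : ∀ {g h a b} → g Γ.≈ h → a A.≈ b → act g a A.≈ act h b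
    act-hom : ∀ g → RingMorphisms.IsRingHomomorphism A.rawRing A.rawRing (act g)
    act-ε   : ∀ a → act Γ.ε a A.≈ a
    act-∙   : ∀ g h a → act (g Γ.∙ h) a A.≈ act g (act h a)

  act-inverseʳ : ∀ g a → act g (act (g Γ.⁻¹) a) A.≈ a
  act-inverseʳ g a = A.trans (A.sym (act-∙ _ _ _)) (A.trans (act-cong (Γ.inverseʳ g) A.refl) (act-ε a))

  act-inverseˡ : ∀ g a → act (g Γ.⁻¹) (act g a) A.≈ a
  act-inverseˡ g a = A.trans (A.sym (act-∙ _ _ _)) (A.trans (act-cong (Γ.inverseˡ g) A.refl) (act-ε a))

module _ {Γ : Grp} {A : CRing} (α : RingAction Γ A) where
  private
    module Γ = Group Γ
    module A = CommutativeRing A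
    module Hom g = RingMorphisms.IsRingHomomorphism (RingAction.act-hom α g)
  open RingAction α
  open Fractions A hiding (totalFractions)

  private
    act-regular : ∀ g {s} → IsRegular A s → IsRegular A (act g s)
    act-regular g {s} hs b p = A.trans (A.sym (act-inverseʳ g b))
      (A.trans (act-cong Γ.refl (hs _ (A.trans (A.sym (act-inverseˡ g _))
        (A.trans (act-cong Γ.refl (A.trans (Hom.*-homo g _ _)
            (A.trans (A.*-congˡ (act-inverseʳ g b)) p)))
          (Hom.0#-homo (g Γ.⁻¹))))))
        (Hom.0#-homo g))

    actᶠ : Γ.Carrier → Fraction → Fraction
    actᶠ g (a / s ⟨ hs ⟩) = act g a / act g s ⟨ act-regular g hs ⟩

    actᶠ-cong : ∀ {g h x y} → g Γ.≈ h → x ≈ᶠ y → actᶠ g x ≈ᶠ actᶠ h y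
    actᶠ-cong {g} {h} gh (cross p) = cross (A.trans (A.*-congˡ (act-cong (Γ.sym gh) A.refl))
      (A.trans (A.sym (Hom.*-homo g _ _)) (A.trans (act-cong Γ.refl p)
        (A.trans (Hom.*-homo g _ _) (A.*-congʳ (act-cong gh A.refl))))))

    ≈ᶠ-of : ∀ {x y} → num x A.≈ num y → den x A.≈ den y → x ≈ᶠ y
    ≈ᶠ-of p q = cross (A.*-cong p (A.sym q))

  fractionAction : RingAction Γ (totalFractions A)
  fractionAction = record
    { act = actᶠ
    ; act-cong = actᶠ-cong
    ; act-hom = λ g → ringHomomorphism (totalFractions A) (totalFractions A) (actᶠ g)
        (actᶠ-cong Γ.refl)
        (λ _ _ → ≈ᶠ-of (A.trans (Hom.+-homo g _ _) (A.+-cong (Hom.*-homo g _ _) (Hom.*-homo g _ _)))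
                       (Hom.*-homo g _ _))
        (λ _ _ → ≈ᶠ-of (Hom.*-homo g _ _) (Hom.*-homo g _ _))
        (≈ᶠ-of (Hom.1#-homo g) (Hom.1#-homo g))
    ; act-ε = λ _ → ≈ᶠ-of (act-ε _) (act-ε _)
    ; act-∙ = λ g h _ → ≈ᶠ-of (act-∙ g h _) (act-∙ g h _) }

record Automorphism {R S : CRing} (ι : R ⟶ S) : Set where
  private
    module S = CommutativeRing S
  field
    to                : S.Carrier → S.Carrier
    isRingIsomorphism : RingMorphisms.IsRingIsomorphism S.rawRing S.rawRing to
    fixes             : ∀ a → to (_⟶_.⟦_⟧ ι a) S.≈ _⟶_.⟦_⟧ ι a

  open RingMorphisms.IsRingIsomorphism isRingIsomorphism public

  from : S.Carrier → S.Carrier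
  from y = proj₁ (surjective y)

  to-from : ∀ y → to (from y) S.≈ y
  to-from y = proj₂ (surjective y) S.refl

module _ {R S : CRing} (ι : R ⟶ S) where
  private
    module S = CommutativeRing S
    module ι = _⟶_ ι
    open Automorphism

    automorphism : (f g : S.Carrier → S.Carrier) →
      RingMorphisms.IsRingHomomorphism S.rawRing S.rawRing f →
      (∀ {x y} → x S.≈ y → g x S.≈ g y) →
      (∀ x → g (f x) S.≈ x) → (∀ x → f (g x) S.≈ x) →
      (∀ a → f (ι.⟦ a ⟧) S.≈ ι.⟦ a ⟧) → Automorphism ι
    automorphism f g f-hom g-cong gf fg fix = record
      { to = f
      ; isRingIsomorphism = record
        { isRingMonomorphism = record
          { isRingHomomorphism = f-hom
          ; injective = λ {x} {y} p → S.trans (S.sym (gf x)) (S.trans (g-cong p) (gf y)) }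
        ; surjective = λ y → g y , λ p → S.trans (f-cong p) (fg y) }
      ; fixes = fix }
      where open RingMorphisms.IsRingHomomorphism f-hom using () renaming (⟦⟧-cong to f-cong)

    from-to : (σ : Automorphism ι) → ∀ x → from σ (to σ x) S.≈ x
    from-to σ x = injective σ (to-from σ (to σ x))

    from-cong : (σ : Automorphism ι) → ∀ {x y} → x S.≈ y → from σ x S.≈ from σ y
    from-cong σ p = injective σ (S.trans (to-from σ _) (S.trans p (S.sym (to-from σ _))))

    identity : Automorphism ι
    identity = automorphism id id (ringHomomorphism S S id id (λ _ _ → S.refl) (λ _ _ → S.refl) S.refl)
      id (λ _ → S.refl) (λ _ → S.refl) (λ _ → S.refl)

    compose : Automorphism ι → Automorphism ι → Automorphism ι
    compose σ τ = automorphism (to σ ∘ to τ) (from τ ∘ from σ)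
      (ringHomomorphism S S (to σ ∘ to τ) (⟦⟧-cong σ ∘ ⟦⟧-cong τ)
        (λ _ _ → S.trans (⟦⟧-cong σ (+-homo τ _ _)) (+-homo σ _ _))
        (λ _ _ → S.trans (⟦⟧-cong σ (*-homo τ _ _)) (*-homo σ _ _))
        (S.trans (⟦⟧-cong σ (1#-homo τ)) (1#-homo σ)))
      (from-cong τ ∘ from-cong σ)
      (λ x → S.trans (from-cong τ (from-to σ _)) (from-to τ x))
      (λ x → S.trans (⟦⟧-cong σ (to-from τ _)) (to-from σ x))
      (λ a → S.trans (⟦⟧-cong σ (fixes τ a)) (fixes σ a))

    invert : Automorphism ι → Automorphism ι
    invert σ = automorphism (from σ) (to σ)
      (ringHomomorphism S S (from σ) (from-cong σ)
        (λ a b → injective σ (S.trans (to-from σ _) (S.sym (S.trans (+-homo σ _ _)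
           (S.+-cong (to-from σ a) (to-from σ b))))))
        (λ a b → injective σ (S.trans (to-from σ _) (S.sym (S.trans (*-homo σ _ _)
           (S.*-cong (to-from σ a) (to-from σ b))))))
        (injective σ (S.trans (to-from σ _) (S.sym (1#-homo σ)))))
      (⟦⟧-cong σ) (to-from σ) (from-to σ)
      (λ a → injective σ (S.trans (to-from σ _) (S.sym (fixes σ a))))

  Aut : Grp
  Aut = record
    { Carrier = Automorphism ι
    ; _≈_ = λ σ τ → ∀ x → to σ x S.≈ to τ x
    ; _∙_ = compose
    ; ε = identity
    ; _⁻¹ = invert
    ; isGroup = record
      { isMonoid = record
        { isSemigroup = record
          { isMagma = record
            { isEquivalence = record
              { refl = λ _ → S.refl
              ; sym = λ p x → S.sym (p x)
              ; trans = λ p q x → S.trans (p x) (q x) }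
            ; ∙-cong = λ {σ} {σ'} p q x → S.trans (⟦⟧-cong σ (q x)) (p _) }
          ; assoc = λ _ _ _ _ → S.refl }
        ; identity = (λ _ _ → S.refl) , (λ _ _ → S.refl) }
      ; inverse = from-to , to-from
      ; ⁻¹-cong = λ {σ} {τ} p x → injective σ (S.trans (to-from σ x)
          (S.sym (S.trans (p _) (to-from τ x)))) } }

infixl 6 _⊞_
infixr 7 _·_

data Lin (R : CRing) (X : Set) : Set where
  gen : X → Lin R X
  𝟎   : Lin R X
  _⊞_ : Lin R X → Lin R X → Lin R X
  ⊟_  : Lin R X → Lin R X
  _·_ : CommutativeRing.Carrier R → Lin R X → Lin R X

module _ {R : CRing} {X Y : Set} (f : X → Y) where

  mapLin : Lin R X → Lin R Y
  mapLin (gen x) = gen (f x)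
  mapLin 𝟎       = 𝟎
  mapLin (s ⊞ t) = mapLin s ⊞ mapLin t
  mapLin (⊟ t)   = ⊟ mapLin t
  mapLin (a · t) = a · mapLin t

Mod : CRing → Set₁
Mod R = LeftModule (CommutativeRing.ring R) 0ℓ 0ℓ

module _ (R : CRing) {X : Set} (_≐_ : Lin R X → Lin R X → Set) where
  private module R = CommutativeRing R

  infix 4 _≋_

  -- The least R-module congruence containing _≐_.
  data _≋_ : Lin R X → Lin R X → Set where
    relation : ∀ {s t} → s ≐ t → s ≋ t
    ≋-refl   : ∀ {t} → t ≋ t
    ≋-sym    : ∀ {s t} → s ≋ t → t ≋ s
    ≋-trans  : ∀ {s t u} → s ≋ t → t ≋ u → s ≋ u
    ⊞-cong   : ∀ {s s' t t'} → s ≋ s' → t ≋ t' → s ⊞ t ≋ s' ⊞ t'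
    ⊟-cong   : ∀ {s t} → s ≋ t → ⊟ s ≋ ⊟ t
    ·-cong   : ∀ {a b s t} → a R.≈ b → s ≋ t → a · s ≋ b · t
    ⊞-assoc  : ∀ s t u → (s ⊞ t) ⊞ u ≋ s ⊞ (t ⊞ u)
    ⊞-comm   : ∀ s t → s ⊞ t ≋ t ⊞ s
    ⊞-idˡ    : ∀ t → 𝟎 ⊞ t ≋ t
    ⊞-invˡ   : ∀ t → ⊟ t ⊞ t ≋ 𝟎
    ·-zeroˡ  : ∀ t → R.0# · t ≋ 𝟎
    ·-zeroʳ  : ∀ a → a · 𝟎 ≋ 𝟎
    ·-distʳ  : ∀ t a b → (a R.+ b) · t ≋ a · t ⊞ b · t
    ·-distˡ  : ∀ a s t → a · (s ⊞ t) ≋ a · s ⊞ a · t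
    ·-one    : ∀ t → R.1# · t ≋ t
    ·-assoc  : ∀ a b t → (a R.* b) · t ≋ a · (b · t)

  presentedModule : Mod R
  presentedModule = record
    { Carrierᴹ = Lin R X ; _≈ᴹ_ = _≋_ ; _+ᴹ_ = _⊞_ ; _*ₗ_ = _·_ ; 0ᴹ = 𝟎 ; -ᴹ_ = ⊟_
    ; isLeftModule = record
      { isLeftSemimodule = record
        { +ᴹ-isCommutativeMonoid = record
          { isMonoid = record
            { isSemigroup = record
              { isMagma = record
                { isEquivalence = record { refl = ≋-refl ; sym = ≋-sym ; trans = ≋-trans }
                ; ∙-cong = ⊞-cong }
              ; assoc = ⊞-assoc }
            ; identity = ⊞-idˡ , λ t → ≋-trans (⊞-comm _ _) (⊞-idˡ t) }
          ; comm = ⊞-comm }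
        ; isPreleftSemimodule = record
          { *ₗ-cong = ·-cong
          ; *ₗ-zeroˡ = ·-zeroˡ
          ; *ₗ-distribʳ = ·-distʳ
          ; *ₗ-identityˡ = ·-one
          ; *ₗ-assoc = ·-assoc
          ; *ₗ-zeroʳ = ·-zeroʳ
          ; *ₗ-distribˡ = ·-distˡ } }
      ; -ᴹ‿cong = ⊟-cong
      ; -ᴹ‿inverse = ⊞-invˡ , λ t → ≋-trans (⊞-comm _ _) (⊞-invˡ t) } }

  module _ (f : X → X) (r : ∀ {s t} → s ≐ t → mapLin f s ≋ mapLin f t) where

    mapLin-cong : ∀ {s t} → s ≋ t → mapLin f s ≋ mapLin f t
    mapLin-cong (relation p)    = r p
    mapLin-cong ≋-refl          = ≋-refl
    mapLin-cong (≋-sym p)       = ≋-sym (mapLin-cong p)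
    mapLin-cong (≋-trans p q)   = ≋-trans (mapLin-cong p) (mapLin-cong q)
    mapLin-cong (⊞-cong p q)    = ⊞-cong (mapLin-cong p) (mapLin-cong q)
    mapLin-cong (⊟-cong p)      = ⊟-cong (mapLin-cong p)
    mapLin-cong (·-cong p q)    = ·-cong p (mapLin-cong q)
    mapLin-cong (⊞-assoc _ _ _) = ⊞-assoc _ _ _
    mapLin-cong (⊞-comm _ _)    = ⊞-comm _ _
    mapLin-cong (⊞-idˡ _)       = ⊞-idˡ _
    mapLin-cong (⊞-invˡ _)      = ⊞-invˡ _
    mapLin-cong (·-zeroˡ _)     = ·-zeroˡ _
    mapLin-cong (·-zeroʳ _)     = ·-zeroʳ _
    mapLin-cong (·-distʳ _ _ _) = ·-distʳ _ _ _
    mapLin-cong (·-distˡ _ _ _) = ·-distˡ _ _ _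
    mapLin-cong (·-one _)       = ·-one _
    mapLin-cong (·-assoc _ _ _) = ·-assoc _ _ _

  mapLin-ext : (f g : X → X) → (∀ x → gen (f x) ≋ gen (g x)) → ∀ t → mapLin f t ≋ mapLin g t
  mapLin-ext f g p (gen x) = p x
  mapLin-ext f g p 𝟎       = ≋-refl
  mapLin-ext f g p (s ⊞ t) = ⊞-cong (mapLin-ext f g p s) (mapLin-ext f g p t)
  mapLin-ext f g p (⊟ t)   = ⊟-cong (mapLin-ext f g p t)
  mapLin-ext f g p (a · t) = ·-cong R.refl (mapLin-ext f g p t)

mapLin-id : ∀ {R : CRing} {X : Set} (t : Lin R X) → mapLin id t ≡ t
mapLin-id (gen x) = ≡.refl
mapLin-id 𝟎       = ≡.refl
mapLin-id (s ⊞ t) = ≡.cong₂ _⊞_ (mapLin-id s) (mapLin-id t)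
mapLin-id (⊟ t)   = ≡.cong ⊟_ (mapLin-id t)
mapLin-id (a · t) = ≡.cong (a ·_) (mapLin-id t)

mapLin-∘ : ∀ {R : CRing} {X : Set} (f g : X → X) (t : Lin R X) →
           mapLin (f ∘ g) t ≡ mapLin f (mapLin g t)
mapLin-∘ f g (gen x) = ≡.refl
mapLin-∘ f g 𝟎       = ≡.refl
mapLin-∘ f g (s ⊞ t) = ≡.cong₂ _⊞_ (mapLin-∘ f g s) (mapLin-∘ f g t)
mapLin-∘ f g (⊟ t)   = ≡.cong ⊟_ (mapLin-∘ f g t)
mapLin-∘ f g (a · t) = ≡.cong (a ·_) (mapLin-∘ f g t)

module _ (R : CRing) (M N : Mod R) where
  private
    module M = LeftModule M
    module N = LeftModule N

  record IsLinear (f : M.Carrierᴹ → N.Carrierᴹ) : Set where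
    field
      isLeftModuleHomomorphism :
        LeftModuleMorphisms.IsLeftModuleHomomorphism M.rawLeftModule N.rawLeftModule f
    open LeftModuleMorphisms.IsLeftModuleHomomorphism isLeftModuleHomomorphism public

  record IsLinearIso (f : M.Carrierᴹ → N.Carrierᴹ) : Set where
    field
      isLeftModuleIsomorphism :
        LeftModuleMorphisms.IsLeftModuleIsomorphism M.rawLeftModule N.rawLeftModule f
    open LeftModuleMorphisms.IsLeftModuleIsomorphism isLeftModuleIsomorphism public

  linear : (f : M.Carrierᴹ → N.Carrierᴹ) →
    (∀ {x y} → x M.≈ᴹ y → f x N.≈ᴹ f y) →
    (∀ x y → f (x M.+ᴹ y) N.≈ᴹ f x N.+ᴹ f y) →
    (∀ a x → f (a M.*ₗ x) N.≈ᴹ a N.*ₗ f x) → IsLinear f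
  linear f f-cong f-+ f-· = record { isLeftModuleHomomorphism = record
    { +ᴹ-isGroupHomomorphism = record
      { isMonoidHomomorphism = record
        { isMagmaHomomorphism = record
          { isRelHomomorphism = record { cong = f-cong }
          ; homo = f-+ }
        ; ε-homo = f-0 }
      ; ⁻¹-homo = λ x → GroupProperties.inverseʳ-unique N.+ᴹ-group (f x) (f (M.-ᴹ x))
          (N.≈ᴹ-trans (N.≈ᴹ-sym (f-+ _ _)) (N.≈ᴹ-trans (f-cong (M.-ᴹ‿inverseʳ x)) f-0)) }
    ; *ₗ-homo = f-· } }
    where
    open CommutativeRing R using (0#)
    f-0 : f M.0ᴹ N.≈ᴹ N.0ᴹ
    f-0 = N.≈ᴹ-trans (f-cong (M.≈ᴹ-sym (M.*ₗ-zeroˡ M.0ᴹ)))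
            (N.≈ᴹ-trans (f-· 0# M.0ᴹ) (N.*ₗ-zeroˡ _))

IsCentral : (Γ : Grp) → Group.Carrier Γ → Set
IsCentral Γ z = ∀ g → g ∙ z ≈ z ∙ g
  where open Group Γ

record Representation (Γ : Grp) (R : CRing) : Set₁ where
  private module Γ = Group Γ
  field
    space : Mod R
  open LeftModule space public
  field
    act        : Γ.Carrier → Carrierᴹ → Carrierᴹ
    act-cong   : ∀ {g h x y} → g Γ.≈ h → x ≈ᴹ y → act g x ≈ᴹ act h y
    act-linear : ∀ g → IsLinear R space space (act g)
    act-ε      : ∀ x → act Γ.ε x ≈ᴹ x
    act-∙      : ∀ g h x → act (g Γ.∙ h) x ≈ᴹ act g (act h x)

module _ {Γ : Grp} {R : CRing} (ρ ρ' : Representation Γ R) where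
  private
    module ρ = Representation ρ
    module ρ' = Representation ρ'

  infix 4 _≅_

  record _≅_ : Set where
    field
      to          : ρ.Carrierᴹ → ρ'.Carrierᴹ
      isLinearIso : IsLinearIso R ρ.space ρ'.space to
      equivariant : ∀ g x → to (ρ.act g x) ρ'.≈ᴹ ρ'.act g (to x)

module _ {Γ : Grp} {R : CRing} (ρ : Representation Γ R) where
  private
    module Γ = Group Γ
    module R = CommutativeRing R
    module Lin' g = IsLinear (Representation.act-linear ρ g)
  open Representation ρ
  open LeftModule space using () renaming (≈ᴹ-refl to refl; ≈ᴹ-sym to sym; ≈ᴹ-trans to trans)

  record IsSubrepresentation (P : Carrierᴹ → Set) : Set where
    field
      +-closed   : ∀ {x y} → P x → P y → P (x +ᴹ y)
      0-closed   : P 0ᴹ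
      neg-closed : ∀ {x} → P x → P (-ᴹ x)
      *ₗ-closed  : ∀ a {x} → P x → P (a *ₗ x)
      act-closed : ∀ g {x} → P x → P (act g x)

  subrepresentation : ∀ {P} → IsSubrepresentation P → Representation Γ R
  subrepresentation {P} closed = record
    { space = record
      { Carrierᴹ = Σ Carrierᴹ P
      ; _≈ᴹ_ = λ x y → proj₁ x ≈ᴹ proj₁ y
      ; _+ᴹ_ = λ (x , p) (y , q) → x +ᴹ y , +-closed p q
      ; _*ₗ_ = λ a (x , p) → a *ₗ x , *ₗ-closed a p
      ; 0ᴹ = 0ᴹ , 0-closed
      ; -ᴹ_ = λ (x , p) → -ᴹ x , neg-closed p
      ; isLeftModule = record
        { isLeftSemimodule = record
          { +ᴹ-isCommutativeMonoid = record
            { isMonoid = record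
              { isSemigroup = record
                { isMagma = record
                  { isEquivalence = record { refl = refl ; sym = sym ; trans = trans }
                  ; ∙-cong = +ᴹ-cong }
                ; assoc = λ _ _ _ → +ᴹ-assoc _ _ _ }
              ; identity = (λ _ → +ᴹ-identityˡ _) , (λ _ → +ᴹ-identityʳ _) }
            ; comm = λ _ _ → +ᴹ-comm _ _ }
          ; isPreleftSemimodule = record
            { *ₗ-cong = *ₗ-cong
            ; *ₗ-zeroˡ = λ _ → *ₗ-zeroˡ _
            ; *ₗ-distribʳ = λ _ _ _ → *ₗ-distribʳ _ _ _
            ; *ₗ-identityˡ = λ _ → *ₗ-identityˡ _
            ; *ₗ-assoc = λ _ _ _ → *ₗ-assoc _ _ _
            ; *ₗ-zeroʳ = λ _ → *ₗ-zeroʳ _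
            ; *ₗ-distribˡ = λ _ _ _ → *ₗ-distribˡ _ _ _ } }
        ; -ᴹ‿cong = -ᴹ‿cong
        ; -ᴹ‿inverse = (λ _ → -ᴹ‿inverseˡ _) , (λ _ → -ᴹ‿inverseʳ _) } }
    ; act = λ g (x , p) → act g x , act-closed g p
    ; act-cong = act-cong
    ; act-linear = λ g → linear R _ _ _ (Lin'.⟦⟧-cong g) (λ _ _ → Lin'.+ᴹ-homo g _ _) (λ _ _ → Lin'.*ₗ-homo g _ _)
    ; act-ε = λ _ → act-ε _
    ; act-∙ = λ _ _ _ → act-∙ _ _ _ }
    where open IsSubrepresentation closed

  -- Integer polynomials are lists of coefficients, constant term first.
  evaluate : List ℤ → (Carrierᴹ → Carrierᴹ) → Carrierᴹ → Carrierᴹ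
  evaluate []       t x = 0ᴹ
  evaluate (a ∷ as) t x = fromℤ R a *ₗ x +ᴹ t (evaluate as t x)

  module _ (z : Γ.Carrier) (central : IsCentral Γ z) where
    private
      act-comm : ∀ g x → act g (act z x) ≈ᴹ act z (act g x)
      act-comm g x = trans (sym (act-∙ _ _ _)) (trans (act-cong (central g) refl) (act-∙ _ _ _))

      interchange : ∀ a b c d → (a +ᴹ b) +ᴹ (c +ᴹ d) ≈ᴹ (a +ᴹ c) +ᴹ (b +ᴹ d)
      interchange a b c d = trans (+ᴹ-assoc _ _ _) (trans (+ᴹ-congˡ
        (trans (sym (+ᴹ-assoc _ _ _)) (trans (+ᴹ-congʳ (+ᴹ-comm _ _)) (+ᴹ-assoc _ _ _))))
        (sym (+ᴹ-assoc _ _ _)))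

      *ₗ-comm : ∀ a b x → a *ₗ (b *ₗ x) ≈ᴹ b *ₗ (a *ₗ x)
      *ₗ-comm a b x = trans (sym (*ₗ-assoc _ _ _)) (trans (*ₗ-congʳ (R.*-comm a b)) (*ₗ-assoc _ _ _))

      evaluate-cong : ∀ p {x y} → x ≈ᴹ y → evaluate p (act z) x ≈ᴹ evaluate p (act z) y
      evaluate-cong []      e = refl
      evaluate-cong (a ∷ p) e = +ᴹ-cong (*ₗ-congˡ e) (Lin'.⟦⟧-cong z (evaluate-cong p e))

      evaluate-+ : ∀ p x y → evaluate p (act z) (x +ᴹ y) ≈ᴹ evaluate p (act z) x +ᴹ evaluate p (act z) y
      evaluate-+ []      x y = sym (+ᴹ-identityˡ _)
      evaluate-+ (a ∷ p) x y = trans (+ᴹ-cong (*ₗ-distribˡ _ _ _)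
        (trans (Lin'.⟦⟧-cong z (evaluate-+ p x y)) (Lin'.+ᴹ-homo z _ _))) (interchange _ _ _ _)

      evaluate-*ₗ : ∀ p b x → evaluate p (act z) (b *ₗ x) ≈ᴹ b *ₗ evaluate p (act z) x
      evaluate-*ₗ []      b x = sym (*ₗ-zeroʳ b)
      evaluate-*ₗ (a ∷ p) b x = trans (+ᴹ-cong (*ₗ-comm _ _ _)
        (trans (Lin'.⟦⟧-cong z (evaluate-*ₗ p b x)) (Lin'.*ₗ-homo z _ _))) (sym (*ₗ-distribˡ _ _ _))

      evaluate-act : ∀ p g x → evaluate p (act z) (act g x) ≈ᴹ act g (evaluate p (act z) x)
      evaluate-act []      g x = sym (Lin'.0ᴹ-homo g)
      evaluate-act (a ∷ p) g x = trans (+ᴹ-cong (sym (Lin'.*ₗ-homo g _ _))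
        (trans (Lin'.⟦⟧-cong z (evaluate-act p g x)) (sym (act-comm g _)))) (sym (Lin'.+ᴹ-homo g _ _))

    kernel : List ℤ → Representation Γ R
    kernel p = subrepresentation {λ x → evaluate p (act z) x ≈ᴹ 0ᴹ} (record
      { +-closed = λ hx hy → trans (evaluate-+ p _ _) (trans (+ᴹ-cong hx hy) (+ᴹ-identityˡ _))
      ; 0-closed = 0-in
      ; neg-closed = λ {x} hx → trans (sym (+ᴹ-identityˡ _)) (trans (+ᴹ-congʳ (sym hx))
          (trans (sym (evaluate-+ p _ _)) (trans (evaluate-cong p (-ᴹ‿inverseʳ x)) 0-in)))
      ; *ₗ-closed = λ a hx → trans (evaluate-*ₗ p a _) (trans (*ₗ-congˡ hx) (*ₗ-zeroʳ a))
      ; act-closed = λ g hx → trans (evaluate-act p g _) (trans (Lin'.⟦⟧-cong g hx) (Lin'.0ᴹ-homo g)) })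
      where
      0-in : evaluate p (act z) 0ᴹ ≈ᴹ 0ᴹ
      0-in = trans (evaluate-cong p (sym (*ₗ-zeroˡ 0ᴹ))) (trans (evaluate-*ₗ p R.0# 0ᴹ) (*ₗ-zeroˡ _))

    eigenspace : R.Carrier → Representation Γ R
    eigenspace a = subrepresentation {λ x → act z x ≈ᴹ a *ₗ x} (record
      { +-closed = λ hx hy → trans (Lin'.+ᴹ-homo z _ _) (trans (+ᴹ-cong hx hy) (sym (*ₗ-distribˡ _ _ _)))
      ; 0-closed = trans (Lin'.0ᴹ-homo z) (sym (*ₗ-zeroʳ a))
      ; neg-closed = λ {x} hx → trans (Lin'.-ᴹ-homo z x) (trans (-ᴹ‿cong hx)
          (sym (GroupProperties.inverseʳ-unique +ᴹ-group (a *ₗ x) (a *ₗ -ᴹ x)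
            (trans (sym (*ₗ-distribˡ _ _ _)) (trans (*ₗ-congˡ (-ᴹ‿inverseʳ x)) (*ₗ-zeroʳ a))))))
      ; *ₗ-closed = λ b hx → trans (Lin'.*ₗ-homo z _ _) (trans (*ₗ-congˡ hx) (*ₗ-comm _ _ _))
      ; act-closed = λ g hx → trans (sym (act-comm g _)) (trans (Lin'.⟦⟧-cong g hx) (Lin'.*ₗ-homo g _ _)) })

record PermutationAction (Γ : Grp) (R : CRing) {X : Set}
                         (_≐_ : Lin R X → Lin R X → Set) : Set where
  private module Γ = Group Γ
  field
    act          : Γ.Carrier → X → X
    act-cong     : ∀ {g h} → g Γ.≈ h → ∀ x → _≋_ R _≐_ (gen (act g x)) (gen (act h x))
    act-relation : ∀ g {s t} → s ≐ t → _≋_ R _≐_ (mapLin (act g) s) (mapLin (act g) t)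
    act-ε        : ∀ x → _≋_ R _≐_ (gen (act Γ.ε x)) (gen x)
    act-∙        : ∀ g h x → _≋_ R _≐_ (gen (act (g Γ.∙ h) x)) (gen (act g (act h x)))

module _ {Γ : Grp} {R : CRing} {X : Set} {_≐_ : Lin R X → Lin R X → Set}
         (α : PermutationAction Γ R _≐_) where
  open PermutationAction α
  private module Γ = Group Γ

  presentedRepresentation : Representation Γ R
  presentedRepresentation = record
    { space = presentedModule R _≐_
    ; act = λ g → mapLin (act g)
    ; act-cong = λ {g} {h} {s} {t} p q → ≋-trans (mapLin-cong R _≐_ (act g) (act-relation g) q)
        (mapLin-ext R _≐_ (act g) (act h) (act-cong p) t)
    ; act-linear = λ g → linear R _ _ (mapLin (act g)) (mapLin-cong R _≐_ (act g) (act-relation g))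
        (λ _ _ → ≋-refl) (λ _ _ → ≋-refl)
    ; act-ε = λ t → ≡.subst (_≋_ R _≐_ (mapLin (act Γ.ε) t)) (mapLin-id t)
        (mapLin-ext R _≐_ (act Γ.ε) id act-ε t)
    ; act-∙ = λ g h t → ≡.subst (_≋_ R _≐_ (mapLin (act (g Γ.∙ h)) t)) (mapLin-∘ (act g) (act h) t)
        (mapLin-ext R _≐_ (act (g Γ.∙ h)) (act g ∘ act h) (act-∙ g h) t) }

module _ {Γ : Grp} {R S : CRing} (φ : R ⟶ S) (ρ : Representation Γ R) where
  private
    module Γ = Group Γ
    module R = CommutativeRing R
    module S = CommutativeRing S
    module ρ = Representation ρ
    module φ = _⟶_ φ
    module Lin' g = IsLinear (ρ.act-linear g)

  -- The pair (x , b) stands for the elementary tensor x ⊗ b of ρ ⊗_R S.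
  data TensorRelation : Lin S (ρ.Carrierᴹ × S.Carrier) → Lin S (ρ.Carrierᴹ × S.Carrier) → Set where
    ⊗-cong   : ∀ {x y b c} → x ρ.≈ᴹ y → b S.≈ c → TensorRelation (gen (x , b)) (gen (y , c))
    ⊗-addˡ   : ∀ x y b → TensorRelation (gen (x ρ.+ᴹ y , b)) (gen (x , b) ⊞ gen (y , b))
    ⊗-addʳ   : ∀ x b c → TensorRelation (gen (x , b S.+ c)) (gen (x , b) ⊞ gen (x , c))
    balanced : ∀ a x b → TensorRelation (gen (a ρ.*ₗ x , b)) (gen (x , φ.⟦ a ⟧ S.* b))
    ⊗-scale  : ∀ c x b → TensorRelation (c · gen (x , b)) (gen (x , c S.* b))

  extendScalars : Representation Γ S
  extendScalars = presentedRepresentation {_≐_ = TensorRelation} (record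
    { act = λ g (x , b) → ρ.act g x , b
    ; act-cong = λ p _ → relation (⊗-cong (ρ.act-cong p ρ.≈ᴹ-refl) S.refl)
    ; act-relation = tensor
    ; act-ε = λ _ → relation (⊗-cong (ρ.act-ε _) S.refl)
    ; act-∙ = λ _ _ _ → relation (⊗-cong (ρ.act-∙ _ _ _) S.refl) })
    where
    tensor : ∀ g {s t} → TensorRelation s t →
      _≋_ S TensorRelation (mapLin (λ (x , b) → ρ.act g x , b) s) (mapLin (λ (x , b) → ρ.act g x , b) t)
    tensor g (⊗-cong p q)     = relation (⊗-cong (ρ.act-cong Γ.refl p) q)
    tensor g (⊗-addˡ x y b)   = ≋-trans (relation (⊗-cong (Lin'.+ᴹ-homo g _ _) S.refl))
                                        (relation (⊗-addˡ _ _ _))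
    tensor g (⊗-addʳ x b c)   = relation (⊗-addʳ _ _ _)
    tensor g (balanced a x b) = ≋-trans (relation (⊗-cong (Lin'.*ₗ-homo g _ _) S.refl))
                                        (relation (balanced _ _ _))
    tensor g (⊗-scale c x b)  = relation (⊗-scale _ _ _)

restrictˡ : ∀ {G H : Grp} {R : CRing} → Representation (DirectProduct.group G H) R → Representation G R
restrictˡ {G} {H} ρ = record
  { space = space
  ; act = λ g → act (g , H.ε)
  ; act-cong = λ p → act-cong (p , H.refl)
  ; act-linear = λ g → act-linear (g , H.ε)
  ; act-ε = act-ε
  ; act-∙ = λ g h x → ≈ᴹ-trans (act-cong (Group.refl G , H.sym (H.identityˡ H.ε)) ≈ᴹ-refl)
                               (act-∙ (g , H.ε) (h , H.ε) x) }
  where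
  open Representation ρ
  module H = Group H

record Character (G : Grp) (R : CRing) : Set where
  private
    module G = Group G
    module R = CommutativeRing R
  field
    χ      : G.Carrier → R.Carrier
    χ-cong : ∀ {g h} → g G.≈ h → χ g R.≈ χ h
    χ-ε    : χ G.ε R.≈ R.1#
    χ-∙    : ∀ g h → χ (g G.∙ h) R.≈ χ g R.* χ h

module _ {G : Grp} {R : CRing} where
  private
    module G = Group G
    module R = CommutativeRing R
  open CommutativeExp R.commutativeSemiring using (_^_; ^-congˡ; ^-distrib-*)
  open Character

  infixr 8 _^ᶜ_
  infixl 7 _⊗ᶜ_

  _^ᶜ_ : Character G R → ℕ → Character G R
  ψ ^ᶜ i = record
    { χ = λ g → χ ψ g ^ i
    ; χ-cong = λ p → ^-congˡ i (χ-cong ψ p)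
    ; χ-ε = R.trans (^-congˡ i (χ-ε ψ)) (one^ i)
    ; χ-∙ = λ g h → R.trans (^-congˡ i (χ-∙ ψ g h)) (^-distrib-* _ _ i) }
    where
    one^ : ∀ i → R.1# ^ i R.≈ R.1#
    one^ zero    = R.refl
    one^ (suc i) = R.trans (R.*-identityˡ _) (one^ i)

  _⊗ᶜ_ : Representation G R → Character G R → Representation G R
  ρ ⊗ᶜ ψ = record
    { space = space
    ; act = λ g x → χ ψ g *ₗ act g x
    ; act-cong = λ p q → *ₗ-cong (χ-cong ψ p) (act-cong p q)
    ; act-linear = λ g → let open IsLinear (act-linear g) in linear R space space _
        (λ p → *ₗ-congˡ (⟦⟧-cong p))
        (λ _ _ → ≈ᴹ-trans (*ₗ-congˡ (+ᴹ-homo _ _)) (*ₗ-distribˡ _ _ _))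
        (λ _ _ → ≈ᴹ-trans (*ₗ-congˡ (*ₗ-homo _ _)) (*ₗ-comm _ _ _))
    ; act-ε = λ x → ≈ᴹ-trans (*ₗ-cong (χ-ε ψ) (act-ε x)) (*ₗ-identityˡ x)
    ; act-∙ = λ g h x → let open IsLinear (act-linear g) in
        ≈ᴹ-trans (*ₗ-cong (χ-∙ ψ g h) (act-∙ g h x))
          (≈ᴹ-trans (*ₗ-assoc _ _ _) (*ₗ-congˡ (≈ᴹ-sym (*ₗ-homo _ _)))) }
    where
    open Representation ρ
    *ₗ-comm : ∀ a b x → a *ₗ (b *ₗ x) ≈ᴹ b *ₗ (a *ₗ x)
    *ₗ-comm a b x = ≈ᴹ-trans (≈ᴹ-sym (*ₗ-assoc _ _ _))
      (≈ᴹ-trans (*ₗ-congʳ (R.*-comm a b)) (*ₗ-assoc _ _ _))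

record Congruent (m a b : ℤ) : Set where
  constructor mod
  field difference : m ℤᵈ.∣ a ℤ.- b

module _ (ℓ : ℕ) where

  ℓ^_ : ℕ → ℤ
  ℓ^ k = + (ℓ ℕ.^ k)

  record ℓ-adic : Set where
    field
      digit    : ℕ → ℤ
      coherent : ∀ k → Congruent (ℓ^ k) (digit (suc k)) (digit k)
  open ℓ-adic

  private
    module _ {m : ℤ} where
      open Solver ℤₚ.+-*-commutativeSemiring using (solve; _:+_; _:*_; _:=_)

      quotient : ∀ {a b} → Congruent m a b → ℤ
      quotient (mod c) = ℤᵈ.quotient c

      cong-reflexive : ∀ {a b} → a ≡ b → Congruent m a b
      cong-reflexive {a} ≡.refl = mod (ℤᵈ.divides 0ℤ (ℤₚ.+-inverseʳ a))

      congruent : ∀ {a b} q → a ≡ q ℤ.* m ℤ.+ b → Congruent m a b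
      congruent {a} {b} q p = mod (ℤᵈ.divides q (≡.trans (≡.cong (ℤ._- b) p)
        (≡.trans (ℤₚ.+-assoc (q ℤ.* m) b (ℤ.- b))
          (≡.trans (≡.cong (ℤ._+_ (q ℤ.* m)) (ℤₚ.+-inverseʳ b)) (ℤₚ.+-identityʳ _)))))

      expand : ∀ {a b} → (c : Congruent m a b) → a ≡ quotient c ℤ.* m ℤ.+ b
      expand {a} {b} (mod (ℤᵈ.divides q e)) = ≡.trans (≡.sym (≡.trans (ℤₚ.+-assoc a (ℤ.- b) b)
        (≡.trans (≡.cong (ℤ._+_ a) (ℤₚ.+-inverseˡ b)) (ℤₚ.+-identityʳ a)))) (≡.cong (ℤ._+ b) e)

      cong-neg : ∀ {a b} → Congruent m a b → Congruent m (ℤ.- a) (ℤ.- b)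
      cong-neg {a} {b} (mod p) = mod (≡.subst (m ℤᵈ.∣_) (ℤₚ.neg-distrib-+ a (ℤ.- b)) (ℤᵈ.∣m⇒∣-m p))

      cong-sym : ∀ {a b} → Congruent m a b → Congruent m b a
      cong-sym {a} {b} (mod p) = mod (≡.subst (m ℤᵈ.∣_)
        (≡.trans (ℤₚ.neg-distrib-+ a (ℤ.- b))
          (≡.trans (≡.cong (ℤ._+_ (ℤ.- a)) (ℤₚ.neg-involutive b)) (ℤₚ.+-comm (ℤ.- a) b)))
        (ℤᵈ.∣m⇒∣-m p))

      cong-trans : ∀ {a b c} → Congruent m a b → Congruent m b c → Congruent m a c
      cong-trans {a} {b} {c} p q = congruent (x ℤ.+ y) (≡.trans (expand p)
        (≡.trans (≡.cong (ℤ._+_ (x ℤ.* m)) (expand q))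
          (solve 4 (λ x y m c → x :* m :+ (y :* m :+ c) := (x :+ y) :* m :+ c) ≡.refl x y m c)))
        where x = quotient p ; y = quotient q

      cong-+ : ∀ {a b c d} → Congruent m a b → Congruent m c d → Congruent m (a ℤ.+ c) (b ℤ.+ d)
      cong-+ {a} {b} {c} {d} p q = congruent (x ℤ.+ y) (≡.trans (≡.cong₂ ℤ._+_ (expand p) (expand q))
        (solve 5 (λ x y m b d → (x :* m :+ b) :+ (y :* m :+ d) := (x :+ y) :* m :+ (b :+ d)) ≡.refl x y m b d))
        where x = quotient p ; y = quotient q

      cong-* : ∀ {a b c d} → Congruent m a b → Congruent m c d → Congruent m (a ℤ.* c) (b ℤ.* d)
      cong-* {a} {b} {c} {d} p q = congruent (x ℤ.* (y ℤ.* m ℤ.+ d) ℤ.+ b ℤ.* y)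
        (≡.trans (≡.cong₂ ℤ._*_ (expand p) (expand q))
          (solve 5 (λ x y m b d → (x :* m :+ b) :* (y :* m :+ d)
             := (x :* (y :* m :+ d) :+ b :* y) :* m :+ b :* d) ≡.refl x y m b d))
        where x = quotient p ; y = quotient q

    _≈ℓ_ : ℓ-adic → ℓ-adic → Set
    a ≈ℓ b = ∀ k → Congruent (ℓ^ k) (digit a k) (digit b k)

    constant : ℤ → ℓ-adic
    constant a = record { digit = λ _ → a ; coherent = λ _ → cong-reflexive ≡.refl }

  -- The inverse limit of the rings ℤ/ℓᵏ.
  ℤ⟨ℓ⟩ : CRing
  ℤ⟨ℓ⟩ = record
    { Carrier = ℓ-adic
    ; _≈_ = _≈ℓ_
    ; _+_ = λ a b → record
        { digit = λ k → digit a k ℤ.+ digit b k ; coherent = λ k → cong-+ (coherent a k) (coherent b k) }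
    ; _*_ = λ a b → record
        { digit = λ k → digit a k ℤ.* digit b k ; coherent = λ k → cong-* (coherent a k) (coherent b k) }
    ; -_ = λ a → record
        { digit = λ k → ℤ.- digit a k ; coherent = λ k → cong-neg {a = digit a (suc k)} (coherent a k) }
    ; 0# = constant 0ℤ
    ; 1# = constant 1ℤ
    ; isCommutativeRing = record
      { isRing = record
        { +-isAbelianGroup = record
          { isGroup = record
            { isMonoid = record
              { isSemigroup = record
                { isMagma = record
                  { isEquivalence = record
                    { refl = λ _ → cong-reflexive ≡.refl
                    ; sym = λ {a} {b} p k → cong-sym {a = digit a k} (p k)
                    ; trans = λ {a} {b} {c} p q k → cong-trans {b = digit b k} (p k) (q k) }
                  ; ∙-cong = λ p q k → cong-+ (p k) (q k) }
                ; assoc = λ a b c k → cong-reflexive (ℤₚ.+-assoc (digit a k) _ _) }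
              ; identity = (λ a k → cong-reflexive (ℤₚ.+-identityˡ _))
                         , (λ a k → cong-reflexive (ℤₚ.+-identityʳ _)) }
            ; inverse = (λ a k → cong-reflexive (ℤₚ.+-inverseˡ (digit a k)))
                      , (λ a k → cong-reflexive (ℤₚ.+-inverseʳ (digit a k)))
            ; ⁻¹-cong = λ {a} p k → cong-neg {a = digit a k} (p k) }
          ; comm = λ a b k → cong-reflexive (ℤₚ.+-comm (digit a k) _) }
        ; *-cong = λ p q k → cong-* (p k) (q k)
        ; *-assoc = λ a b c k → cong-reflexive (ℤₚ.*-assoc (digit a k) _ _)
        ; *-identity = (λ a k → cong-reflexive (ℤₚ.*-identityˡ _))
                     , (λ a k → cong-reflexive (ℤₚ.*-identityʳ _))
        ; distrib = (λ a b c k → cong-reflexive (ℤₚ.*-distribˡ-+ (digit a k) _ _))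
                  , (λ a b c k → cong-reflexive (ℤₚ.*-distribʳ-+ (digit a k) (digit b k) (digit c k))) }
      ; *-comm = λ a b k → cong-reflexive (ℤₚ.*-comm (digit a k) _) } }

ℤ-ring : CRing
ℤ-ring = ℤₚ.+-*-commutativeRing

module Tate {Γ : Grp} (ℓ : ℕ) (ρ : Representation Γ ℤ-ring) where
  private
    module Γ = Group Γ
    module Z = CommutativeRing (ℤ⟨ℓ⟩ ℓ)
    module Lin' g = IsLinear (Representation.act-linear ρ g)
  open Representation ρ
  open LeftModule space using () renaming (≈ᴹ-refl to refl; ≈ᴹ-sym to sym; ≈ᴹ-trans to trans)
  open ℓ-adic

  record TateElement : Set where
    field
      component  : ℕ → Carrierᴹ
      torsion    : ∀ k → ℓ^_ ℓ k *ₗ component k ≈ᴹ 0ᴹ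
      compatible : ∀ k → (+ ℓ) *ₗ component (suc k) ≈ᴹ component k
  open TateElement

  _≈ᵀ_ : TateElement → TateElement → Set
  x ≈ᵀ y = ∀ k → component x k ≈ᴹ component y k

  *ₗ-comm : ∀ a b x → a *ₗ (b *ₗ x) ≈ᴹ b *ₗ (a *ₗ x)
  *ₗ-comm a b x = trans (sym (*ₗ-assoc _ _ _)) (trans (*ₗ-congʳ (ℤₚ.*-comm a b)) (*ₗ-assoc _ _ _))

  *ₗ-neg : ∀ a x → a *ₗ (-ᴹ x) ≈ᴹ -ᴹ (a *ₗ x)
  *ₗ-neg a x = GroupProperties.inverseʳ-unique +ᴹ-group (a *ₗ x) (a *ₗ -ᴹ x)
    (trans (sym (*ₗ-distribˡ _ _ _)) (trans (*ₗ-congˡ (-ᴹ‿inverseʳ x)) (*ₗ-zeroʳ a)))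

  *ₗ-mod : ∀ {m a b x} → m *ₗ x ≈ᴹ 0ᴹ → Congruent m a b → a *ₗ x ≈ᴹ b *ₗ x
  *ₗ-mod {m} {a} {b} {x} h (mod (ℤᵈ.divides q e)) = trans (*ₗ-congʳ split)
    (trans (*ₗ-distribʳ _ _ _) (trans (+ᴹ-congʳ (trans (*ₗ-assoc _ _ _)
      (trans (*ₗ-congˡ h) (*ₗ-zeroʳ q)))) (+ᴹ-identityˡ _)))
    where
    split : a ≡ q ℤ.* m ℤ.+ b
    split = ≡.trans (≡.sym (≡.trans (ℤₚ.+-assoc a (ℤ.- b) b)
      (≡.trans (≡.cong (ℤ._+_ a) (ℤₚ.+-inverseˡ b)) (ℤₚ.+-identityʳ a)))) (≡.cong (ℤ._+ b) e)

  _+ᵀ_ : TateElement → TateElement → TateElement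
  x +ᵀ y = record
    { component = λ k → component x k +ᴹ component y k
    ; torsion = λ k → trans (*ₗ-distribˡ _ _ _)
        (trans (+ᴹ-cong (torsion x k) (torsion y k)) (+ᴹ-identityˡ _))
    ; compatible = λ k → trans (*ₗ-distribˡ _ _ _) (+ᴹ-cong (compatible x k) (compatible y k)) }

  0ᵀ : TateElement
  0ᵀ = record { component = λ _ → 0ᴹ ; torsion = λ _ → *ₗ-zeroʳ _ ; compatible = λ _ → *ₗ-zeroʳ _ }

  -ᵀ_ : TateElement → TateElement
  -ᵀ x = record
    { component = λ k → -ᴹ component x k
    ; torsion = λ k → trans (*ₗ-neg _ _) (trans (-ᴹ‿cong (torsion x k))
        (GroupProperties.ε⁻¹≈ε +ᴹ-group))
    ; compatible = λ k → trans (*ₗ-neg _ _) (-ᴹ‿cong (compatible x k)) }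

  _*ᵀ_ : ℓ-adic ℓ → TateElement → TateElement
  a *ᵀ x = record
    { component = λ k → digit a k *ₗ component x k
    ; torsion = λ k → trans (*ₗ-comm _ _ _) (trans (*ₗ-congˡ (torsion x k)) (*ₗ-zeroʳ _))
    ; compatible = λ k → trans (*ₗ-comm _ _ _) (trans (*ₗ-congˡ (compatible x k))
        (*ₗ-mod (torsion x k) (coherent a k))) }

  actᵀ : Γ.Carrier → TateElement → TateElement
  actᵀ g x = record
    { component = λ k → act g (component x k)
    ; torsion = λ k → trans (sym (Lin'.*ₗ-homo g _ _))
        (trans (Lin'.⟦⟧-cong g (torsion x k)) (Lin'.0ᴹ-homo g))
    ; compatible = λ k → trans (sym (Lin'.*ₗ-homo g _ _)) (Lin'.⟦⟧-cong g (compatible x k)) }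

  tateSpace : Mod (ℤ⟨ℓ⟩ ℓ)
  tateSpace = record
    { Carrierᴹ = TateElement ; _≈ᴹ_ = _≈ᵀ_ ; _+ᴹ_ = _+ᵀ_ ; _*ₗ_ = _*ᵀ_ ; 0ᴹ = 0ᵀ ; -ᴹ_ = -ᵀ_
    ; isLeftModule = record
      { isLeftSemimodule = record
        { +ᴹ-isCommutativeMonoid = record
          { isMonoid = record
            { isSemigroup = record
              { isMagma = record
                { isEquivalence = record
                  { refl = λ _ → refl ; sym = λ p k → sym (p k) ; trans = λ p q k → trans (p k) (q k) }
                ; ∙-cong = λ p q k → +ᴹ-cong (p k) (q k) }
              ; assoc = λ _ _ _ _ → +ᴹ-assoc _ _ _ }
            ; identity = (λ _ _ → +ᴹ-identityˡ _) , (λ _ _ → +ᴹ-identityʳ _) }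
          ; comm = λ _ _ _ → +ᴹ-comm _ _ }
        ; isPreleftSemimodule = record
          { *ₗ-cong = λ {a} {b} {x} {y} p q k → trans (*ₗ-congˡ (q k)) (*ₗ-mod (torsion y k) (p k))
          ; *ₗ-zeroˡ = λ _ _ → *ₗ-zeroˡ _
          ; *ₗ-distribʳ = λ _ _ _ _ → *ₗ-distribʳ _ _ _
          ; *ₗ-identityˡ = λ _ _ → *ₗ-identityˡ _
          ; *ₗ-assoc = λ _ _ _ _ → *ₗ-assoc _ _ _
          ; *ₗ-zeroʳ = λ _ _ → *ₗ-zeroʳ _
          ; *ₗ-distribˡ = λ _ _ _ _ → *ₗ-distribˡ _ _ _ } }
      ; -ᴹ‿cong = λ p k → -ᴹ‿cong (p k)
      ; -ᴹ‿inverse = (λ _ _ → -ᴹ‿inverseˡ _) , (λ _ _ → -ᴹ‿inverseʳ _) } }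

  tate : Representation Γ (ℤ⟨ℓ⟩ ℓ)
  tate = record
    { space = tateSpace
    ; act = actᵀ
    ; act-cong = λ p q k → act-cong p (q k)
    ; act-linear = λ g → linear (ℤ⟨ℓ⟩ ℓ) tateSpace tateSpace (actᵀ g) (λ p k → Lin'.⟦⟧-cong g (p k))
        (λ _ _ _ → Lin'.+ᴹ-homo g _ _) (λ _ _ _ → Lin'.*ₗ-homo g _ _)
    ; act-ε = λ _ _ → act-ε _
    ; act-∙ = λ _ _ _ _ → act-∙ _ _ _ }

open Tate using (tate)

private
  subtractScaled : ℤ → List ℤ → List ℤ → List ℤ
  subtractScaled q (a ∷ as) (b ∷ bs) = (a ℤ.- q ℤ.* b) ∷ subtractScaled q as bs
  subtractScaled q as       _        = as

  -- Long division of p by the monic polynomial X^|bs| + bs; here coefficients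
  -- are listed from the leading one down, and m counts quotient coefficients.
  divide : ℕ → List ℤ → List ℤ → List ℤ
  divide (suc m) (a ∷ as) bs = a ∷ divide m (subtractScaled a as bs) bs
  divide _       _        bs = []

  divideMonic : List ℤ → List ℤ → List ℤ
  divideMonic p []       = p
  divideMonic p (_ ∷ bs) = divide (List.length p ℕ.∸ List.length bs) p bs

  binomial : ℕ → List ℤ
  binomial zero    = 0ℤ ∷ []
  binomial (suc m) = 1ℤ ∷ List.replicate m 0ℤ List.++ ((ℤ.- 1ℤ) ∷ [])

  -- Φₘ = (X^m - 1) / ∏_{e ∣ m, e < m} Φₑ, given the list of the (e , Φₑ) with e < m.
  nextΦ : ℕ → List (ℕ × List ℤ) → List ℤ
  nextΦ m = List.foldr (λ (e , φ) p → if ⌊ e ℕᵈ.∣? m ⌋ then divideMonic p φ else p) (binomial m)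

  tableΦ : ℕ → List (ℕ × List ℤ)
  tableΦ zero    = []
  tableΦ (suc m) = (suc m , nextΦ (suc m) (tableΦ m)) ∷ tableΦ m

-- Coefficients of Φₘ for m ≥ 1, constant term first.
cyclotomic : ℕ → List ℤ
cyclotomic m = List.reverse (nextΦ m (tableΦ (ℕ.pred m)))

-- A curve over an algebraically closed field k enters through its function
-- field F: the points of its smooth projective model are the places of F/k.
module DivisorClasses (k : Field) (F : CRing) (const : ∣ k ∣ ⟶ F) where
  private
    module k = Field k
  open CommutativeRing F
  open _⟶_ const using (⟦_⟧)

  -- Normalised discrete valuations trivial on k; nothing plays the role of ∞.
  record Place : Set where
    field
      v            : Carrier → Maybe ℤ
      v-cong       : ∀ {x y} → x ≈ y → v x ≡ v y
      v-∞          : ∀ x → v x ≡ nothing ⇔ x ≈ 0#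
      v-*          : ∀ x y → v (x * y) ≡ Maybe.zipWith ℤ._+_ (v x) (v y)
      v-+          : ∀ m x y → MaybeAll.All (m ℤ.≤_) (v x) → MaybeAll.All (m ℤ.≤_) (v y) →
                     MaybeAll.All (m ℤ.≤_) (v (x + y))
      v-const      : ∀ a → ¬ a k.≈ k.0# → v ⟦ a ⟧ ≡ just 0ℤ
      v-uniformise : ∃ λ x → v x ≡ just 1ℤ
  open Place

  -- Only used for units x, where v x is finite.
  ord : Place → Carrier → ℤ
  ord P x = Maybe.fromMaybe 0ℤ (v P x)

  places : Setoid 0ℓ 0ℓ
  places = record
    { Carrier = Place
    ; _≈_ = λ P Q → ∀ x → v P x ≡ v Q x
    ; isEquivalence = record
      { refl = λ _ → ≡.refl
      ; sym = λ p x → ≡.sym (p x)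
      ; trans = λ p q x → ≡.trans (p x) (q x) } }

  private module Places = Setoid places
  open Membership places using (_∈_)
  open UniqueList places using (Unique)

  Divisor : Set
  Divisor = Lin ℤ-ring Place

  -- Every place has degree 1, as k is algebraically closed.
  degree : Divisor → ℤ
  degree (gen P) = 1ℤ
  degree 𝟎       = 0ℤ
  degree (D ⊞ E) = degree D ℤ.+ degree E
  degree (⊟ D)   = ℤ.- degree D
  degree (a · D) = a ℤ.* degree D

  divisorOn : Carrier → List Place → Divisor
  divisorOn x = List.foldr (λ P D → ord P x · gen P ⊞ D) 𝟎

  -- principal: div(x) = 0 for a unit x, where Ps lists without repetition
  -- finitely many places including all those with ord P x ≠ 0.
  data DivisorRelation : Divisor → Divisor → Set where
    same      : ∀ {P Q} → P Places.≈ Q → DivisorRelation (gen P) (gen Q)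
    principal : ∀ x y → x * y ≈ 1# → ∀ Ps → Unique Ps →
                (∀ P → ord P x ≢ 0ℤ → P ∈ Ps) →
                DivisorRelation (divisorOn x Ps) 𝟎

  module _ {Γ : Grp} (α : RingAction Γ F)
           (stable : ∀ g a → ¬ a k.≈ k.0# →
                     ∃ λ b → (¬ b k.≈ k.0#) × RingAction.act α g ⟦ a ⟧ ≈ ⟦ b ⟧) where
    private
      module Γ = Group Γ
      open RingAction α
      module Hom g = RingMorphisms.IsRingHomomorphism (act-hom g)

    -- v_{gP}(x) = v_P(g⁻¹ x)
    move : Γ.Carrier → Place → Place
    move g P = record
      { v = v P ∘ act g'
      ; v-cong = λ p → v-cong P (act-cong Γ.refl p)
      ; v-∞ = λ x → mk⇔
          (λ p → trans (sym (act-inverseʳ g x)) (trans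
             (act-cong Γ.refl (Equivalence.to (v-∞ P _) p)) (Hom.0#-homo g)))
          (λ p → Equivalence.from (v-∞ P _) (trans (act-cong Γ.refl p) (Hom.0#-homo g')))
      ; v-* = λ x y → ≡.trans (v-cong P (Hom.*-homo g' x y)) (v-* P _ _)
      ; v-+ = λ m x y p q → ≡.subst (MaybeAll.All (m ℤ.≤_)) (v-cong P (sym (Hom.+-homo g' x y)))
                              (v-+ P m _ _ p q)
      ; v-const = λ a a≉0 → let (b , b≉0 , e) = stable g' a a≉0 in
          ≡.trans (v-cong P e) (v-const P b b≉0)
      ; v-uniformise = let (x , e) = v-uniformise P in
          act g x , ≡.trans (v-cong P (act-inverseˡ g x)) e }
      where g' = g Γ.⁻¹

    move-cong : ∀ g {P Q} → P Places.≈ Q → move g P Places.≈ move g Q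
    move-cong g p x = p _

    move-injective : ∀ g {P Q} → move g P Places.≈ move g Q → P Places.≈ Q
    move-injective g {P} {Q} p x = ≡.trans (v-cong P (sym (act-inverseˡ g x)))
      (≡.trans (p _) (v-cong Q (act-inverseˡ g x)))

    move-∙ : ∀ g h P → move (g Γ.∙ h) P Places.≈ move g (move h P)
    move-∙ g h P x = v-cong P (trans
      (act-cong (GroupProperties.⁻¹-anti-homo-∙ Γ g h) refl) (act-∙ _ _ _))

    move-ε : ∀ P → move Γ.ε P Places.≈ P
    move-ε P x = v-cong P (trans (act-cong (GroupProperties.ε⁻¹≈ε Γ) refl) (act-ε x))

    move-respects : ∀ {g h} → g Γ.≈ h → ∀ P → move g P Places.≈ move h P
    move-respects p P x = v-cong P (act-cong (Γ.⁻¹-cong p) refl)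

    ord-move : ∀ g P x → ord (move g P) (act g x) ≡ ord P x
    ord-move g P x = ≡.cong (Maybe.fromMaybe 0ℤ) (v-cong P (act-inverseˡ g x))

    infix 4 _≋ᴰ_
    _≋ᴰ_ : Divisor → Divisor → Set
    _≋ᴰ_ = _≋_ ℤ-ring DivisorRelation

    move-divisor : ∀ g x Ps →
      mapLin (move g) (divisorOn x Ps) ≋ᴰ divisorOn (act g x) (List.map (move g) Ps)
    move-divisor g x []       = ≋-refl
    move-divisor g x (P ∷ Ps) =
      ⊞-cong (·-cong (≡.sym (ord-move g P x)) ≋-refl) (move-divisor g x Ps)

    move-relation : ∀ g {D E} → DivisorRelation D E → mapLin (move g) D ≋ᴰ mapLin (move g) E
    move-relation g (same {P} {Q} p) = relation (same (move-cong g {P} {Q} p))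
    move-relation g (principal x y xy Ps unique complete) =
      ≋-trans (move-divisor g x Ps) (relation (principal (act g x) (act g y)
        (trans (sym (Hom.*-homo g x y)) (trans (act-cong Γ.refl xy) (Hom.1#-homo g)))
        (List.map (move g) Ps)
        (UniqueListₚ.map⁺ places places (λ {P} {Q} → move-injective g {P} {Q}) unique)
        complete'))
      where
      complete' : ∀ Q → ord Q (act g x) ≢ 0ℤ → Q ∈ List.map (move g) Ps
      complete' Q h = Membershipₚ.∈-resp-≈ places {List.map (move g) Ps} {move g P} {Q} back
        (Membershipₚ.∈-map⁺ places places {f = move g} (λ {P} {Q} → move-cong g {P} {Q}) {P} {Ps}
          (complete P (λ e → h (≡.trans (≡.sym (≡.trans (≡.sym (ord-move g P x))
             (≡.cong (Maybe.fromMaybe 0ℤ) (back (act g x))))) e))))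
        where
        P = move (g Γ.⁻¹) Q
        back : move g P Places.≈ Q
        back z = ≡.trans (≡.sym (move-∙ g (g Γ.⁻¹) Q z))
          (≡.trans (move-respects (Γ.inverseʳ g) Q z) (move-ε Q z))

    degree-move : ∀ g D → degree (mapLin (move g) D) ≡ degree D
    degree-move g (gen P) = ≡.refl
    degree-move g 𝟎       = ≡.refl
    degree-move g (D ⊞ E) = ≡.cong₂ ℤ._+_ (degree-move g D) (degree-move g E)
    degree-move g (⊟ D)   = ≡.cong (λ m → ℤ.- m) (degree-move g D)
    degree-move g (a · D) = ≡.cong (a ℤ.*_) (degree-move g D)

    Pic : Representation Γ ℤ-ring
    Pic = presentedRepresentation {_≐_ = DivisorRelation} (record
      { act = move
      ; act-cong = λ p P → relation (same (move-respects p P))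
      ; act-relation = move-relation
      ; act-ε = λ P → relation (same (move-ε P))
      ; act-∙ = λ g h P → relation (same (move-∙ g h P)) })

    -- Degree-zero divisors modulo principal divisors.
    Pic⁰ : Representation Γ ℤ-ring
    Pic⁰ = subrepresentation Pic {λ D → degree D ≡ 0ℤ} (record
      { +-closed = λ p q → ≡.cong₂ ℤ._+_ p q
      ; 0-closed = ≡.refl
      ; neg-closed = ≡.cong (λ m → ℤ.- m)
      ; *ₗ-closed = λ a p → ≡.trans (≡.cong (a ℤ.*_) p) (ℤₚ.*-zeroʳ a)
      ; act-closed = λ g {D} p → ≡.trans (degree-move g D) p })

μ : (d : ℕ) .{{_ : NonZero d}} → CRing → Grp
μ d K = record
  { Carrier = ∃ λ u → u ^ d ≈ 1#
  ; _≈_ = λ u w → proj₁ u ≈ proj₁ w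
  ; _∙_ = λ (u , p) (w , q) → u * w ,
      trans (^-distrib-* u w d) (trans (*-cong p q) (*-identityˡ 1#))
  ; ε = 1# , one^ d
  ; _⁻¹ = λ (u , p) → u ^ ℕ.pred d , trans (^-assocʳ u (ℕ.pred d) d)
      (trans (^-congʳ u (ℕₚ.*-comm (ℕ.pred d) d))
        (trans (sym (^-assocʳ u d (ℕ.pred d))) (trans (^-congˡ (ℕ.pred d) p) (one^ (ℕ.pred d)))))
  ; isGroup = record
    { isMonoid = record
      { isSemigroup = record
        { isMagma = record
          { isEquivalence = record { refl = refl ; sym = sym ; trans = trans }
          ; ∙-cong = *-cong }
        ; assoc = λ _ _ _ → *-assoc _ _ _ }
      ; identity = (λ _ → *-identityˡ _) , (λ _ → *-identityʳ _) }
    ; inverse = (λ (u , p) → trans (*-comm _ _) (inverse u p)) , (λ (u , p) → inverse u p)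
    ; ⁻¹-cong = ^-congˡ (ℕ.pred d) } }
  where
  open CommutativeRing K
  open CommutativeExp commutativeSemiring
  one^ : ∀ k → 1# ^ k ≈ 1#
  one^ zero    = refl
  one^ (suc k) = trans (*-identityˡ _) (one^ k)
  inverse : ∀ u → u ^ d ≈ 1# → u * u ^ ℕ.pred d ≈ 1#
  inverse u p = trans (^-congʳ u (ℕₚ.suc-pred d)) p

data Coordinate : Set where
  𝕩 𝕪 : Coordinate

-- The curve yᵈ = f(x) over K, with 𝕩 and 𝕪 its coordinate functions.
module Superelliptic (K : Field) (K̄ : AlgebraicClosure K) (d : ℕ) .{{_ : NonZero d}}
                     (f : Expr ∣ K ∣ ⊤) where
  open AlgebraicClosure K̄ using (ι; closure)
  private
    module K = Field K
    module K̄ = Field closure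
    module ι = _⟶_ ι

  Gal : Grp
  Gal = Aut ι

  -- g(x), with coefficients in the algebraic closure.
  _[x] : Expr ∣ K ∣ ⊤ → Expr ∣ closure ∣ Coordinate
  con a    [x] = con ι.⟦ a ⟧
  var _    [x] = var 𝕩
  (e ⊕ e') [x] = e [x] ⊕ e' [x]
  (e ⊛ e') [x] = e [x] ⊛ e' [x]
  (⊝ e)    [x] = ⊝ (e [x])

  data Equation : Expr ∣ closure ∣ Coordinate → Expr ∣ closure ∣ Coordinate → Set where
    equation : Equation (power (var 𝕪) d) (f [x])

  coordinateRing : CRing
  coordinateRing = presentedAlgebra ∣ closure ∣ Equation

  functionField : CRing
  functionField = totalFractions coordinateRing

  private
    module A = CommutativeRing coordinateRing
    open CommutativeExp A.commutativeSemiring using (_^_; ^-distrib-*; ^-congˡ)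

  conHom : ∣ closure ∣ ⟶ coordinateRing
  conHom = record
    { ⟦_⟧ = con
    ; isRingHomomorphism = ringHomomorphism ∣ closure ∣ coordinateRing con con-cong con-+ con-* A.refl }

  power-^ : ∀ e k → power e k A.≈ e ^ k
  power-^ e zero    = A.refl
  power-^ e (suc k) = A.*-congˡ (power-^ e k)

  -- (g , u) applies g to the constants, fixes x and sends y to u y.
  module _ (g : Automorphism ι) (u : K.Carrier) where
    private module g = Automorphism g

    constants : ∣ closure ∣ ⟶ coordinateRing
    constants = record
      { ⟦_⟧ = con ∘ g.to
      ; isRingHomomorphism = ringHomomorphism ∣ closure ∣ coordinateRing (con ∘ g.to)
          (λ p → con-cong (g.⟦⟧-cong p))
          (λ a b → A.trans (con-cong (g.+-homo a b)) (con-+ _ _))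
          (λ a b → A.trans (con-cong (g.*-homo a b)) (con-* _ _))
          (con-cong g.1#-homo) }

    images : Coordinate → A.Carrier
    images 𝕩 = var 𝕩
    images 𝕪 = con ι.⟦ u ⟧ ⊛ var 𝕪

    substitute : A.Carrier → A.Carrier
    substitute = eval constants images

    substitute-[x] : ∀ e → substitute (e [x]) A.≈ e [x]
    substitute-[x] (con a)  = con-cong (g.fixes a)
    substitute-[x] (var _)  = A.refl
    substitute-[x] (e ⊕ e') = A.+-cong (substitute-[x] e) (substitute-[x] e')
    substitute-[x] (e ⊛ e') = A.*-cong (substitute-[x] e) (substitute-[x] e')
    substitute-[x] (⊝ e)    = A.-‿cong (substitute-[x] e)

    substitute-power : ∀ e k → substitute (power e k) A.≈ substitute e ^ k
    substitute-power e zero    = con-cong g.1#-homo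
    substitute-power e (suc k) = A.*-congˡ (substitute-power e k)

    substitute-equation : Arithmetic._^_ ∣ K ∣ u d K.≈ K.1# →
      ∀ {e e'} → Equation e e' → substitute e A.≈ substitute e'
    substitute-equation uᵈ equation = A.trans (substitute-power (var 𝕪) d)
      (A.trans (^-distrib-* (con ι.⟦ u ⟧) (var 𝕪) d)
        (A.trans (A.*-congʳ (A.trans (hom-^ conHom _ d) (con-cong
            (K̄.trans (hom-^ ι u d) (K̄.trans (ι.⟦⟧-cong uᵈ) ι.1#-homo)))))
          (A.trans (A.*-identityˡ _) (A.trans (A.sym (power-^ (var 𝕪) d))
            (A.trans (relation equation) (A.sym (substitute-[x] f)))))))

  module _ {g h : Automorphism ι} {u w : K.Carrier}
           (p : ∀ a → Automorphism.to g a K̄.≈ Automorphism.to h a) (q : u K.≈ w) where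
    substitute-≈ : ∀ e → substitute g u e A.≈ substitute h w e
    substitute-≈ (con a)  = con-cong (p a)
    substitute-≈ (var 𝕩)  = A.refl
    substitute-≈ (var 𝕪)  = A.*-congʳ (con-cong (ι.⟦⟧-cong q))
    substitute-≈ (e ⊕ e') = A.+-cong (substitute-≈ e) (substitute-≈ e')
    substitute-≈ (e ⊛ e') = A.*-cong (substitute-≈ e) (substitute-≈ e')
    substitute-≈ (⊝ e)    = A.-‿cong (substitute-≈ e)

  substitute-ε : ∀ e → substitute (Group.ε Gal) K.1# e A.≈ e
  substitute-ε (con a)  = A.refl
  substitute-ε (var 𝕩)  = A.refl
  substitute-ε (var 𝕪)  = A.trans (A.*-congʳ (con-cong ι.1#-homo)) (A.*-identityˡ _)
  substitute-ε (e ⊕ e') = A.+-cong (substitute-ε e) (substitute-ε e')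
  substitute-ε (e ⊛ e') = A.*-cong (substitute-ε e) (substitute-ε e')
  substitute-ε (⊝ e)    = A.-‿cong (substitute-ε e)

  module _ (g h : Automorphism ι) (u w : K.Carrier) where
    substitute-∙ : ∀ e → substitute (Group._∙_ Gal g h) (u K.* w) e
                         A.≈ substitute g u (substitute h w e)
    substitute-∙ (con a)  = A.refl
    substitute-∙ (var 𝕩)  = A.refl
    substitute-∙ (var 𝕪)  = A.trans (A.*-congʳ (A.trans (con-cong (K̄.trans (ι.*-homo u w)
        (K̄.trans (K̄.*-comm _ _) (K̄.*-congʳ (K̄.sym (Automorphism.fixes g w)))))) (con-* _ _)))
      (A.*-assoc _ _ _)
    substitute-∙ (e ⊕ e') = A.+-cong (substitute-∙ e) (substitute-∙ e')
    substitute-∙ (e ⊛ e') = A.*-cong (substitute-∙ e) (substitute-∙ e')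
    substitute-∙ (⊝ e)    = A.-‿cong (substitute-∙ e)

  -- u ∈ μ_d acts on functions by h(x , y) ↦ h(x , u y), hence on divisor classes
  -- by pullback.  Acting by pushforward instead would replace u by u⁻¹.
  Symmetry : Grp
  Symmetry = DirectProduct.group Gal (μ d ∣ K ∣)

  substitute-cong : ∀ g u {e e'} → Arithmetic._^_ ∣ K ∣ u d K.≈ K.1# →
                    e A.≈ e' → substitute g u e A.≈ substitute g u e'
  substitute-cong g u uᵈ = eval-cong ∣ closure ∣ Equation (constants g u) (images g u)
                             (substitute-equation g u uᵈ)

  coordinateAction : RingAction Symmetry coordinateRing
  coordinateAction = record
    { act = λ (g , u , _) → substitute g u
    ; act-cong = λ {(g , u , uᵈ)} {(h , w , wᵈ)} {a} {b} (p , q) r →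
        A.trans (substitute-cong g u uᵈ r) (substitute-≈ {g} {h} p q b)
    ; act-hom = λ (g , u , uᵈ) → ringHomomorphism coordinateRing coordinateRing (substitute g u)
        (substitute-cong g u uᵈ) (λ _ _ → A.refl) (λ _ _ → A.refl) (con-cong (Automorphism.1#-homo g))
    ; act-ε = substitute-ε
    ; act-∙ = λ (g , u , _) (h , w , _) → substitute-∙ g h u w }

  private
    module Fr = Fractions coordinateRing

  base∘con : ∣ closure ∣ ⟶ functionField
  base∘con = record
    { ⟦_⟧ = Fr.base ∘ con
    ; isRingHomomorphism = ringHomomorphism ∣ closure ∣ functionField (Fr.base ∘ con)
        (_⟶_.⟦⟧-cong Fr.base-hom ∘ con-cong)
        (λ a b → F.trans (_⟶_.⟦⟧-cong Fr.base-hom (con-+ a b)) (_⟶_.+-homo Fr.base-hom _ _))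
        (λ a b → F.trans (_⟶_.⟦⟧-cong Fr.base-hom (con-* a b)) (_⟶_.*-homo Fr.base-hom _ _))
        F.refl }
    where module F = CommutativeRing functionField

  stable : ∀ s a → ¬ a K̄.≈ K̄.0# → ∃ λ b → (¬ b K̄.≈ K̄.0#) ×
    CommutativeRing._≈_ functionField
      (RingAction.act (fractionAction coordinateAction) s (_⟶_.⟦_⟧ base∘con a)) (_⟶_.⟦_⟧ base∘con b)
  stable (g , u) a a≉0 = g.to a , (λ p → a≉0 (g.injective (K̄.trans p (K̄.sym g.0#-homo)))) ,
    Fr.cross (A.*-congˡ {con (g.to a)} (A.sym (con-cong g.1#-homo)))
    where module g = Automorphism g

  open DivisorClasses closure functionField base∘con public using (Place; Divisor)

  -- The points of the Jacobian over the algebraic closure, as the group of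
  -- divisor classes of degree 0, with its action of Gal × μ_d.
  Jacobian : Representation Symmetry ℤ-ring
  Jacobian = DivisorClasses.Pic⁰ closure functionField base∘con (fractionAction coordinateAction) stable

module _ (ℓ : ℕ) (ℚℓ : FractionField (ℤ⟨ℓ⟩ ℓ)) where

  Vℓ : ∀ {Γ} → Representation Γ ℤ-ring → Representation Γ ∣ FractionField.field' ℚℓ ∣
  Vℓ J = extendScalars (FractionField.ι ℚℓ) (tate ℓ J)

module NewPart (K : Field) (K̄ : AlgebraicClosure K) (d : ℕ) .{{_ : NonZero d}} (f : Expr ∣ K ∣ ⊤)
               (ζ : Field.Carrier K) (ζᵈ : Field._≈_ K (Arithmetic._^_ ∣ K ∣ ζ d) (Field.1# K))
               (ℓ : ℕ) (ℚℓ : FractionField (ℤ⟨ℓ⟩ ℓ)) where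
  open Superelliptic K K̄ d f
  open Field K using (*-comm; refl)

  -- (x , y) ↦ (x , ζ y)
  t : Group.Carrier Symmetry
  t = Group.ε Gal , ζ , ζᵈ

  t-central : IsCentral Symmetry t
  t-central (g , u , _) = (λ _ → Field.refl (AlgebraicClosure.closure K̄)) , *-comm u ζ

  d-new : Representation Symmetry ∣ FractionField.field' ℚℓ ∣
  d-new = kernel (Vℓ ℓ ℚℓ Jacobian) t t-central (cyclotomic d)

  module _ (ℚ̄ℓ : AlgebraicClosure (FractionField.field' ℚℓ)) where

    newEigenspace : Field.Carrier (AlgebraicClosure.closure ℚ̄ℓ) →
                    Representation Gal ∣ AlgebraicClosure.closure ℚ̄ℓ ∣
    newEigenspace a = restrictˡ (eigenspace (extendScalars (AlgebraicClosure.ι ℚ̄ℓ) d-new) t t-central a)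

module Roots (K : Field) where
  open Field K
  open CommutativeExp commutativeSemiring
  open GroupProperties +-group using (x≈y⇒x∙y⁻¹≈ε; x∙y⁻¹≈ε⇒x≈y)
  open RingProperties (CommutativeRing.ring ∣ K ∣) using (x[y-z]≈xy-xz; -‿distribʳ-*)
  open SetoidReasoning setoid

  _≟_ : ∀ a b → Dec (a ≈ b)
  a ≟ b with zero⊎inverse (a - b)
  ... | inj₁ p       = yes (x∙y⁻¹≈ε⇒x≈y a b p)
  ... | inj₂ (w , p) = no λ q → 1≉0 (trans (sym p) (trans (*-congʳ (x≈y⇒x∙y⁻¹≈ε q)) (zeroˡ w)))

  cancel : ∀ {a b} → ¬ a ≈ 0# → a * b ≈ 0# → b ≈ 0#
  cancel {a} {b} a≉0 p with zero⊎inverse a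
  ... | inj₁ q       = ⊥-elim (a≉0 q)
  ... | inj₂ (w , q) = begin
    b            ≈⟨ *-identityˡ b ⟨
    1# * b       ≈⟨ *-congʳ (trans (sym q) (*-comm a w)) ⟩
    (w * a) * b  ≈⟨ *-assoc w a b ⟩
    w * (a * b)  ≈⟨ *-congˡ p ⟩
    w * 0#       ≈⟨ zeroʳ w ⟩
    0#           ∎

  private
    -- Monic polynomials, by their non-leading coefficients (constant term first).
    value : ∀ {m} → Vec Carrier m → Carrier → Carrier
    value []       x = 1#
    value (a ∷ as) x = a + x * value as x

    quotient : ∀ {m} → Carrier → Vec Carrier (suc m) → Vec Carrier m
    quotient r (a ∷ [])         = []
    quotient r (a ∷ as@(_ ∷ _)) = value as r ∷ quotient r as

    telescope : ∀ x r z → (x - r) * z + r * z ≈ x * z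
    telescope x r z = trans (sym (distribʳ z (x - r) r)) (*-congʳ (trans (+-assoc x (- r) r)
      (trans (+-congˡ (-‿inverseˡ r)) (+-identityʳ x))))

    division : ∀ {m} r x (as : Vec Carrier (suc m)) →
               value as x ≈ (x - r) * value (quotient r as) x + value as r
    division r x (a ∷ []) = begin
      a + x * 1#                         ≈⟨ +-congˡ (telescope x r 1#) ⟨
      a + ((x - r) * 1# + r * 1#)        ≈⟨ swap a _ _ ⟩
      (x - r) * 1# + (a + r * 1#)        ∎
      where
      open Solver commutativeSemiring using (solve; _:+_; _:=_)
      swap : ∀ a b c → a + (b + c) ≈ b + (a + c)
      swap = solve 3 (λ a b c → a :+ (b :+ c) := b :+ (a :+ c)) refl
    division r x (a ∷ as@(_ ∷ _)) = begin
      a + x * value as x                           ≈⟨ +-congˡ (*-congˡ (division r x as)) ⟩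
      a + x * ((x - r) * q + w)                    ≈⟨ expand a x (x - r) q w ⟩
      a + (x * w + (x - r) * (x * q))              ≈⟨ +-congˡ (+-congʳ (telescope x r w)) ⟨
      a + (((x - r) * w + r * w) + (x - r) * (x * q)) ≈⟨ collect a (x - r) w (r * w) (x * q) ⟩
      (x - r) * (w + x * q) + (a + r * w)          ∎
      where
      q = value (quotient r as) x
      w = value as r
      open Solver commutativeSemiring using (solve; _:+_; _:*_; _:=_)
      expand : ∀ a x s q w → a + x * (s * q + w) ≈ a + (x * w + s * (x * q))
      expand = solve 5 (λ a x s q w → a :+ x :* (s :* q :+ w) := a :+ (x :* w :+ s :* (x :* q))) refl
      collect : ∀ a s w b e → a + ((s * w + b) + s * e) ≈ s * (w + e) + (a + b)
      collect = solve 5 (λ a s w b e → a :+ ((s :* w :+ b) :+ s :* e) := s :* (w :+ e) :+ (a :+ b)) refl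

    few-roots : ∀ {m} (as : Vec Carrier m) (r : Fin (suc m) → Carrier) →
                (∀ i j → i ≢ j → ¬ r i ≈ r j) → (∀ i → value as (r i) ≈ 0#) → ⊥
    few-roots []       r distinct root = 1≉0 (root Fin.zero)
    few-roots (a ∷ as) r distinct root = few-roots (quotient r₀ (a ∷ as)) (r ∘ Fin.suc)
      (λ i j i≢j → distinct (Fin.suc i) (Fin.suc j) (i≢j ∘ Finₚ.suc-injective))
      (λ i → cancel (λ p → distinct (Fin.suc i) Fin.zero (λ ()) (x∙y⁻¹≈ε⇒x≈y _ _ p))
        (trans (sym (+-identityʳ _)) (trans (+-congˡ (sym (root Fin.zero)))
          (trans (sym (division r₀ (r (Fin.suc i)) (a ∷ as))) (root (Fin.suc i))))))
      where r₀ = r Fin.zero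

    xⁿ-1 : ∀ m → Vec Carrier (suc m)
    xⁿ-1 m = - 1# ∷ Vec.replicate m 0#

    value-replicate : ∀ m x → value (Vec.replicate m 0#) x ≈ x ^ m
    value-replicate zero    x = refl
    value-replicate (suc m) x = trans (+-identityˡ _) (*-congˡ (value-replicate m x))

    root-xⁿ-1 : ∀ m {u} → u ^ suc m ≈ 1# → value (xⁿ-1 m) u ≈ 0#
    root-xⁿ-1 m p = trans (+-congˡ (trans (*-congˡ (value-replicate m _)) p)) (-‿inverseˡ 1#)

  private
    module _ {n ζ} (prim : IsPrimitiveRoot ∣ K ∣ n ζ) where
      one^ : ∀ k → 1# ^ k ≈ 1#
      one^ zero    = refl
      one^ (suc k) = trans (*-identityˡ _) (one^ k)

      ordered : ∀ {i j} → i ℕ.< j → j ℕ.< n → ¬ ζ ^ i ≈ ζ ^ j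
      ordered {i} {j} i<j j<n p = proj₂ prim (j ℕ.∸ i) (ℕₚ.m<n⇒0<n∸m i<j)
        (ℕₚ.≤-<-trans (ℕₚ.m∸n≤m j i) j<n) (begin
          ζ ^ (j ℕ.∸ i)                       ≈⟨ *-identityˡ _ ⟨
          1# * ζ ^ (j ℕ.∸ i)                  ≈⟨ *-congʳ unit ⟨
          (ζ ^ (n ℕ.∸ i) * ζ ^ i) * ζ ^ (j ℕ.∸ i) ≈⟨ *-assoc _ _ _ ⟩
          ζ ^ (n ℕ.∸ i) * (ζ ^ i * ζ ^ (j ℕ.∸ i)) ≈⟨ *-congˡ (^-homo-* ζ i (j ℕ.∸ i)) ⟨
          ζ ^ (n ℕ.∸ i) * ζ ^ (i ℕ.+ (j ℕ.∸ i))  ≈⟨ *-congˡ (^-congʳ ζ (ℕₚ.m+[n∸m]≡n (ℕₚ.<⇒≤ i<j))) ⟩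
          ζ ^ (n ℕ.∸ i) * ζ ^ j               ≈⟨ *-congˡ p ⟨
          ζ ^ (n ℕ.∸ i) * ζ ^ i               ≈⟨ unit ⟩
          1#                                  ∎)
        where
        unit : ζ ^ (n ℕ.∸ i) * ζ ^ i ≈ 1#
        unit = trans (sym (^-homo-* ζ (n ℕ.∸ i) i))
          (trans (^-congʳ ζ (ℕₚ.m∸n+n≡m (ℕₚ.<⇒≤ (ℕₚ.<-trans i<j j<n)))) (proj₁ prim))

      distinct : ∀ (i j : Fin n) → i ≢ j → ¬ ζ ^ toℕ i ≈ ζ ^ toℕ j
      distinct i j i≢j p with ℕₚ.<-cmp (toℕ i) (toℕ j)
      ... | tri< i<j _ _ = ordered i<j (Finₚ.toℕ<n j) p
      ... | tri≈ _ e _   = i≢j (Finₚ.toℕ-injective e)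
      ... | tri> _ _ j<i = ordered j<i (Finₚ.toℕ<n i) (sym p)

      ζ^-root : ∀ k → (ζ ^ k) ^ n ≈ 1#
      ζ^-root k = trans (^-assocʳ ζ k n) (trans (^-congʳ ζ (ℕₚ.*-comm k n))
        (trans (sym (^-assocʳ ζ n k)) (trans (^-congˡ k (proj₁ prim)) (one^ k))))

  power-of : ∀ {n ζ} .{{_ : NonZero n}} → IsPrimitiveRoot ∣ K ∣ n ζ →
             ∀ {u} → u ^ n ≈ 1# → ∃ λ k → u ≈ ζ ^ k
  power-of {n@(suc m)} {ζ} prim {u} uⁿ with Finₚ.any? (λ (i : Fin n) → u ≟ (ζ ^ toℕ i))
  ... | yes (i , p) = toℕ i , p
  ... | no none     = ⊥-elim (few-roots (xⁿ-1 m) r r-distinct (λ i → root-xⁿ-1 m (r-root i)))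
    where
    r : Fin (suc n) → Carrier
    r Fin.zero    = u
    r (Fin.suc i) = ζ ^ toℕ i
    r-distinct : ∀ i j → i ≢ j → ¬ r i ≈ r j
    r-distinct Fin.zero    Fin.zero    i≢j _ = i≢j ≡.refl
    r-distinct Fin.zero    (Fin.suc j) _   p = none (j , p)
    r-distinct (Fin.suc i) Fin.zero    _   p = none (i , sym p)
    r-distinct (Fin.suc i) (Fin.suc j) i≢j p = distinct prim i j (i≢j ∘ ≡.cong Fin.suc) p
    r-root : ∀ i → r i ^ n ≈ 1#
    r-root Fin.zero    = uⁿ
    r-root (Fin.suc i) = ζ^-root prim (toℕ i)

-- R[γ] ⊆ S, each element carried together with a polynomial expression in γ.
module Adjoin {R S : CRing} (ι : R ⟶ S) (γ : CommutativeRing.Carrier S) where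
  private
    module R = CommutativeRing R
    module S = CommutativeRing S
    module ι = _⟶_ ι

  evalγ : Expr R ⊤ → S.Carrier
  evalγ = eval ι (λ _ → γ)

  adjoin : CRing
  adjoin = record
    { Carrier = ∃ λ z → ∃ λ P → evalγ P S.≈ z
    ; _≈_ = λ z w → proj₁ z S.≈ proj₁ w
    ; _+_ = λ (z , P , p) (w , Q , q) → z S.+ w , P ⊕ Q , S.+-cong p q
    ; _*_ = λ (z , P , p) (w , Q , q) → z S.* w , P ⊛ Q , S.*-cong p q
    ; -_ = λ (z , P , p) → S.- z , ⊝ P , S.-‿cong p
    ; 0# = S.0# , con R.0# , ι.0#-homo
    ; 1# = S.1# , con R.1# , ι.1#-homo
    ; isCommutativeRing = record
      { isRing = record
        { +-isAbelianGroup = record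
          { isGroup = record
            { isMonoid = record
              { isSemigroup = record
                { isMagma = record
                  { isEquivalence = record { refl = S.refl ; sym = S.sym ; trans = S.trans }
                  ; ∙-cong = S.+-cong }
                ; assoc = λ _ _ _ → S.+-assoc _ _ _ }
              ; identity = (λ _ → S.+-identityˡ _) , (λ _ → S.+-identityʳ _) }
            ; inverse = (λ _ → S.-‿inverseˡ _) , (λ _ → S.-‿inverseʳ _)
            ; ⁻¹-cong = S.-‿cong }
          ; comm = λ _ _ → S.+-comm _ _ }
        ; *-cong = S.*-cong
        ; *-assoc = λ _ _ _ → S.*-assoc _ _ _
        ; *-identity = (λ _ → S.*-identityˡ _) , (λ _ → S.*-identityʳ _)
        ; distrib = (λ _ _ _ → S.distribˡ _ _ _) , (λ _ _ _ → S.distribʳ _ _ _) }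
      ; *-comm = λ _ _ → S.*-comm _ _ } }

  generator : CommutativeRing.Carrier adjoin
  generator = γ , var tt , S.refl

  inclusion : R ⟶ adjoin
  inclusion = record
    { ⟦_⟧ = λ a → ι.⟦ a ⟧ , con a , S.refl
    ; isRingHomomorphism = ringHomomorphism R adjoin _ ι.⟦⟧-cong ι.+-homo ι.*-homo ι.1#-homo }

IsRadical : {K : Field} (K̄ : AlgebraicClosure K) → ℕ → Field.Carrier K →
            Field.Carrier (AlgebraicClosure.closure K̄) → Set
IsRadical K̄ n c γ = γ ^ n ≈ _⟶_.⟦_⟧ ι c
  where
  open AlgebraicClosure K̄ using (closure; ι)
  open Field closure using (_≈_)
  open Arithmetic ∣ closure ∣ using (_^_)

module Kummer (K : Field) (K̄ : AlgebraicClosure K) (n : ℕ) .{{_ : NonZero n}}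
              {ζ : Field.Carrier K} (prim : IsPrimitiveRoot ∣ K ∣ n ζ)
              {c : Field.Carrier K} (c≉0 : ¬ Field._≈_ K c (Field.0# K))
              {γ : Field.Carrier (AlgebraicClosure.closure K̄)}
              (γⁿ : IsRadical K̄ n c γ) where
  open AlgebraicClosure K̄ using (closure; ι)
  open Adjoin ι γ using (evalγ)
  private
    module K = Field K
    module C = Field closure
    module ι = _⟶_ ι
    open CommutativeExp C.commutativeSemiring
    module Kᵉ = CommutativeExp K.commutativeSemiring
    open SetoidReasoning C.setoid

  L : CRing
  L = Adjoin.adjoin ι γ

  K→L : ∣ K ∣ ⟶ L
  K→L = Adjoin.inclusion ι γ

  ι-nonzero : ∀ {a} → ¬ a K.≈ K.0# → ¬ ι.⟦ a ⟧ C.≈ C.0#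
  ι-nonzero {a} a≉0 p with K.zero⊎inverse a
  ... | inj₁ q       = a≉0 q
  ... | inj₂ (b , q) = C.1≉0 (C.trans (C.sym ι.1#-homo) (C.trans (ι.⟦⟧-cong (K.sym q))
                         (C.trans (ι.*-homo a b) (C.trans (C.*-congʳ p) (C.zeroˡ _)))))

  ι-injective : ∀ {a b} → ι.⟦ a ⟧ C.≈ ι.⟦ b ⟧ → a K.≈ b
  ι-injective {a} {b} p with Roots._≟_ K a b
  ... | yes q = q
  ... | no a≉b = ⊥-elim (ι-nonzero (λ q → a≉b (GroupProperties.x∙y⁻¹≈ε⇒x≈y K.+-group a b q))
      (C.trans (ι.+-homo a (K.- b)) (C.trans (C.+-congˡ (ι.-‿homo b))
        (GroupProperties.x≈y⇒x∙y⁻¹≈ε C.+-group p))))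

  ιζ-prim : IsPrimitiveRoot ∣ closure ∣ n ι.⟦ ζ ⟧
  ιζ-prim = C.trans (hom-^ ι ζ n) (C.trans (ι.⟦⟧-cong (proj₁ prim)) ι.1#-homo) ,
    λ k 0<k k<n p → proj₂ prim k 0<k k<n (ι-injective
      (C.trans (C.sym (hom-^ ι ζ k)) (C.trans p (C.sym ι.1#-homo))))

  γ≉0 : ¬ γ C.≈ C.0#
  γ≉0 p = ι-nonzero c≉0 (C.trans (C.sym γⁿ) (C.trans (^-congˡ n p) (zero^ n)))
    where
    zero^ : ∀ n .{{_ : NonZero n}} → C.0# ^ n C.≈ C.0#
    zero^ (suc n) = C.zeroˡ _

  image : (g : Automorphism ι) → ∃ λ k → Automorphism.to g γ C.≈ ι.⟦ ζ ⟧ ^ k C.* γ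
  image g with C.zero⊎inverse γ
  ... | inj₁ p       = ⊥-elim (γ≉0 p)
  ... | inj₂ (w , p) = k , (begin
    g.to γ                ≈⟨ C.*-identityʳ _ ⟨
    g.to γ C.* C.1#       ≈⟨ C.*-congˡ (C.trans (C.sym p) (C.*-comm γ w)) ⟩
    g.to γ C.* (w C.* γ)  ≈⟨ C.*-assoc _ _ _ ⟨
    (g.to γ C.* w) C.* γ  ≈⟨ C.*-congʳ e ⟩
    ι.⟦ ζ ⟧ ^ k C.* γ     ∎)
    where
    module g = Automorphism g
    gHom : ∣ closure ∣ ⟶ ∣ closure ∣
    gHom = record { ⟦_⟧ = g.to ; isRingHomomorphism = g.isRingHomomorphism }
    one^ : ∀ k → C.1# ^ k C.≈ C.1#
    one^ zero    = C.refl
    one^ (suc k) = C.trans (C.*-identityˡ _) (one^ k)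
    root : (g.to γ C.* w) ^ n C.≈ C.1#
    root = begin
      (g.to γ C.* w) ^ n      ≈⟨ ^-distrib-* _ _ n ⟩
      g.to γ ^ n C.* w ^ n    ≈⟨ C.*-congʳ (C.trans (hom-^ gHom γ n) (C.trans (g.⟦⟧-cong γⁿ)
                                   (C.trans (g.fixes c) (C.sym γⁿ)))) ⟩
      γ ^ n C.* w ^ n         ≈⟨ ^-distrib-* γ w n ⟨
      (γ C.* w) ^ n           ≈⟨ ^-congˡ n p ⟩
      C.1# ^ n                ≈⟨ one^ n ⟩
      C.1#                    ∎
    k = proj₁ (Roots.power-of closure ιζ-prim root)
    e = proj₂ (Roots.power-of closure ιζ-prim root)

  scaleX : K.Carrier → Expr ∣ K ∣ ⊤ → Expr ∣ K ∣ ⊤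
  scaleX u (con a)  = con a
  scaleX u (var _)  = con u ⊛ var tt
  scaleX u (e ⊕ e') = scaleX u e ⊕ scaleX u e'
  scaleX u (e ⊛ e') = scaleX u e ⊛ scaleX u e'
  scaleX u (⊝ e)    = ⊝ scaleX u e

  module _ (g : Automorphism ι) where
    private module g = Automorphism g

    ζᵏ : K.Carrier
    ζᵏ = ζ Kᵉ.^ proj₁ (image g)

    evalγ-scaleX : ∀ P → evalγ (scaleX ζᵏ P) C.≈ g.to (evalγ P)
    evalγ-scaleX (con a)  = C.sym (g.fixes a)
    evalγ-scaleX (var _)  = C.sym (C.trans (proj₂ (image g))
                              (C.*-congʳ (hom-^ ι ζ (proj₁ (image g)))))
    evalγ-scaleX (e ⊕ e') = C.trans (C.+-cong (evalγ-scaleX e) (evalγ-scaleX e')) (C.sym (g.+-homo _ _))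
    evalγ-scaleX (e ⊛ e') = C.trans (C.*-cong (evalγ-scaleX e) (evalγ-scaleX e')) (C.sym (g.*-homo _ _))
    evalγ-scaleX (⊝ e)    = C.trans (C.-‿cong (evalγ-scaleX e)) (C.sym (g.-‿homo _))

    restrictTo : CommutativeRing.Carrier L → CommutativeRing.Carrier L
    restrictTo (z , P , p) = g.to z , scaleX ζᵏ P , C.trans (evalγ-scaleX P) (g.⟦⟧-cong p)

  restriction : Automorphism ι → Automorphism K→L
  restriction g = record
    { to = restrictTo g
    ; isRingIsomorphism = record
      { isRingMonomorphism = record
        { isRingHomomorphism = ringHomomorphism L L (restrictTo g) g.⟦⟧-cong
            (λ _ _ → g.+-homo _ _) (λ _ _ → g.*-homo _ _) g.1#-homo
        ; injective = g.injective }
      ; surjective = λ z → restrictTo (Group._⁻¹ (Aut ι) g) z ,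
          λ p → C.trans (g.⟦⟧-cong p) (g.to-from (proj₁ z)) }
    ; fixes = g.fixes }
    where module g = Automorphism g

  inflate : ∀ {E} → Character (Aut K→L) E → Character (Aut ι) E
  inflate {E} ψ = record
    { χ = λ g → χ (restriction g)
    ; χ-cong = λ {g} {h} p → χ-cong {restriction g} {restriction h} (λ z → p (proj₁ z))
    ; χ-ε = E.trans (χ-cong {restriction (Group.ε (Aut ι))} {Group.ε (Aut K→L)} (λ _ → C.refl)) χ-ε
    ; χ-∙ = λ g h → E.trans (χ-cong {restriction (Group._∙_ (Aut ι) g h)}
        {Group._∙_ (Aut K→L) (restriction g) (restriction h)} (λ _ → C.refl))
        (χ-∙ (restriction g) (restriction h)) }
    where
    open Character ψ
    module E = CommutativeRing E

Generates : (G : Grp) → Group.Carrier G → Set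
Generates G σ = ∀ τ → ∃ λ k → τ ≈ k ×ᴳ σ
  where
  open Group G
  open Multiples monoid renaming (_×_ to _×ᴳ_)

ζ-power : ∀ (R : CRing) {n d ζ} .{{_ : NonZero d}} →
          let open CommutativeRing R using (_≈_; 1#)
              open Arithmetic R using (_^_) in
          d ℕᵈ.∣ n → ζ ^ n ≈ 1# → (ζ ^ (n ℕ./ d)) ^ d ≈ 1#
ζ-power R {n} {d} {ζ} d∣n p = trans (^-assocʳ ζ (n ℕ./ d) d) (trans (^-congʳ ζ (ℕ/.m/n*n≡m d∣n)) p)
  where
  open CommutativeRing R
  open CommutativeExp commutativeSemiring

-- The subspace V_ℓ^(i)(Jac(C_d))^{d-new} for C_d : yᵈ = f(x), on which t acts
-- as ζ_d^i; here ζ_d is ζ^(n/d) in K and ζℓ^(n/d) in ℚ̄ℓ.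
V⁽_⁾ : (i : ℕ) {K : Field} (K̄ : AlgebraicClosure K)
       {n : ℕ} {ζ : Field.Carrier K} → IsPrimitiveRoot ∣ K ∣ n ζ →
       (ℓ : ℕ) (ℚℓ : FractionField (ℤ⟨ℓ⟩ ℓ)) (ℚ̄ℓ : AlgebraicClosure (FractionField.field' ℚℓ)) →
       Field.Carrier (AlgebraicClosure.closure ℚ̄ℓ) →
       (d : ℕ) .{{_ : NonZero d}} → d ℕᵈ.∣ n → (f : Expr ∣ K ∣ ⊤) →
       Representation (Aut (AlgebraicClosure.ι K̄)) ∣ AlgebraicClosure.closure ℚ̄ℓ ∣
V⁽ i ⁾ {K} K̄ {n} {ζ} prim ℓ ℚℓ ℚ̄ℓ ζℓ d d∣n f =
  NewPart.newEigenspace K K̄ d f (ζ ^ (n ℕ./ d)) (ζ-power ∣ K ∣ d∣n (proj₁ prim)) ℓ ℚℓ ℚ̄ℓ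
    ((ζℓ E.^ (n ℕ./ d)) E.^ i)
  where
  open Arithmetic ∣ K ∣ using (_^_)
  module E = Arithmetic ∣ AlgebraicClosure.closure ℚ̄ℓ ∣

{-# OPTIONS --safe #-}
-- With γⁿ = c, the rule y ↦ γ^(n/d) y identifies C_d' with C_d over K̄ and commutes with t.
-- If g γ = ζᵏ γ, conjugating g by this identification changes it by tᵏ, which is the scalar
-- ζ_d^(ik) on the i-th eigenspace; χ takes the value ζᵏ at g, since both are governed by the
-- power of σ to which g restricts.  The identification is carried from coordinate rings to
-- places, divisor classes, Tate modules and eigenspaces, remembering at each stage only
-- which pairs of symmetries it intertwines.
module Submission where

open import Defs
open import Algebra.Bundles using (CommutativeRing; Group)
import Algebra.Construct.DirectProduct as DirectProduct
open import Algebra.Module.Bundles using (LeftModule)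
import Algebra.Properties.CommutativeSemiring.Exp as CommutativeExp
import Algebra.Properties.Monoid.Mult as Multiples
import Data.Integer.Base as ℤ
open import Data.Integer.Base using (0ℤ)
open import Data.List.Base as List using ([]; _∷_)
import Data.List.Membership.Setoid as Membership
import Data.List.Membership.Setoid.Properties as Membershipₚ
import Data.List.Relation.Unary.Unique.Setoid.Properties as UniqueListₚ
import Data.Maybe.Base as Maybe
import Data.Maybe.Relation.Unary.All as MaybeAll
open import Data.Nat.Base using (ℕ; zero; suc; NonZero; _≤_; _*_; _/_)
import Data.Nat.DivMod as ℕ/
import Data.Nat.Properties as ℕₚ
open import Data.Nat.Coprimality using (Coprime)
open import Data.Nat.Divisibility using (_∣_)
open import Data.Nat.Primality using (Prime)
open import Data.Product.Base using (∃; _×_; _,_; proj₁; proj₂; map₁)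
open import Data.Sum.Base using (inj₁; inj₂)
open import Data.Unit.Base using (⊤)
open import Function.Base using (flip; id)
open import Function.Bundles using (mk⇔; Equivalence)
open import Relation.Binary.Bundles using (Setoid)
open import Relation.Binary.PropositionalEquality as ≡ using (_≡_; _≢_)
import Relation.Binary.Reasoning.Setoid as SetoidReasoning
open import Relation.Nullary using (¬_; contradiction)

-- The obstacle is that a = γ^(n/d) lies in K̄ and in general not in K, so y ↦ a y identifies the
-- curves without commuting with Galois. It matches (g , u) on C_d' with (g , u') on C_d exactly
-- when u a = g(a) u'. This is the graph of the automorphism of Gal × μ_d given by the Kummer
-- cocycle a / g(a); carrying the bare relation spares every stage from constructing that
-- automorphism. The relation pairs t with t, because t fixes the constant a, so eigenspaces with
-- the same i correspond. It pairs (g , ζ_d^k) with (g , 1) when g a = ζ_d^k a, and this is the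
-- source of the twist. If g restricts to σ^j, then k = (n/r) j serves. The resulting scalar is the
-- i(n/d)-th power of the value χ(g) = ζ^k, whence the exponent i(n/d), which is i when d = n.

open Fractions using (totalFractions)

-- Isomorphisms of rings and of their total rings of fractions.

infix 1 _≃ᴿ_

-- The inverse is part of the data because valuations are transported by composing with it.
record _≃ᴿ_ (R S : CRing) : Set where
  private
    module R = CommutativeRing R
    module S = CommutativeRing S
  field
    hom  : R ⟶ S
    hom⁻ : S ⟶ R
  module To = _⟶_ hom
  module From = _⟶_ hom⁻
  field
    to-from : ∀ y → To.⟦ From.⟦ y ⟧ ⟧ S.≈ y
    from-to : ∀ x → From.⟦ To.⟦ x ⟧ ⟧ R.≈ x
  open To public using () renaming (⟦_⟧ to to)
  open From public using () renaming (⟦_⟧ to from)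

≃ᴿ-sym : ∀ {R S} → R ≃ᴿ S → S ≃ᴿ R
≃ᴿ-sym φ = record { hom = hom⁻ ; hom⁻ = hom ; to-from = from-to ; from-to = to-from }
  where open _≃ᴿ_ φ

module _ {A B : CRing} (φ : A ≃ᴿ B) where
  private
    module A = CommutativeRing A
    module B = CommutativeRing B
  open _≃ᴿ_ φ
  open Fractions using (_/_⟨_⟩; cross; uncross; num; den; regular)

  -- If `to s` kills `b`, applying `from` shows that `s` kills `from b`.
  to-regular : ∀ {s} → IsRegular A s → IsRegular B (to s)
  to-regular {s} hs b p = B.trans (B.sym (to-from b)) (B.trans (To.⟦⟧-cong (hs (from b)
      (A.trans (A.*-congʳ (A.sym (from-to s)))
        (A.trans (A.sym (From.*-homo _ _)) (A.trans (From.⟦⟧-cong p) From.0#-homo)))))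
    To.0#-homo)

  mapFractions : totalFractions A ⟶ totalFractions B
  mapFractions = record
    { ⟦_⟧ = λ z → to (num z) / to (den z) ⟨ to-regular (regular z) ⟩
    ; isRingHomomorphism = ringHomomorphism (totalFractions A) (totalFractions B) _
        (λ p → cross (B.trans (B.sym (To.*-homo _ _)) (B.trans (To.⟦⟧-cong (uncross p)) (To.*-homo _ _))))
        (λ _ _ → cross (B.*-cong (B.trans (To.+-homo _ _) (B.+-cong (To.*-homo _ _) (To.*-homo _ _)))
                                 (B.sym (To.*-homo _ _))))
        (λ _ _ → cross (B.*-cong (To.*-homo _ _) (B.sym (To.*-homo _ _))))
        (cross (B.*-cong To.1#-homo (B.sym To.1#-homo))) }

totalFractions-≃ : ∀ {A B} → A ≃ᴿ B → totalFractions A ≃ᴿ totalFractions B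
totalFractions-≃ {A} {B} φ = record
  { hom     = mapFractions φ
  ; hom⁻    = mapFractions (≃ᴿ-sym φ)
  ; to-from = λ _ → Fractions.cross (B.*-cong (to-from _) (B.sym (to-from _)))
  ; from-to = λ _ → Fractions.cross (A.*-cong (from-to _) (A.sym (from-to _))) }
  where
  open _≃ᴿ_ φ
  module A = CommutativeRing A
  module B = CommutativeRing B

-- Isomorphisms of modules, in particular of presented modules.

linearIso : ∀ {R : CRing} {M N : Mod R} → let module M = LeftModule M
                                              module N = LeftModule N in
  {f : M.Carrierᴹ → N.Carrierᴹ} → IsLinear R M N f →
  (∀ {x y} → f x N.≈ᴹ f y → x M.≈ᴹ y) → (∀ y → ∃ λ x → f x N.≈ᴹ y) → IsLinearIso R M N f
linearIso {N = N} f-linear injective surjective = record { isLeftModuleIsomorphism = record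
  { isLeftModuleMonomorphism = record
    { isLeftModuleHomomorphism = isLeftModuleHomomorphism
    ; injective = injective }
  ; surjective = λ y → let (x , e) = surjective y in x , λ p → N.≈ᴹ-trans (⟦⟧-cong p) e } }
  where
  open IsLinear f-linear
  module N = LeftModule N

record ModuleIso (R : CRing) (M N : Mod R) : Set where
  private
    module M = LeftModule M
    module N = LeftModule N
  field
    to        : M.Carrierᴹ → N.Carrierᴹ
    from      : N.Carrierᴹ → M.Carrierᴹ
    to-linear : IsLinear R M N to
    from-cong : ∀ {x y} → x N.≈ᴹ y → from x M.≈ᴹ from y
    to-from   : ∀ y → to (from y) N.≈ᴹ y
    from-to   : ∀ x → from (to x) M.≈ᴹ x
  open IsLinear to-linear public using () renaming
    (⟦⟧-cong to to-cong; +ᴹ-homo to to-+; *ₗ-homo to to-*ₗ; 0ᴹ-homo to to-0)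

  injective : ∀ {x y} → to x N.≈ᴹ to y → x M.≈ᴹ y
  injective p = M.≈ᴹ-trans (M.≈ᴹ-sym (from-to _)) (M.≈ᴹ-trans (from-cong p) (from-to _))

  from-linear : IsLinear R N M from
  from-linear = linear R N M from from-cong
    (λ x y → injective (N.≈ᴹ-trans (to-from _) (N.≈ᴹ-sym (N.≈ᴹ-trans (to-+ _ _)
      (N.+ᴹ-cong (to-from x) (to-from y))))))
    (λ a x → injective (N.≈ᴹ-trans (to-from _) (N.≈ᴹ-sym (N.≈ᴹ-trans (to-*ₗ _ _)
      (N.*ₗ-congˡ (to-from x))))))

  isLinearIso : IsLinearIso R M N to
  isLinearIso = linearIso to-linear injective (λ y → from y , to-from y)

ModuleIso-sym : ∀ {R M N} → ModuleIso R M N → ModuleIso R N M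
ModuleIso-sym i = record
  { to = from ; from = to ; to-linear = from-linear ; from-cong = to-cong
  ; to-from = from-to ; from-to = to-from }
  where open ModuleIso i

module _ {R : CRing} {X Y : Set}
         (_≐_ : Lin R X → Lin R X → Set) (_≐'_ : Lin R Y → Lin R Y → Set) where

  mapLin-respects : (f : X → Y) → (∀ {s t} → s ≐ t → _≋_ R _≐'_ (mapLin f s) (mapLin f t)) →
    ∀ {s t} → _≋_ R _≐_ s t → _≋_ R _≐'_ (mapLin f s) (mapLin f t)
  mapLin-respects f r (relation p)    = r p
  mapLin-respects f r ≋-refl          = ≋-refl
  mapLin-respects f r (≋-sym p)       = ≋-sym (mapLin-respects f r p)
  mapLin-respects f r (≋-trans p q)   = ≋-trans (mapLin-respects f r p) (mapLin-respects f r q)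
  mapLin-respects f r (⊞-cong p q)    = ⊞-cong (mapLin-respects f r p) (mapLin-respects f r q)
  mapLin-respects f r (⊟-cong p)      = ⊟-cong (mapLin-respects f r p)
  mapLin-respects f r (·-cong p q)    = ·-cong p (mapLin-respects f r q)
  mapLin-respects f r (⊞-assoc _ _ _) = ⊞-assoc _ _ _
  mapLin-respects f r (⊞-comm _ _)    = ⊞-comm _ _
  mapLin-respects f r (⊞-idˡ _)       = ⊞-idˡ _
  mapLin-respects f r (⊞-invˡ _)      = ⊞-invˡ _
  mapLin-respects f r (·-zeroˡ _)     = ·-zeroˡ _
  mapLin-respects f r (·-zeroʳ _)     = ·-zeroʳ _
  mapLin-respects f r (·-distʳ _ _ _) = ·-distʳ _ _ _
  mapLin-respects f r (·-distˡ _ _ _) = ·-distˡ _ _ _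
  mapLin-respects f r (·-one _)       = ·-one _
  mapLin-respects f r (·-assoc _ _ _) = ·-assoc _ _ _

module _ {R : CRing} {X Y Z W : Set} (_≐_ : Lin R W → Lin R W → Set)
         (f : Y → W) (g : X → Y) (h : Z → W) (k : X → Z)
         (square : ∀ x → _≋_ R _≐_ (gen (f (g x))) (gen (h (k x)))) where

  mapLin-square : ∀ t → _≋_ R _≐_ (mapLin f (mapLin g t)) (mapLin h (mapLin k t))
  mapLin-square (gen x) = square x
  mapLin-square 𝟎       = ≋-refl
  mapLin-square (s ⊞ t) = ⊞-cong (mapLin-square s) (mapLin-square t)
  mapLin-square (⊟ t)   = ⊟-cong (mapLin-square t)
  mapLin-square (a · t) = ·-cong (CommutativeRing.refl R) (mapLin-square t)

module _ {R : CRing} {X Y : Set} (_≐_ : Lin R X → Lin R X → Set)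
         (f : Y → X) (g : X → Y) (inverse : ∀ x → _≋_ R _≐_ (gen (f (g x))) (gen x)) where

  mapLin-inverse : ∀ t → _≋_ R _≐_ (mapLin f (mapLin g t)) t
  mapLin-inverse t = ≡.subst (λ u → _≋_ R _≐_ (mapLin f (mapLin g t)) u)
    (≡.trans (mapLin-id (mapLin id t)) (mapLin-id t)) (mapLin-square _≐_ f g id id inverse t)

module _ {R : CRing} {X Y : Set}
         {_≐_ : Lin R X → Lin R X → Set} {_≐'_ : Lin R Y → Lin R Y → Set} where

  -- `f` and `g` need to be mutually inverse only modulo the relations: carrying a place forth and
  -- back returns the same valuation up to pointwise equality, which the relation `same` absorbs.
  presentedModule-≃ : (f : X → Y) (g : Y → X) →
    (∀ {s t} → s ≐ t → _≋_ R _≐'_ (mapLin f s) (mapLin f t)) →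
    (∀ {s t} → s ≐' t → _≋_ R _≐_ (mapLin g s) (mapLin g t)) →
    (∀ y → _≋_ R _≐'_ (gen (f (g y))) (gen y)) →
    (∀ x → _≋_ R _≐_ (gen (g (f x))) (gen x)) →
    ModuleIso R (presentedModule R _≐_) (presentedModule R _≐'_)
  presentedModule-≃ f g f-resp g-resp fg gf = record
    { to        = mapLin f
    ; from      = mapLin g
    ; to-linear = linear R (presentedModule R _≐_) (presentedModule R _≐'_) (mapLin f)
        (mapLin-respects _≐_ _≐'_ f f-resp) (λ _ _ → ≋-refl) (λ _ _ → ≋-refl)
    ; from-cong = mapLin-respects _≐'_ _≐_ g g-resp
    ; to-from   = mapLin-inverse _≐'_ f g fg
    ; from-to   = mapLin-inverse _≐_ g f gf }

-- Intertwiners, and their passage to kernels, eigenspaces, scalar extensions and Tate modules.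

-- `_↝_` is an arbitrary relation, not assumed compatible with products or inverses. Reversing an
-- intertwiner therefore only flips it.
record Intertwiner {Γ Γ' : Grp} (_↝_ : Group.Carrier Γ → Group.Carrier Γ' → Set) {R : CRing}
                   (ρ : Representation Γ R) (ρ' : Representation Γ' R) : Set where
  private
    module ρ = Representation ρ
    module ρ' = Representation ρ'
  field
    iso : ModuleIso R ρ.space ρ'.space
  open ModuleIso iso public
  field
    equivariant : ∀ {s s'} → s ↝ s' → ∀ x → to (ρ.act s x) ρ'.≈ᴹ ρ'.act s' (to x)

module _ {Γ Γ' : Grp} {_↝_ : Group.Carrier Γ → Group.Carrier Γ' → Set} {R : CRing} where

  Intertwiner-sym : {ρ : Representation Γ R} {ρ' : Representation Γ' R} →
                    Intertwiner {Γ} {Γ'} _↝_ ρ ρ' → Intertwiner {Γ'} {Γ} (flip _↝_) ρ' ρ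
  Intertwiner-sym {ρ} {ρ'} I = record
    { iso = ModuleIso-sym iso
    ; equivariant = λ r y → injective (ρ'.≈ᴹ-trans (to-from _)
        (ρ'.≈ᴹ-sym (ρ'.≈ᴹ-trans (equivariant r _) (ρ'.act-cong (Group.refl Γ') (to-from y))))) }
    where
    open Intertwiner I
    module ρ' = Representation ρ'

  module _ (ρ : Representation Γ R) (ρ' : Representation Γ' R) (I : Intertwiner {Γ} {Γ'} _↝_ ρ ρ')
           {P : Representation.Carrierᴹ ρ → Set} {P' : Representation.Carrierᴹ ρ' → Set}
           (closed : IsSubrepresentation ρ P) (closed' : IsSubrepresentation ρ' P') where
    private
      module ρ' = Representation ρ'
      module S = Representation (subrepresentation ρ {P} closed)
      module S' = Representation (subrepresentation ρ' {P'} closed')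
    open Intertwiner I

    subrepresentation-≃ : (∀ x → P x → P' (to x)) → (∀ y → P' y → P (from y)) →
      Intertwiner {Γ} {Γ'} _↝_ (subrepresentation ρ {P} closed) (subrepresentation ρ' {P'} closed')
    subrepresentation-≃ P→P' P'→P = record
      { iso = record
        { to        = λ (x , p) → to x , P→P' x p
        ; from      = λ (y , p) → from y , P'→P y p
        ; to-linear = linear R S.space S'.space _ to-cong (λ _ _ → to-+ _ _) (λ _ _ → to-*ₗ _ _)
        ; from-cong = from-cong
        ; to-from   = λ _ → to-from _
        ; from-to   = λ _ → from-to _ }
      ; equivariant = λ r _ → equivariant r _ }

module _ {Γ Γ' : Grp} {_↝_ : Group.Carrier Γ → Group.Carrier Γ' → Set} {R : CRing}
         (ρ : Representation Γ R) (ρ' : Representation Γ' R) (I : Intertwiner {Γ} {Γ'} _↝_ ρ ρ')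
         {z : Group.Carrier Γ} {z' : Group.Carrier Γ'} (z↝z' : z ↝ z') where
  private
    module ρ = Representation ρ
    module ρ' = Representation ρ'
    module Act' = IsLinear (ρ'.act-linear z')
  open Intertwiner I

  evaluate-natural : ∀ p x → to (evaluate ρ p (ρ.act z) x) ρ'.≈ᴹ evaluate ρ' p (ρ'.act z') (to x)
  evaluate-natural []      x = to-0
  evaluate-natural (a ∷ p) x = ρ'.≈ᴹ-trans (to-+ _ _) (ρ'.+ᴹ-cong (to-*ₗ _ _)
    (ρ'.≈ᴹ-trans (equivariant z↝z' _) (Act'.⟦⟧-cong (evaluate-natural p x))))

  to-kernel : ∀ p x → evaluate ρ p (ρ.act z) x ρ.≈ᴹ ρ.0ᴹ →
              evaluate ρ' p (ρ'.act z') (to x) ρ'.≈ᴹ ρ'.0ᴹ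
  to-kernel p x h = ρ'.≈ᴹ-trans (ρ'.≈ᴹ-sym (evaluate-natural p x)) (ρ'.≈ᴹ-trans (to-cong h) to-0)

  to-eigenvector : ∀ a x → ρ.act z x ρ.≈ᴹ a ρ.*ₗ x → ρ'.act z' (to x) ρ'.≈ᴹ a ρ'.*ₗ to x
  to-eigenvector a x h = ρ'.≈ᴹ-trans (ρ'.≈ᴹ-sym (equivariant z↝z' x))
    (ρ'.≈ᴹ-trans (to-cong h) (to-*ₗ a x))

module _ {Γ Γ' : Grp} {_↝_ : Group.Carrier Γ → Group.Carrier Γ' → Set} {R : CRing}
         (ρ : Representation Γ R) (ρ' : Representation Γ' R) (I : Intertwiner {Γ} {Γ'} _↝_ ρ ρ')
         {z : Group.Carrier Γ} {z' : Group.Carrier Γ'} (z↝z' : z ↝ z')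
         (central : IsCentral Γ z) (central' : IsCentral Γ' z') where

  -- Since `z` is paired with `z'`, the isomorphism carries any polynomial in `z` to the same
  -- polynomial in `z'`; the inverse intertwiner gives the opposite inclusion.
  kernel-≃ : ∀ p → Intertwiner {Γ} {Γ'} _↝_ (kernel ρ z central p) (kernel ρ' z' central' p)
  kernel-≃ p = subrepresentation-≃ ρ ρ' I _ _ (to-kernel ρ ρ' I z↝z' p)
    (to-kernel ρ' ρ (Intertwiner-sym {Γ} {Γ'} {_↝_} I) z↝z' p)

  eigenspace-≃ : ∀ a → Intertwiner {Γ} {Γ'} _↝_ (eigenspace ρ z central a) (eigenspace ρ' z' central' a)
  eigenspace-≃ a = subrepresentation-≃ ρ ρ' I _ _ (to-eigenvector ρ ρ' I z↝z' a)
    (to-eigenvector ρ' ρ (Intertwiner-sym {Γ} {Γ'} {_↝_} I) z↝z' a)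

module _ {Γ Γ' : Grp} {R S : CRing} (φ : R ⟶ S) (ρ : Representation Γ R) (ρ' : Representation Γ' R) where
  private
    module S = CommutativeRing S
    module ρ = Representation ρ
    module ρ' = Representation ρ'

  tensor-respects : (i : ModuleIso R ρ.space ρ'.space) → ∀ {s t} → TensorRelation φ ρ s t →
    _≋_ S (TensorRelation φ ρ') (mapLin (map₁ (ModuleIso.to i)) s) (mapLin (map₁ (ModuleIso.to i)) t)
  tensor-respects i (⊗-cong p q)     = relation (⊗-cong (ModuleIso.to-cong i p) q)
  tensor-respects i (⊗-addˡ x y b)   = ≋-trans (relation (⊗-cong (ModuleIso.to-+ i x y) S.refl))
                                               (relation (⊗-addˡ _ _ _))
  tensor-respects i (⊗-addʳ x b c)   = relation (⊗-addʳ _ _ _)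
  tensor-respects i (balanced a x b) = ≋-trans (relation (⊗-cong (ModuleIso.to-*ₗ i a x) S.refl))
                                               (relation (balanced _ _ _))
  tensor-respects i (⊗-scale c x b)  = relation (⊗-scale _ _ _)

module _ {Γ Γ' : Grp} {_↝_ : Group.Carrier Γ → Group.Carrier Γ' → Set} {R S : CRing} (φ : R ⟶ S)
         (ρ : Representation Γ R) (ρ' : Representation Γ' R) (I : Intertwiner {Γ} {Γ'} _↝_ ρ ρ') where
  private
    module S = CommutativeRing S
    module ρ = Representation ρ
    module ρ' = Representation ρ'
  open Intertwiner I

  extendScalars-≃ : Intertwiner {Γ} {Γ'} _↝_ (extendScalars φ ρ) (extendScalars φ ρ')
  extendScalars-≃ = record
    { iso = presentedModule-≃ {_≐_ = TensorRelation φ ρ} {_≐'_ = TensorRelation φ ρ'}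
        (map₁ to) (map₁ from)
        (tensor-respects φ ρ ρ' iso) (tensor-respects φ ρ' ρ (ModuleIso-sym iso))
        (λ _ → relation (⊗-cong (to-from _) S.refl)) (λ _ → relation (⊗-cong (from-to _) S.refl))
    ; equivariant = λ {s} {s'} r → mapLin-square (TensorRelation φ ρ')
        (map₁ to) (map₁ (ρ.act s)) (map₁ (ρ'.act s')) (map₁ to)
        (λ _ → relation (⊗-cong (equivariant r _) S.refl)) }

module _ {Γ Γ' : Grp} (ℓ : ℕ) (ρ : Representation Γ ℤ-ring) (ρ' : Representation Γ' ℤ-ring) where
  private
    module ρ = Representation ρ
    module ρ' = Representation ρ'
    module T = Tate ℓ ρ
    module T' = Tate ℓ ρ'
    open Tate.TateElement

  mapTate : {f : ρ.Carrierᴹ → ρ'.Carrierᴹ} → IsLinear ℤ-ring ρ.space ρ'.space f →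
            T.TateElement → T'.TateElement
  mapTate {f} f-linear x = record
    { component  = λ k → f (component x k)
    ; torsion    = λ k → ρ'.≈ᴹ-trans (ρ'.≈ᴹ-sym (*ₗ-homo _ _)) (ρ'.≈ᴹ-trans (⟦⟧-cong (torsion x k)) 0ᴹ-homo)
    ; compatible = λ k → ρ'.≈ᴹ-trans (ρ'.≈ᴹ-sym (*ₗ-homo _ _)) (⟦⟧-cong (compatible x k)) }
    where open IsLinear f-linear

module _ {Γ Γ' : Grp} {_↝_ : Group.Carrier Γ → Group.Carrier Γ' → Set} (ℓ : ℕ)
         (ρ : Representation Γ ℤ-ring) (ρ' : Representation Γ' ℤ-ring) (I : Intertwiner {Γ} {Γ'} _↝_ ρ ρ') where
  private
    module T = Tate ℓ ρ
    module T' = Tate ℓ ρ'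
  open Intertwiner I

  tate-≃ : Intertwiner {Γ} {Γ'} _↝_ T.tate T'.tate
  tate-≃ = record
    { iso = record
      { to        = mapTate ℓ ρ ρ' to-linear
      ; from      = mapTate ℓ ρ' ρ from-linear
      ; to-linear = linear (ℤ⟨ℓ⟩ ℓ) T.tateSpace T'.tateSpace _ (λ p k → to-cong (p k))
          (λ _ _ _ → to-+ _ _) (λ _ _ _ → to-*ₗ _ _)
      ; from-cong = λ p k → from-cong (p k)
      ; to-from   = λ _ _ → to-from _
      ; from-to   = λ _ _ → from-to _ }
    ; equivariant = λ r _ _ → equivariant r _ }

-- Transport of places and of divisor classes along an isomorphism of function fields.

module _ (k : Field) {F F' : CRing} (const : ∣ k ∣ ⟶ F) (const' : ∣ k ∣ ⟶ F') where
  private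
    module F = CommutativeRing F
    module F' = CommutativeRing F'
    module D = DivisorClasses k F const
    module D' = DivisorClasses k F' const'
    module const = _⟶_ const
    module const' = _⟶_ const'

  open D.Place

  transport : (φ : F ≃ᴿ F') → (∀ a → _≃ᴿ_.to φ const.⟦ a ⟧ F'.≈ const'.⟦ a ⟧) → D.Place → D'.Place
  transport φ φ-const P = record
    { v            = λ x → v P (from x)
    ; v-cong       = λ p → v-cong P (From.⟦⟧-cong p)
    ; v-∞          = λ x → mk⇔
        (λ p → F'.trans (F'.sym (to-from x)) (F'.trans
          (To.⟦⟧-cong (Equivalence.to (v-∞ P _) p)) To.0#-homo))
        (λ p → Equivalence.from (v-∞ P _) (F.trans (From.⟦⟧-cong p) From.0#-homo))
    ; v-*          = λ x y → ≡.trans (v-cong P (From.*-homo x y)) (v-* P _ _)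
    ; v-+          = λ m x y p q → ≡.subst (MaybeAll.All (m ℤ.≤_)) (v-cong P (F.sym (From.+-homo x y)))
                       (v-+ P m _ _ p q)
    ; v-const      = λ a a≉0 → ≡.trans
        (v-cong P (F.trans (From.⟦⟧-cong (F'.sym (φ-const a))) (from-to _))) (v-const P a a≉0)
    ; v-uniformise = let (x , e) = v-uniformise P in to x , ≡.trans (v-cong P (from-to x)) e }
    where open _≃ᴿ_ φ

module _ (k : Field) {F F' : CRing} (const : ∣ k ∣ ⟶ F) (const' : ∣ k ∣ ⟶ F') (φ : F ≃ᴿ F')
         (φ-const : ∀ a → CommutativeRing._≈_ F' (_≃ᴿ_.to φ (_⟶_.⟦_⟧ const a)) (_⟶_.⟦_⟧ const' a))
         (φ⁻-const : ∀ a → CommutativeRing._≈_ F (_≃ᴿ_.from φ (_⟶_.⟦_⟧ const' a)) (_⟶_.⟦_⟧ const a))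
         where
  private
    module F = CommutativeRing F
    module F' = CommutativeRing F'
    module D = DivisorClasses k F const
    module D' = DivisorClasses k F' const'
    module P = Setoid D.places
    module P' = Setoid D'.places
    open D.Place using (v-cong)
    open D'.Place using () renaming (v-cong to v'-cong)
    open Membership D'.places using (_∈_)
    open _≃ᴿ_ φ

    tr : D.Place → D'.Place
    tr = transport k const const' φ φ-const

    tr⁻ : D'.Place → D.Place
    tr⁻ = transport k const' const (≃ᴿ-sym φ) φ⁻-const

    tr-tr⁻ : ∀ Q → tr (tr⁻ Q) P'.≈ Q
    tr-tr⁻ Q x = v'-cong Q (to-from x)

    tr-injective : ∀ {P Q} → tr P P'.≈ tr Q → P P.≈ Q
    tr-injective {P} {Q} p x = ≡.trans (v-cong P (F.sym (from-to x)))
      (≡.trans (p (to x)) (v-cong Q (from-to x)))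

    ord-transport : ∀ P x → D'.ord (tr P) (to x) ≡ D.ord P x
    ord-transport P x = ≡.cong (Maybe.fromMaybe 0ℤ) (v-cong P (from-to x))

    transport-divisor : ∀ x Ps → _≋_ ℤ-ring D'.DivisorRelation
      (mapLin tr (D.divisorOn x Ps)) (D'.divisorOn (to x) (List.map tr Ps))
    transport-divisor x []       = ≋-refl
    transport-divisor x (P ∷ Ps) =
      ⊞-cong (·-cong (≡.sym (ord-transport P x)) ≋-refl) (transport-divisor x Ps)

  transport-relation : ∀ {s t} → D.DivisorRelation s t →
    _≋_ ℤ-ring D'.DivisorRelation (mapLin tr s) (mapLin tr t)
  transport-relation (D.same p) = relation (D'.same (λ x → p (from x)))
  transport-relation (D.principal x y xy Ps unique complete) =
    ≋-trans (transport-divisor x Ps) (relation (D'.principal (to x) (to y)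
      (F'.trans (F'.sym (To.*-homo x y)) (F'.trans (To.⟦⟧-cong xy) To.1#-homo))
      (List.map tr Ps)
      (UniqueListₚ.map⁺ D.places D'.places (λ {P} {Q} → tr-injective {P} {Q}) unique)
      complete'))
    where
    complete' : ∀ Q → D'.ord Q (to x) ≢ 0ℤ → Q ∈ List.map tr Ps
    -- Every place `Q` of F' is a transport, namely of `tr⁻ Q`. The order of `x` at `tr⁻ Q` is by
    -- definition that of `to x` at `Q`, so `h` is used unchanged.
    complete' Q h = Membershipₚ.∈-resp-≈ D'.places {List.map tr Ps} {tr (tr⁻ Q)} {Q} (tr-tr⁻ Q)
      (Membershipₚ.∈-map⁺ D.places D'.places {f = tr} (λ {P} {Q} p x → p (from x)) {tr⁻ Q} {Ps}
        (complete (tr⁻ Q) h))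

  degree-transport : ∀ D → D'.degree (mapLin tr D) ≡ D.degree D
  degree-transport (gen P) = ≡.refl
  degree-transport 𝟎       = ≡.refl
  degree-transport (D ⊞ E) = ≡.cong₂ ℤ._+_ (degree-transport D) (degree-transport E)
  degree-transport (⊟ D)   = ≡.cong ℤ.-_ (degree-transport D)
  degree-transport (a · D) = ≡.cong (a ℤ.*_) (degree-transport D)

module _ (k : Field) {F F' : CRing} (const : ∣ k ∣ ⟶ F) (const' : ∣ k ∣ ⟶ F') (φ : F ≃ᴿ F')
         (φ-const : ∀ a → CommutativeRing._≈_ F' (_≃ᴿ_.to φ (_⟶_.⟦_⟧ const a)) (_⟶_.⟦_⟧ const' a))
         (φ⁻-const : ∀ a → CommutativeRing._≈_ F (_≃ᴿ_.from φ (_⟶_.⟦_⟧ const' a)) (_⟶_.⟦_⟧ const a))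
         {Γ Γ' : Grp} (α : RingAction Γ F) (α' : RingAction Γ' F')
         (stable : ∀ g a → ¬ Field._≈_ k a (Field.0# k) → ∃ λ b → (¬ Field._≈_ k b (Field.0# k)) ×
            CommutativeRing._≈_ F (RingAction.act α g (_⟶_.⟦_⟧ const a)) (_⟶_.⟦_⟧ const b))
         (stable' : ∀ g a → ¬ Field._≈_ k a (Field.0# k) → ∃ λ b → (¬ Field._≈_ k b (Field.0# k)) ×
            CommutativeRing._≈_ F' (RingAction.act α' g (_⟶_.⟦_⟧ const' a)) (_⟶_.⟦_⟧ const' b))
         (_↝_ : Group.Carrier Γ → Group.Carrier Γ' → Set)
         (φ-equivariant : ∀ {s s'} → s ↝ s' → ∀ x → CommutativeRing._≈_ F'
            (_≃ᴿ_.to φ (RingAction.act α s x)) (RingAction.act α' s' (_≃ᴿ_.to φ x)))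
         where
  private
    module Γ = Group Γ
    module Γ' = Group Γ'
    module F = CommutativeRing F
    module F' = CommutativeRing F'
    module D = DivisorClasses k F const
    module D' = DivisorClasses k F' const'
    module α = RingAction α
    module α' = RingAction α'
    open _≃ᴿ_ φ

    -- A place is moved by acting with the inverse on functions, whereas `φ-equivariant` speaks of
    -- `s` itself. Writing `x` as s'(s'⁻¹ x) and pulling s' through `φ` gives from x = s (from (s'⁻¹
    -- x)), and s⁻¹ cancels.
    from-equivariant⁻¹ : ∀ {s s'} → s ↝ s' → ∀ x →
      α.act (s Γ.⁻¹) (from x) F.≈ from (α'.act (s' Γ'.⁻¹) x)
    from-equivariant⁻¹ {s} {s'} r x = F.trans
      (α.act-cong Γ.refl (F.trans (From.⟦⟧-cong (F'.trans (F'.sym (α'.act-inverseʳ s' x))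
        (F'.trans (α'.act-cong Γ'.refl (F'.sym (to-from _))) (F'.sym (φ-equivariant r _)))))
        (from-to _)))
      (α.act-inverseˡ s _)

    tr = transport k const const' φ φ-const
    tr⁻ = transport k const' const (≃ᴿ-sym φ) φ⁻-const

    Pic-≃ : Intertwiner {Γ} {Γ'} _↝_ (D.Pic α stable) (D'.Pic α' stable')
    Pic-≃ = record
      { iso = presentedModule-≃ {_≐_ = D.DivisorRelation} {_≐'_ = D'.DivisorRelation} tr tr⁻
          (transport-relation k const const' φ φ-const φ⁻-const)
          (transport-relation k const' const (≃ᴿ-sym φ) φ⁻-const φ-const)
          (λ Q → relation (D'.same (λ x → D'.Place.v-cong Q (to-from x))))
          (λ P → relation (D.same (λ x → D.Place.v-cong P (from-to x))))
      ; equivariant = λ {s} {s'} r → mapLin-square D'.DivisorRelation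
          tr (D.move α stable s) (D'.move α' stable' s') tr
          (λ P → relation (D'.same (λ x → D.Place.v-cong P (from-equivariant⁻¹ r x)))) }

  Pic⁰-≃ : Intertwiner {Γ} {Γ'} _↝_ (D.Pic⁰ α stable) (D'.Pic⁰ α' stable')
  Pic⁰-≃ = subrepresentation-≃ (D.Pic α stable) (D'.Pic α' stable') Pic-≃ _ _
    (λ x p → ≡.trans (degree-transport k const const' φ φ-const φ⁻-const x) p)
    (λ y p → ≡.trans (degree-transport k const' const (≃ᴿ-sym φ) φ⁻-const φ-const y) p)

-- Γ, Γ' and the representations J, J' are read off from the two elements: d-new is
-- built from NewPart's own copy of Jacobian, and comparing it with another copy, which
-- is only definitionally equal, is prohibitively slow.
Vℓ-kernel-≃ : ∀ {ℓ : ℕ} {ℚℓ : FractionField (ℤ⟨ℓ⟩ ℓ)} {Γ Γ' : Grp}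
  {J : Representation Γ ℤ-ring} {J' : Representation Γ' ℤ-ring} →
  Representation.Carrierᴹ (Vℓ ℓ ℚℓ J) → Representation.Carrierᴹ (Vℓ ℓ ℚℓ J') →
  {_↝_ : Group.Carrier Γ → Group.Carrier Γ' → Set} → Intertwiner {Γ} {Γ'} _↝_ J J' →
  {z : Group.Carrier Γ} {z' : Group.Carrier Γ'} → z ↝ z' →
  (central : IsCentral Γ z) (central' : IsCentral Γ' z') → ∀ p →
  Intertwiner {Γ} {Γ'} _↝_ (kernel (Vℓ ℓ ℚℓ J) z central p) (kernel (Vℓ ℓ ℚℓ J') z' central' p)
Vℓ-kernel-≃ {ℓ} {ℚℓ} {Γ} {Γ'} {J} {J'} _ _ {_↝_} I = kernel-≃ (Vℓ ℓ ℚℓ J) (Vℓ ℓ ℚℓ J')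
  (extendScalars-≃ {Γ} {Γ'} {_↝_} (FractionField.ι ℚℓ) (Tate.tate ℓ J) (Tate.tate ℓ J')
    (tate-≃ {Γ} {Γ'} {_↝_} ℓ J J' I))

-- Powers of a central symmetry acting as scalars on its eigenspace.

1^ : ∀ (R : CRing) k → let open CommutativeRing R using (_≈_; 1#)
                           open Arithmetic R using (_^_) in
     1# ^ k ≈ 1#
1^ R zero    = CommutativeRing.refl R
1^ R (suc k) = CommutativeRing.trans R (CommutativeRing.*-identityˡ R _) (1^ R k)

μ-power : ∀ (K : CRing) (d : ℕ) {ζ} → let open CommutativeRing K using (_≈_; 1#)
                                          open Arithmetic K using (_^_) in
          ζ ^ d ≈ 1# → ∀ k → (ζ ^ k) ^ d ≈ 1#
μ-power K d {ζ} ζᵈ k = begin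
  (ζ ^ k) ^ d   ≈⟨ ^-assocʳ ζ k d ⟩
  ζ ^ (k * d)   ≡⟨ ≡.cong (ζ ^_) (ℕₚ.*-comm k d) ⟩
  ζ ^ (d * k)   ≈⟨ ^-assocʳ ζ d k ⟨
  (ζ ^ d) ^ k   ≈⟨ ^-congˡ k ζᵈ ⟩
  1# ^ k        ≈⟨ 1^ K k ⟩
  1#            ∎
  where
  open CommutativeRing K hiding (_*_)
  open CommutativeExp commutativeSemiring
  open SetoidReasoning setoid

module _ {Γ : Grp} {R : CRing} (ρ : Representation Γ R) where
  private
    module Γ = Group Γ
    module R = CommutativeRing R
    open Arithmetic R using (_^_)
  open Representation ρ

  -- `h k` plays the role of t^k h(0). Giving it as a sequence allows the concrete choice (g , ζ^k),
  -- in which the power is taken in the field.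
  act-power : ∀ {t a} (h : ℕ → Γ.Carrier) → (∀ k → h (suc k) Γ.≈ t Γ.∙ h k) →
    ∀ x → act t (act (h 0) x) ≈ᴹ a *ₗ act (h 0) x →
    ∀ k → act (h k) x ≈ᴹ (a ^ k) *ₗ act (h 0) x
  act-power h step x eigen zero    = ≈ᴹ-sym (*ₗ-identityˡ _)
  act-power {t} {a} h step x eigen (suc k) = begin
    act (h (suc k)) x                  ≈⟨ act-cong (step k) ≈ᴹ-refl ⟩
    act (t Γ.∙ h k) x                  ≈⟨ act-∙ t (h k) x ⟩
    act t (act (h k) x)                ≈⟨ ⟦⟧-cong (act-power h step x eigen k) ⟩
    act t ((a ^ k) *ₗ act (h 0) x)     ≈⟨ *ₗ-homo _ _ ⟩
    (a ^ k) *ₗ act t (act (h 0) x)     ≈⟨ *ₗ-congˡ eigen ⟩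
    (a ^ k) *ₗ (a *ₗ act (h 0) x)      ≈⟨ *ₗ-assoc _ _ _ ⟨
    ((a ^ k) R.* a) *ₗ act (h 0) x     ≈⟨ *ₗ-congʳ (R.*-comm _ _) ⟩
    (a ^ suc k) *ₗ act (h 0) x         ∎
    where
    open IsLinear (act-linear t)
    open SetoidReasoning ≈ᴹ-setoid

module _ {Γ Γ' : Grp} {_↝_ : Group.Carrier Γ → Group.Carrier Γ' → Set} {R : CRing}
         (ρ : Representation Γ R) (ρ' : Representation Γ' R) (I : Intertwiner {Γ} {Γ'} _↝_ ρ ρ')
         {t : Group.Carrier Γ} {t' : Group.Carrier Γ'} (t↝t' : t ↝ t')
         (central : IsCentral Γ t) (central' : IsCentral Γ' t') (a : CommutativeRing.Carrier R) where
  private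
    module Γ' = Group Γ'
    module ρ' = Representation ρ'
    module I = Intertwiner I
    module V = Representation (eigenspace ρ t central a)
    module V' = Representation (eigenspace ρ' t' central' a)
    to = Intertwiner.to (eigenspace-≃ ρ ρ' I t↝t' central central' a)

  eigenspace-twist : ∀ {g g'} (h : ℕ → Γ'.Carrier) → h 0 Γ'.≈ g' →
    (∀ k → h (suc k) Γ'.≈ t' Γ'.∙ h k) → ∀ k → g ↝ h k → ∀ x →
    to (V.act g x) V'.≈ᴹ Arithmetic._^_ R a k V'.*ₗ V'.act g' (to x)
  eigenspace-twist h h₀ step k r x = ρ'.≈ᴹ-trans (I.equivariant r (proj₁ x))
    -- The eigenspace is stable because `t'` is central, so its membership proof for `h 0` applied
    -- to `to x` is the eigenvector hypothesis.
    (ρ'.≈ᴹ-trans (act-power ρ' h step (proj₁ (to x)) (proj₂ (V'.act (h 0) (to x))) k)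
      (ρ'.*ₗ-congˡ (ρ'.act-cong h₀ ρ'.≈ᴹ-refl)))

-- ρ ≅ ρ' ⊗ᶜ ψ, unfolded: comparing two copies of ρ' ⊗ᶜ ψ for definitional equality is
-- far slower than comparing copies of ρ'.
record TwistedIso {G : Grp} {R : CRing} (ρ ρ' : Representation G R) (ψ : Character G R) : Set where
  private
    module ρ = Representation ρ
    module ρ' = Representation ρ'
  field
    to          : ρ.Carrierᴹ → ρ'.Carrierᴹ
    isLinearIso : IsLinearIso R ρ.space ρ'.space to
    equivariant : ∀ g x → to (ρ.act g x) ρ'.≈ᴹ Character.χ ψ g ρ'.*ₗ ρ'.act g (to x)

module _ {G H : Grp} {R S : CRing} (φ : R ⟶ S) (ρ ρ' : Representation (DirectProduct.group G H) R) where
  private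
    module G = Group G
    module S = CommutativeRing S
    Γ = DirectProduct.group G H
    module Γ = Group Γ
    module ρ = Representation (extendScalars φ ρ)
    ε = Group.ε H

  -- The result runs against `I`, from ρ' to ρ. In the pairs `h g k ↝ (g , ε)` the pure Galois
  -- element acts on ρ', so the inverse of `I` turns g on ρ' into t^k g on ρ, that is, into g
  -- followed by the scalar a^k.
  eigenspace-twistedIso : {_↝_ : Γ.Carrier → Γ.Carrier → Set} → Intertwiner {Γ} {Γ} _↝_ ρ ρ' →
    {t t' : Γ.Carrier} → t ↝ t' → (central : IsCentral Γ t) (central' : IsCentral Γ t') →
    ∀ a (ψ : Character G S) (h : G.Carrier → ℕ → Γ.Carrier) →
    (∀ g → h g 0 Γ.≈ (g , ε)) → (∀ g k → h g (suc k) Γ.≈ t Γ.∙ h g k) →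
    (∀ g → ∃ λ k → (h g k ↝ (g , ε)) × Character.χ ψ g S.≈ Arithmetic._^_ S a k) →
    TwistedIso (restrictˡ {G} {H} (eigenspace (extendScalars φ ρ') t' central' a))
               (restrictˡ {G} {H} (eigenspace (extendScalars φ ρ) t central a)) ψ
  eigenspace-twistedIso {_↝_} I {t} {t'} t↝t' central central' a ψ h h₀ step twist = record
    { to          = E.to
    ; isLinearIso = E.isLinearIso
    ; equivariant = λ g x → let (k , r , e) = twist g in ρ.≈ᴹ-trans
        (eigenspace-twist {Γ} {Γ} {flip _↝_} (extendScalars φ ρ') (extendScalars φ ρ) extended
          t↝t' central' central a (h g) (h₀ g) (step g) k r x)
        (ρ.*ₗ-congʳ (S.sym e)) }
    where
    extended : Intertwiner {Γ} {Γ} (flip _↝_) (extendScalars φ ρ') (extendScalars φ ρ)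
    extended = extendScalars-≃ {Γ} {Γ} {flip _↝_} φ ρ' ρ (Intertwiner-sym {Γ} {Γ} {_↝_} I)
    module E = Intertwiner (eigenspace-≃ {Γ} {Γ} {flip _↝_} _ _ extended t↝t' central' central a)

-- The substitution y ↦ a y between two superelliptic curves, from coordinate rings to eigenspaces.

eval-power : ∀ {R S : CRing} {X : Set} (φ : R ⟶ S) (ρ : X → CommutativeRing.Carrier S) e k →
  CommutativeRing._≈_ S (eval φ ρ (power e k)) (Arithmetic._^_ S (eval φ ρ e) k)
eval-power         φ ρ e zero    = _⟶_.1#-homo φ
eval-power {S = S} φ ρ e (suc k) = CommutativeRing.*-congˡ S (eval-power φ ρ e k)

module _ (K : Field) (K̄ : AlgebraicClosure K) (d : ℕ) .{{_ : NonZero d}} where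
  open AlgebraicClosure K̄ using (ι; closure)
  private
    module K = Field K
    module K̄ = Field closure
    module ι = _⟶_ ι
    module K̄ᵃ = Arithmetic ∣ closure ∣

  module _ (f f' : Expr ∣ K ∣ ⊤) where
    private
      module C = Superelliptic K K̄ d f
      module C' = Superelliptic K K̄ d f'
      module A = CommutativeRing C.coordinateRing
      module A' = CommutativeRing C'.coordinateRing
      open CommutativeExp A'.commutativeSemiring

    module _ (a : K̄.Carrier) where

      scaledCoordinates : Coordinate → A'.Carrier
      scaledCoordinates 𝕩 = var 𝕩
      scaledCoordinates 𝕪 = con a ⊛ var 𝕪

      scale : A.Carrier → A'.Carrier
      scale = eval C'.conHom scaledCoordinates

      scale-[x] : ∀ e → scale (C._[x] e) A'.≈ C'._[x] e
      scale-[x] (con _)  = A'.refl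
      scale-[x] (var _)  = A'.refl
      scale-[x] (e ⊕ e') = A'.+-cong (scale-[x] e) (scale-[x] e')
      scale-[x] (e ⊛ e') = A'.*-cong (scale-[x] e) (scale-[x] e')
      scale-[x] (⊝ e)    = A'.-‿cong (scale-[x] e)

      module _ (scaling : con (a K̄ᵃ.^ d) ⊛ C'._[x] f' A'.≈ C'._[x] f) where

        -- On the second curve (a y)^d = a^d f' = f, the last equality being `scaling`.
        scale-equation : ∀ {e e'} → C.Equation e e' → scale e A'.≈ scale e'
        scale-equation C.equation = begin
          scale (power (var 𝕪) d)            ≈⟨ eval-power C'.conHom scaledCoordinates (var 𝕪) d ⟩
          (con a ⊛ var 𝕪) ^ d                ≈⟨ ^-distrib-* (con a) (var 𝕪) d ⟩
          con a ^ d ⊛ var 𝕪 ^ d              ≈⟨ A'.*-cong (hom-^ C'.conHom a d) (A'.sym (C'.power-^ (var 𝕪) d)) ⟩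
          con (a K̄ᵃ.^ d) ⊛ power (var 𝕪) d   ≈⟨ A'.*-congˡ (relation C'.equation) ⟩
          con (a K̄ᵃ.^ d) ⊛ C'._[x] f'        ≈⟨ scaling ⟩
          C'._[x] f                          ≈⟨ scale-[x] f ⟨
          scale (C._[x] f)                   ∎
          where open SetoidReasoning A'.setoid

        scaleHom : C.coordinateRing ⟶ C'.coordinateRing
        scaleHom = record
          { ⟦_⟧ = scale
          ; isRingHomomorphism = ringHomomorphism C.coordinateRing C'.coordinateRing scale
              (eval-cong ∣ closure ∣ C.Equation C'.conHom scaledCoordinates scale-equation)
              (λ _ _ → A'.refl) (λ _ _ → A'.refl) A'.refl }

  module _ (f f' : Expr ∣ K ∣ ⊤) {a b : K̄.Carrier} (ab : a K̄.* b K̄.≈ K̄.1#) where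
    private
      module C = Superelliptic K K̄ d f
      module A = CommutativeRing C.coordinateRing

    scale-inverse : ∀ e → scale f' f a (scale f f' b e) A.≈ e
    scale-inverse (con _)  = A.refl
    scale-inverse (var 𝕩)  = A.refl
    scale-inverse (var 𝕪)  = A.trans (A.sym (A.*-assoc (con b) (con a) (var 𝕪)))
      (A.trans (A.*-congʳ (A.trans (A.sym (con-* b a)) (con-cong (K̄.trans (K̄.*-comm b a) ab))))
        (A.*-identityˡ (var 𝕪)))
    scale-inverse (e ⊕ e') = A.+-cong (scale-inverse e) (scale-inverse e')
    scale-inverse (e ⊛ e') = A.*-cong (scale-inverse e) (scale-inverse e')
    scale-inverse (⊝ e)    = A.-‿cong (scale-inverse e)

  module _ (f f' : Expr ∣ K ∣ ⊤) (a : K̄.Carrier) where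
    private
      module C = Superelliptic K K̄ d f
      module C' = Superelliptic K K̄ d f'
      module A' = CommutativeRing C'.coordinateRing

    -- The condition under which y ↦ a y' intertwines (g , u) and (g' , u').
    _↝_ : Group.Carrier C.Symmetry → Group.Carrier C'.Symmetry → Set
    (g , u , _) ↝ (g' , u' , _) = (∀ z → Automorphism.to g z K̄.≈ Automorphism.to g' z)
                                × (ι.⟦ u ⟧ K̄.* a K̄.≈ Automorphism.to g' a K̄.* ι.⟦ u' ⟧)

    scale-equivariant : ∀ s s' → s ↝ s' → ∀ e →
      scale f f' a (RingAction.act C.coordinateAction s e) A'.≈
      RingAction.act C'.coordinateAction s' (scale f f' a e)
    scale-equivariant _ _ (gg' , _) (con z) = con-cong (gg' z)
    scale-equivariant _ _ _         (var 𝕩) = A'.refl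
    scale-equivariant _ _ (_ , ua)  (var 𝕪) = A'.trans (A'.sym (A'.*-assoc _ _ (var 𝕪)))
      (A'.trans (A'.*-congʳ (A'.trans (A'.sym (con-* _ _)) (A'.trans (con-cong ua) (con-* _ _))))
        (A'.*-assoc _ _ (var 𝕪)))
    scale-equivariant s s' r (e ⊕ e') = A'.+-cong (scale-equivariant s s' r e) (scale-equivariant s s' r e')
    scale-equivariant s s' r (e ⊛ e') = A'.*-cong (scale-equivariant s s' r e) (scale-equivariant s s' r e')
    scale-equivariant s s' r (⊝ e)    = A'.-‿cong (scale-equivariant s s' r e)

  module _ (f f' : Expr ∣ K ∣ ⊤) {a b : K̄.Carrier} (ab : a K̄.* b K̄.≈ K̄.1#) where
    private
      module C = Superelliptic K K̄ d f
      module C' = Superelliptic K K̄ d f'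
      module A = CommutativeRing C.coordinateRing
      module A' = CommutativeRing C'.coordinateRing
      module F = CommutativeRing C.functionField
      module F' = CommutativeRing C'.functionField

    module _ (scaling : con (a K̄ᵃ.^ d) ⊛ C'._[x] f' A'.≈ C'._[x] f)
             (scaling⁻ : con (b K̄ᵃ.^ d) ⊛ C._[x] f A.≈ C._[x] f') where

      coordinateRing-≃ : C.coordinateRing ≃ᴿ C'.coordinateRing
      coordinateRing-≃ = record
        { hom     = scaleHom f f' a scaling
        ; hom⁻    = scaleHom f' f b scaling⁻
        ; to-from = scale-inverse f' f ab
        ; from-to = scale-inverse f f' (K̄.trans (K̄.*-comm b a) ab) }

      functionField-≃ : C.functionField ≃ᴿ C'.functionField
      functionField-≃ = totalFractions-≃ coordinateRing-≃

      functionField-≃-const : ∀ z → _≃ᴿ_.to functionField-≃ (_⟶_.⟦_⟧ C.base∘con z)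
                                    F'.≈ _⟶_.⟦_⟧ C'.base∘con z
      functionField-≃-const _ = Fractions.cross A'.refl

      functionField-≃⁻-const : ∀ z → _≃ᴿ_.from functionField-≃ (_⟶_.⟦_⟧ C'.base∘con z)
                                     F.≈ _⟶_.⟦_⟧ C.base∘con z
      functionField-≃⁻-const _ = Fractions.cross A.refl

      functionField-≃-equivariant : ∀ {s s'} → _↝_ f f' a s s' → ∀ h →
        _≃ᴿ_.to functionField-≃ (RingAction.act (fractionAction C.coordinateAction) s h) F'.≈
        RingAction.act (fractionAction C'.coordinateAction) s' (_≃ᴿ_.to functionField-≃ h)
      functionField-≃-equivariant {s} {s'} r (z Fractions./ w ⟨ _ ⟩) = Fractions.cross
        (A'.*-cong (scale-equivariant f f' a s s' r z)
                   (A'.sym (scale-equivariant f f' a s s' r w)))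

      Jacobian-≃ : Intertwiner {C.Symmetry} {C'.Symmetry} (_↝_ f f' a) C.Jacobian C'.Jacobian
      Jacobian-≃ = Pic⁰-≃ closure C.base∘con C'.base∘con
        functionField-≃ functionField-≃-const functionField-≃⁻-const
        (fractionAction C.coordinateAction) (fractionAction C'.coordinateAction) C.stable C'.stable
        (_↝_ f f' a) (λ {s} {s'} → functionField-≃-equivariant {s} {s'})

      module _ (ζ : K.Carrier) (ζᵈ : Arithmetic._^_ ∣ K ∣ ζ d K.≈ K.1#) (ℓ : ℕ)
               (ℚℓ : FractionField (ℤ⟨ℓ⟩ ℓ)) where
        private
          module N = NewPart K K̄ d f ζ ζᵈ ℓ ℚℓ
          module N' = NewPart K K̄ d f' ζ ζᵈ ℓ ℚℓ

          -- The Galois component of t is the identity, so the condition is just ζ a = a ζ. This is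
          -- why the d-new parts and the eigenspaces for one and the same eigenvalue correspond.
          t↝t : _↝_ f f' a N.t N'.t
          t↝t = (λ _ → K̄.refl) , K̄.*-comm _ _

          module V = Representation N.d-new
          module V' = Representation N'.d-new

          module I = Intertwiner (Vℓ-kernel-≃ {ℓ} {ℚℓ} (proj₁ V.0ᴹ) (proj₁ V'.0ᴹ) {_↝_ f f' a} Jacobian-≃
            {NewPart.t K K̄ d f ζ ζᵈ ℓ ℚℓ} {NewPart.t K K̄ d f' ζ ζᵈ ℓ ℚℓ} t↝t
            (NewPart.t-central K K̄ d f ζ ζᵈ ℓ ℚℓ) (NewPart.t-central K K̄ d f' ζ ζᵈ ℓ ℚℓ) (cyclotomic d))

          to : V.Carrierᴹ → V'.Carrierᴹ
          to = I.to

          from : V'.Carrierᴹ → V.Carrierᴹ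
          from = I.from

        d-new-≃ : Intertwiner {C.Symmetry} {C'.Symmetry} (_↝_ f f' a)
          (NewPart.d-new K K̄ d f ζ ζᵈ ℓ ℚℓ) (NewPart.d-new K K̄ d f' ζ ζᵈ ℓ ℚℓ)
        -- Field by field: compared as wholes, the two types differ in the module-law proofs
        -- they contain, which Agda would normalise.
        d-new-≃ = record
          { iso = record
            { to        = to
            ; from      = from
            ; to-linear = linear _ V.space V'.space to (λ {x} {y} → I.to-cong {x} {y}) I.to-+ I.to-*ₗ
            ; from-cong = λ {x} {y} → I.from-cong {x} {y}
            ; to-from   = I.to-from
            ; from-to   = I.from-to }
          ; equivariant = λ {s} {s'} → I.equivariant {s} {s'} }

        module _ (ℚ̄ℓ : AlgebraicClosure (FractionField.field' ℚℓ))
                 (α : Field.Carrier (AlgebraicClosure.closure ℚ̄ℓ)) where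
          private
            E = ∣ AlgebraicClosure.closure ℚ̄ℓ ∣
            module E = CommutativeRing E
            module Eᵃ = Arithmetic E
            module Kᵃ = Arithmetic ∣ K ∣
            module W = Representation (NewPart.newEigenspace K K̄ d f ζ ζᵈ ℓ ℚℓ ℚ̄ℓ α)
            module W' = Representation (NewPart.newEigenspace K K̄ d f' ζ ζᵈ ℓ ℚℓ ℚ̄ℓ α)

          module _ (ψ : Character (Aut ι) E)
                   (twist : ∀ g → ∃ λ k → (ι.⟦ ζ Kᵃ.^ k ⟧ K̄.* a K̄.≈ Automorphism.to g a)
                                        × (Character.χ ψ g E.≈ α Eᵃ.^ k)) where
            private
              twisted = eigenspace-twistedIso {C.Gal} (AlgebraicClosure.ι ℚ̄ℓ)
                (NewPart.d-new K K̄ d f ζ ζᵈ ℓ ℚℓ) (NewPart.d-new K K̄ d f' ζ ζᵈ ℓ ℚℓ)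
                {_↝_ f f' a} d-new-≃
                {NewPart.t K K̄ d f ζ ζᵈ ℓ ℚℓ} {NewPart.t K K̄ d f' ζ ζᵈ ℓ ℚℓ} t↝t
                (NewPart.t-central K K̄ d f ζ ζᵈ ℓ ℚℓ) (NewPart.t-central K K̄ d f' ζ ζᵈ ℓ ℚℓ) α ψ
                -- This is t^k g: the automorphism g on constants together with y ↦ ζ^k y.
                (λ g k → g , ζ Kᵃ.^ k , μ-power ∣ K ∣ d ζᵈ k)
                (λ _ → (λ _ → K̄.refl) , K.refl) (λ _ _ → (λ _ → K̄.refl) , K.refl)
                -- For the pair (g , ζ^k), (g , 1) the intertwining condition reads ζ^k a = g(a) ·
                -- 1, which is `ga`.
                (λ g → let (k , ga , χg) = twist g in
                  k , ((λ _ → K̄.refl) , K̄.trans ga (K̄.sym (K̄.trans (K̄.*-congˡ ι.1#-homo)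
                    (K̄.*-identityʳ _)))) , χg)
              module T = TwistedIso twisted
              module Iso = IsLinearIso T.isLinearIso

              to' : W'.Carrierᴹ → W.Carrierᴹ
              to' = T.to

            newEigenspace-twistedIso : TwistedIso (NewPart.newEigenspace K K̄ d f' ζ ζᵈ ℓ ℚℓ ℚ̄ℓ α)
                                                  (NewPart.newEigenspace K K̄ d f ζ ζᵈ ℓ ℚℓ ℚ̄ℓ α) ψ
            newEigenspace-twistedIso = record
              { to          = to'
              ; isLinearIso = linearIso
                  (linear E W'.space W.space to' (λ {x} {y} → Iso.⟦⟧-cong {x} {y}) Iso.+ᴹ-homo Iso.*ₗ-homo)
                  (λ {x} {y} → Iso.injective {x} {y})
                  (λ y → proj₁ (Iso.surjective y) ,
                    proj₂ (Iso.surjective y) {proj₁ (Iso.surjective y)} (W'.≈ᴹ-refl {proj₁ (Iso.surjective y)}))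
              ; equivariant = T.equivariant }

-- Powers of the generator σ, on the radical and under the character.

nonzero-invertible : ∀ (F : Field) → let module F = Field F in
  ∀ {x} → ¬ x F.≈ F.0# → ∃ λ y → x F.* y F.≈ F.1#
nonzero-invertible F {x} x≉0 with Field.zero⊎inverse F x
... | inj₁ x≈0     = contradiction x≈0 x≉0
... | inj₂ inverse = inverse

module _ {R S : CRing} (ι : R ⟶ S) (σ : Automorphism ι) where
  private
    module S = CommutativeRing S
    module ι = _⟶_ ι
    module σ = Automorphism σ
    open Arithmetic R using (_^_)
    open Multiples (Group.monoid (Aut ι)) using () renaming (_×_ to _×ᴳ_)
    open SetoidReasoning S.setoid

  -- The factor `w` comes from the base ring and is fixed by σ, so each application contributes w
  -- itself and not a conjugate of it.
  multiple-scales : ∀ {w x} → σ.to x S.≈ ι.⟦ w ⟧ S.* x → ∀ k →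
                    Automorphism.to (k ×ᴳ σ) x S.≈ ι.⟦ w ^ k ⟧ S.* x
  multiple-scales {w} {x} p zero    = S.sym (S.trans (S.*-congʳ ι.1#-homo) (S.*-identityˡ x))
  multiple-scales {w} {x} p (suc k) = begin
    σ.to (Automorphism.to (k ×ᴳ σ) x)       ≈⟨ σ.⟦⟧-cong (multiple-scales p k) ⟩
    σ.to (ι.⟦ w ^ k ⟧ S.* x)                ≈⟨ σ.*-homo _ _ ⟩
    σ.to ι.⟦ w ^ k ⟧ S.* σ.to x             ≈⟨ S.*-cong (σ.fixes _) p ⟩
    ι.⟦ w ^ k ⟧ S.* (ι.⟦ w ⟧ S.* x)         ≈⟨ S.*-assoc _ _ _ ⟨
    (ι.⟦ w ^ k ⟧ S.* ι.⟦ w ⟧) S.* x         ≈⟨ S.*-congʳ (S.trans (S.*-comm _ _) (S.sym (ι.*-homo _ _))) ⟩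
    ι.⟦ w ^ suc k ⟧ S.* x                   ∎

module _ {G : Grp} {R : CRing} (ψ : Character G R) where
  private
    module R = CommutativeRing R
    open Arithmetic R using (_^_)
    open Multiples (Group.monoid G) using () renaming (_×_ to _×ᴳ_)
  open Character ψ

  χ-multiple : ∀ σ k → χ (k ×ᴳ σ) R.≈ χ σ ^ k
  χ-multiple σ zero    = χ-ε
  χ-multiple σ (suc k) = R.trans (χ-∙ σ (k ×ᴳ σ)) (R.*-congˡ (χ-multiple σ k))

module _ (R : CRing) where
  open CommutativeRing R hiding (_*_)
  open CommutativeExp commutativeSemiring
  open SetoidReasoning setoid

  -- Moves the outer exponent inside. It is used in K with c = n/d to produce ζ_d, and in ℚ̄ℓ with c
  -- = i(n/d) to produce the eigenvalue.
  ^-rotate : ∀ x a b c → ((x ^ a) ^ b) ^ c ≈ (x ^ c) ^ (a * b)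
  ^-rotate x a b c = begin
    ((x ^ a) ^ b) ^ c    ≈⟨ ^-congˡ c (^-assocʳ x a b) ⟩
    (x ^ (a * b)) ^ c    ≈⟨ ^-assocʳ x (a * b) c ⟩
    x ^ (a * b * c)      ≡⟨ ≡.cong (x ^_) (ℕₚ.*-comm (a * b) c) ⟩
    x ^ (c * (a * b))    ≈⟨ ^-assocʳ x c (a * b) ⟨
    (x ^ c) ^ (a * b)    ∎

-- The curves of f and c f, compared through a d-th root of c.

module _ (K : Field) (K̄ : AlgebraicClosure K) {n : ℕ} .{{_ : NonZero n}} {ζ : Field.Carrier K}
         (prim : IsPrimitiveRoot ∣ K ∣ n ζ) (f : Expr ∣ K ∣ ⊤)
         {c : Field.Carrier K} (c≉0 : ¬ Field._≈_ K c (Field.0# K))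
         {γ : Field.Carrier (AlgebraicClosure.closure K̄)} (γⁿ : IsRadical K̄ n c γ)
         (d : ℕ) .{{_ : NonZero d}} (d∣n : d ∣ n) where
  open AlgebraicClosure K̄ using (ι; closure)
  private
    module ι = _⟶_ ι
    module K̄ = Field closure
    module Kᵃ = Arithmetic ∣ K ∣
    open CommutativeExp K̄.commutativeSemiring
    module C = Superelliptic K K̄ d f
    module C' = Superelliptic K K̄ d (con c ⊛ f)
    module A = CommutativeRing C.coordinateRing
    module A' = CommutativeRing C'.coordinateRing

    γ⁻¹ = nonzero-invertible closure (Kummer.γ≉0 K K̄ n prim c≉0 γⁿ)
    -- As (n/d) d = n, this is a d-th root of c, and `b` below is its inverse.
    a = γ ^ (n / d)
    b = proj₁ γ⁻¹ ^ (n / d)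

    aᵈ : a ^ d K̄.≈ ι.⟦ c ⟧
    aᵈ = K̄.trans (^-assocʳ γ (n / d) d) (K̄.trans (^-congʳ γ (ℕ/.m/n*n≡m d∣n)) γⁿ)

    ab : a K̄.* b K̄.≈ K̄.1#
    ab = K̄.trans (K̄.sym (^-distrib-* γ _ (n / d)))
      (K̄.trans (^-congˡ (n / d) (proj₂ γ⁻¹)) (1^ ∣ closure ∣ (n / d)))

    bᵈc : b ^ d K̄.* ι.⟦ c ⟧ K̄.≈ K̄.1#
    bᵈc = K̄.trans (K̄.*-congˡ (K̄.sym aᵈ)) (K̄.trans (K̄.sym (^-distrib-* b a d))
      (K̄.trans (^-congˡ d (K̄.trans (K̄.*-comm b a) ab)) (1^ ∣ closure ∣ d)))

    scaling : con (a ^ d) ⊛ C._[x] f A.≈ C._[x] (con c ⊛ f)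
    scaling = A.*-congʳ (con-cong aᵈ)

    scaling⁻ : con (b ^ d) ⊛ C'._[x] (con c ⊛ f) A'.≈ C'._[x] f
    scaling⁻ = A'.trans (A'.sym (A'.*-assoc _ _ _)) (A'.trans
      (A'.*-congʳ (A'.trans (A'.sym (con-* _ _)) (con-cong bᵈc))) (A'.*-identityˡ _))

  module _ {ζd : Field.Carrier K} (ζdᵈ : Field._≈_ K (ζd Kᵃ.^ d) (Field.1# K))
           (ℓ : ℕ) (ℚℓ : FractionField (ℤ⟨ℓ⟩ ℓ)) (ℚ̄ℓ : AlgebraicClosure (FractionField.field' ℚℓ))
           (α : Field.Carrier (AlgebraicClosure.closure ℚ̄ℓ))
           (ψ : Character (Aut ι) ∣ AlgebraicClosure.closure ℚ̄ℓ ∣) where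
    private
      module E = CommutativeRing ∣ AlgebraicClosure.closure ℚ̄ℓ ∣
      module Eᵃ = Arithmetic ∣ AlgebraicClosure.closure ℚ̄ℓ ∣

    twisted-newEigenspace :
      (∀ g → ∃ λ k → (ι.⟦ ζd Kᵃ.^ k ⟧ K̄.* γ ^ (n / d) K̄.≈ Automorphism.to g (γ ^ (n / d)))
                   × (Character.χ ψ g E.≈ α Eᵃ.^ k)) →
      TwistedIso (NewPart.newEigenspace K K̄ d f ζd ζdᵈ ℓ ℚℓ ℚ̄ℓ α)
                 (NewPart.newEigenspace K K̄ d (con c ⊛ f) ζd ζdᵈ ℓ ℚℓ ℚ̄ℓ α) ψ
    -- The curve of c f comes first: the substitution sends its y to a y on the curve of f, since
    -- a^d f = c f. The reversal in `eigenspace-twistedIso` then puts the twist on the side of c f.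
    twisted-newEigenspace = newEigenspace-twistedIso K K̄ d (con c ⊛ f) f {a} {b} ab scaling scaling⁻ ζd ζdᵈ ℓ ℚℓ ℚ̄ℓ α ψ

  V-twistedIso : ∀ ℓ (ℚℓ : FractionField (ℤ⟨ℓ⟩ ℓ)) (ℚ̄ℓ : AlgebraicClosure (FractionField.field' ℚℓ)) →
    let E = ∣ AlgebraicClosure.closure ℚ̄ℓ ∣
        module E = CommutativeRing E
        module Eᵃ = Arithmetic E
    in
    (ζℓ : E.Carrier) (i : ℕ) (ψ : Character (Aut ι) E) →
    (∀ g → ∃ λ k → (ι.⟦ (ζ Kᵃ.^ (n / d)) Kᵃ.^ k ⟧ K̄.* γ ^ (n / d) K̄.≈ Automorphism.to g (γ ^ (n / d)))
                 × (Character.χ ψ g E.≈ ((ζℓ Eᵃ.^ (n / d)) Eᵃ.^ i) Eᵃ.^ k)) →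
    TwistedIso (V⁽ i ⁾ K̄ prim ℓ ℚℓ ℚ̄ℓ ζℓ d d∣n f) (V⁽ i ⁾ K̄ prim ℓ ℚℓ ℚ̄ℓ ζℓ d d∣n (con c ⊛ f)) ψ
  V-twistedIso ℓ ℚℓ ℚ̄ℓ ζℓ i ψ = twisted-newEigenspace {ζ Kᵃ.^ (n / d)} (ζ-power ∣ K ∣ d∣n (proj₁ prim)) ℓ ℚℓ ℚ̄ℓ
    ((ζℓ Eᵃ.^ (n / d)) Eᵃ.^ i) ψ
    where module Eᵃ = Arithmetic ∣ AlgebraicClosure.closure ℚ̄ℓ ∣

lemma5p4 :
  -- K is the fraction field of a complete DVR with residue characteristic p.
  (O : CompleteDVR) (p : ℕ) → CompleteDVR.HasResidueCharacteristic O p →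
  (K : Field) (O→K : CompleteDVR.commutativeRing O ⟶ ∣ K ∣) → IsFractionField K O→K →
  (K̄ : AlgebraicClosure K) →
  let module K = Field K
      module Kᵃ = Arithmetic ∣ K ∣
      closure = AlgebraicClosure.closure K̄
  in
  (n : ℕ) .{{_ : NonZero n}} → ¬ p ∣ n →
  (ζ : K.Carrier) (ζ-prim : IsPrimitiveRoot ∣ K ∣ n ζ) →
  -- f has nonzero discriminant and all its roots in K.
  (f : Expr ∣ K ∣ ⊤) (split : Splitting K f) → ¬ Splitting.discriminant split K.≈ K.0# →
  (c : K.Carrier) (c≉0 : ¬ c K.≈ K.0#) →
  (ℓ : ℕ) → Prime ℓ → ℓ ≢ p →
  (ℚℓ : FractionField (ℤ⟨ℓ⟩ ℓ)) (ℚ̄ℓ : AlgebraicClosure (FractionField.field' ℚℓ)) →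
  let E = AlgebraicClosure.closure ℚ̄ℓ
      module E = Field E
      module Eᵃ = Arithmetic ∣ E ∣
  in
  (ζℓ : E.Carrier) → IsPrimitiveRoot ∣ E ∣ n ζℓ →
  -- L = K[γ] with γⁿ = c, r = [L : K], and σ : γ ↦ ζ^(n/r) γ generates Gal(L/K).
  (γ : Field.Carrier closure) (γⁿ : IsRadical K̄ n c γ) →
  let open Kummer K K̄ n ζ-prim c≉0 γⁿ
      module L = CommutativeRing L
      γᴸ = Adjoin.generator (AlgebraicClosure.ι K̄) γ
  in
  (r : ℕ) .{{_ : NonZero r}} → HasDegree K K→L r →
  (σ : Automorphism K→L) → Generates (Aut K→L) σ →
  Automorphism.to σ γᴸ L.≈ (_⟶_.⟦_⟧ K→L (ζ Kᵃ.^ (n / r)) L.* γᴸ) →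
  (χ : Character (Aut K→L) ∣ E ∣) → Character.χ χ σ E.≈ (ζℓ Eᵃ.^ (n / r)) →
  (d : ℕ) .{{_ : NonZero d}} (d∣n : d ∣ n) →
  (i : ℕ) → 1 ≤ i → i ≤ n → Coprime i n →
  -- On C_d the twist χ^i of C_n = C reads χ^(i·n/d), because C_d ≅ C_d'
  -- over K̄ is given by y ↦ γ^(n/d) y.
  let V = V⁽ i ⁾ K̄ ζ-prim ℓ ℚℓ ℚ̄ℓ ζℓ d d∣n in
  V f ≅ (V (con c ⊛ f) ⊗ᶜ inflate χ ^ᶜ (i * (n / d)))
lemma5p4 O p residue K O→K frac K̄ n p∤n ζ ζ-prim f split disc c c≉0 ℓ ℓ-prime ℓ≢p ℚℓ ℚ̄ℓ ζℓ ζℓ-prim γ γⁿ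
  r degree σ generates σγ χ χσ d d∣n i 1≤i i≤n coprime =
  record { to = T.to ; isLinearIso = T.isLinearIso ; equivariant = T.equivariant }
  where
  open AlgebraicClosure K̄ using (ι; closure)
  open Kummer K K̄ n ζ-prim c≉0 γⁿ
  module ι = _⟶_ ι
  module K̄ = Field closure
  module E = Field (AlgebraicClosure.closure ℚ̄ℓ)
  module Kᵃ = Arithmetic ∣ K ∣
  module Eᵉ = CommutativeExp E.commutativeSemiring
  open CommutativeExp K̄.commutativeSemiring

  twist : ∀ g → ∃ λ k →
    (ι.⟦ (ζ Kᵃ.^ (n / d)) Kᵃ.^ k ⟧ K̄.* γ ^ (n / d) K̄.≈ Automorphism.to g (γ ^ (n / d)))
    × (Character.χ (inflate χ ^ᶜ (i * (n / d))) g E.≈ ((ζℓ Eᵉ.^ (n / d)) Eᵉ.^ i) Eᵉ.^ k)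
  -- With g equal to σ^j on L, g multiplies γ by ζ^((n/r) j) and χ(g) = ζℓ^((n/r) j). The same
  -- exponent thus serves in K̄ and in ℚ̄ℓ.
  twist g = (n / r) * j , galois , character
    where
    module g = Automorphism g
    gHom : ∣ closure ∣ ⟶ ∣ closure ∣
    gHom = record { ⟦_⟧ = g.to ; isRingHomomorphism = g.isRingHomomorphism }
    m = n / d
    j = proj₁ (generates (restriction g))
    g≈jσ = proj₂ (generates (restriction g))
    ω = (ζ Kᵃ.^ (n / r)) Kᵃ.^ j

    gγ : g.to γ K̄.≈ ι.⟦ ω ⟧ K̄.* γ
    -- g and σ^j are compared only on L, which contains γ; this suffices because a is a power of γ.
    gγ = K̄.trans (g≈jσ (Adjoin.generator ι γ)) (multiple-scales K→L σ σγ j)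

    galois : ι.⟦ (ζ Kᵃ.^ m) Kᵃ.^ ((n / r) * j) ⟧ K̄.* γ ^ m K̄.≈ g.to (γ ^ m)
    galois = begin
      ι.⟦ (ζ Kᵃ.^ m) Kᵃ.^ ((n / r) * j) ⟧ K̄.* γ ^ m  ≈⟨ K̄.*-congʳ (ι.⟦⟧-cong (^-rotate ∣ K ∣ ζ (n / r) j m)) ⟨
      ι.⟦ ω Kᵃ.^ m ⟧ K̄.* γ ^ m                       ≈⟨ K̄.*-congʳ (hom-^ ι ω m) ⟨
      ι.⟦ ω ⟧ ^ m K̄.* γ ^ m                          ≈⟨ ^-distrib-* ι.⟦ ω ⟧ γ m ⟨
      (ι.⟦ ω ⟧ K̄.* γ) ^ m                            ≈⟨ ^-congˡ m gγ ⟨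
      g.to γ ^ m                                     ≈⟨ hom-^ gHom γ m ⟩
      g.to (γ ^ m)                                   ∎
      where open SetoidReasoning K̄.setoid

    character : Character.χ χ (restriction g) Eᵉ.^ (i * m) E.≈ ((ζℓ Eᵉ.^ m) Eᵉ.^ i) Eᵉ.^ ((n / r) * j)
    character = begin
      Character.χ χ (restriction g) Eᵉ.^ (i * m)        ≈⟨ Eᵉ.^-congˡ (i * m) χg ⟩
      ((ζℓ Eᵉ.^ (n / r)) Eᵉ.^ j) Eᵉ.^ (i * m)           ≈⟨ ^-rotate ∣ AlgebraicClosure.closure ℚ̄ℓ ∣ ζℓ (n / r) j (i * m) ⟩
      (ζℓ Eᵉ.^ (i * m)) Eᵉ.^ ((n / r) * j)              ≡⟨ ≡.cong (λ e → (ζℓ Eᵉ.^ e) Eᵉ.^ ((n / r) * j)) (ℕₚ.*-comm i m) ⟩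
      (ζℓ Eᵉ.^ (m * i)) Eᵉ.^ ((n / r) * j)              ≈⟨ Eᵉ.^-congˡ ((n / r) * j) (Eᵉ.^-assocʳ ζℓ m i) ⟨
      ((ζℓ Eᵉ.^ m) Eᵉ.^ i) Eᵉ.^ ((n / r) * j)           ∎
      where
      open SetoidReasoning E.setoid
      χg : Character.χ χ (restriction g) E.≈ (ζℓ Eᵉ.^ (n / r)) Eᵉ.^ j
      χg = E.trans (Character.χ-cong χ g≈jσ) (E.trans (χ-multiple χ σ j) (Eᵉ.^-congˡ j χσ))

  T : TwistedIso (V⁽ i ⁾ K̄ ζ-prim ℓ ℚℓ ℚ̄ℓ ζℓ d d∣n f) (V⁽ i ⁾ K̄ ζ-prim ℓ ℚℓ ℚ̄ℓ ζℓ d d∣n (con c ⊛ f))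
                 (Kummer.inflate K K̄ n ζ-prim c≉0 γⁿ χ ^ᶜ (i * (n / d)))
  T = V-twistedIso K K̄ ζ-prim f c≉0 γⁿ d d∣n ℓ ℚℓ ℚ̄ℓ ζℓ i
    (Kummer.inflate K K̄ n ζ-prim c≉0 γⁿ χ ^ᶜ (i * (n / d))) twist
  module T = TwistedIso T
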